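{- There is a data structure using $O(nd)$ space for the Online Quadratic-Form Sampling Problem supporting the following operations: $\textsc{Init}(n,d,\{v_1,\dots,v_n\}\subset\mathbb{R}^d,\{\alpha_1,\dots,\alpha_n\}\subset\mathbb{R})$ preprocesses in time $O(nd^{\omega-1})$; and $\textsc{Query}(A)$, given a positive semidefinite matrix $A\in\mathbb{R}^{d\times d}$, outputs a sample $i\in[n]$ distributed exactly according to $\mathcal{D}_A$, in time $O(d^2\log(n/d)+d^\omega)$.
   Context: Online Quadratic-Form Sampling Problem: given $n$ vectors $v_1,\dots,v_n\in\mathbb{R}^d$ and $n$ coefficients $\alpha_1,\dots,\alpha_n$, for any queried positive semidefinite $A\in\mathbb{R}^{d\times d}$, output a sample $i\in[n]$ from the distribution $\mathcal{D}_A$ given by $\Pr_{\mathcal{D}_A}[i]=\frac{\alpha_i v_i^\top Av_i}{\sum_{j=1}^n\alpha_jv_j^\top Av_j}$ for $i\in[n]$. $\omega\approx2.373$ is the exponent of matrix multiplication. -}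

module Defs where

open import Level using (Level; _⊔_) renaming (suc to lsuc)
open import Algebra.Bundles using (CommutativeRing)
import Algebra.Properties.Monoid.Mult as Mult
import Algebra.Properties.Monoid.Sum as Sum
open import Data.Bool using (if_then_else_)
open import Data.Fin using (Fin; toℕ)
open import Data.Nat as ℕ using (ℕ; suc; ⌊_/2⌋)
import Data.Nat.Properties as ℕ
open import Data.Product using (_×_; ∃; ∃-syntax)
open import Data.Sum using (_⊎_; inj₁; inj₂)
open import Data.Sum.Properties using (≡-dec)
open import Data.Unit.Polymorphic using (⊤)
open import Relation.Binary.Core using (Rel)
open import Relation.Binary.Definitions using (DecidableEquality)
open import Relation.Binary.PropositionalEquality using (_≡_)
open import Relation.Binary.Structures using (IsDecTotalOrder)
open import Relation.Nullary using (¬_; does)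
open import Relation.Unary using (Pred)

private variable
  a : Level
  B : Set a

------------------------------------------------------------------------
-- The library has no real numbers, so ℝ is given by its axioms: the
-- complete ordered field, unique up to isomorphism.  The order is decidable
-- because the theory is classical.  For each base b ≥ 1 the laws of _^_
-- determine x ↦ b ^ x: homomorphy and b ^ 1 = b fix it on the rationals,
-- monotonicity then on all reals.  Nothing is said of bases below 1, nor of
-- the value of 0# ⁻¹.

record RealNumbers (c ℓ₁ ℓ₂ : Level) : Set (lsuc (c ⊔ ℓ₁ ⊔ ℓ₂)) where
  field
    commutativeRing : CommutativeRing c ℓ₁

  open CommutativeRing commutativeRing public

  infix  4 _≤_
  infixr 8 _^_
  infix  9 _⁻¹

  field
    _≤_             : Rel Carrier ℓ₂
    isDecTotalOrder : IsDecTotalOrder _≈_ _≤_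
    +-monoʳ-≤       : ∀ z {x y} → x ≤ y → z + x ≤ z + y
    *-nonNegative   : ∀ {x y} → 0# ≤ x → 0# ≤ y → 0# ≤ x * y

    0≉1             : ¬ 0# ≈ 1#
    _⁻¹             : Carrier → Carrier
    ⁻¹-cong         : ∀ {x y} → x ≈ y → x ⁻¹ ≈ y ⁻¹
    ⁻¹-inverseʳ     : ∀ {x} → ¬ x ≈ 0# → x * x ⁻¹ ≈ 1#

    supremum        : (P : Pred Carrier (c ⊔ ℓ₁ ⊔ ℓ₂)) → ∃ P →
                      (∃[ b ] (∀ x → P x → x ≤ b)) →
                      ∃[ s ] ((∀ x → P x → x ≤ s) ×
                              (∀ b → (∀ x → P x → x ≤ b) → s ≤ b))

    _^_             : Carrier → Carrier → Carrier
    ^-cong          : ∀ {b b′ x x′} → b ≈ b′ → x ≈ x′ → b ^ x ≈ b′ ^ x′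
    ^-homo-+        : ∀ {b} → 1# ≤ b → ∀ x y → b ^ (x + y) ≈ b ^ x * b ^ y
    ^-identityʳ     : ∀ {b} → 1# ≤ b → b ^ 1# ≈ b
    ^-monoʳ-≤       : ∀ {b} → 1# ≤ b → ∀ {x y} → x ≤ y → b ^ x ≤ b ^ y

  fromℕ : ℕ → Carrier
  fromℕ n = Mult._×_ +-monoid n 1#

------------------------------------------------------------------------
-- Names of registers and arrays.  The io names carry inputs and outputs;
-- programs may use both kinds as working memory.

Name : Set
Name = ℕ ⊎ ℕ

pattern io  k = inj₁ k
pattern var k = inj₂ k

_≟ᴺ_ : DecidableEquality Name
_≟ᴺ_ = ≡-dec ℕ._≟_ ℕ._≟_

_[_↦_] : (Name → B) → Name → B → (Name → B)
(f [ x ↦ b ]) y = if does (y ≟ᴺ x) then b else f y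

_[_,_↦_] : (Name → ℕ → B) → Name → ℕ → B → (Name → ℕ → B)
(f [ x , i ↦ b ]) y j =
  if does (y ≟ᴺ x) then (if does (j ℕ.≟ i) then b else f y j) else f y j

------------------------------------------------------------------------
-- Programs of a randomised real RAM.  Registers hold integers; arrays hold
-- integers or reals and are addressed through registers.  Reals are opaque:
-- they are only combined by field operations, compared with each other, and
-- used as the bias of a coin, and are never converted into integers.

-- In "load a x", a is an integer array and x the register holding the index.
data IntExp : Set where
  const          : ℕ → IntExp
  reg            : Name → IntExp
  _⊞_ _∸_ _⊠_    : Name → Name → IntExp
  half           : Name → IntExp
  load           : Name → Name → IntExp

-- "a ! x" is the cell of the real array a whose index is in register x.
record Cell : Set where
  constructor _!_
  field
    array index : Name

data RealExp : Set where
  zero one            : RealExp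
  copy                : Cell → RealExp
  _⊕_ _⊖_ _⊗_ _⊘_     : Cell → Cell → RealExp

infix  6 _!_
infix  5 _≔_ _≔ʳ_ _!_≔ᵃ_
infixr 3 _⨾_

data Program : Set where
  skip                : Program
  _≔_                 : Name → IntExp → Program
  _!_≔ᵃ_              : Name → Name → Name → Program
  _≔ʳ_                : Cell → RealExp → Program
  _⨾_                 : Program → Program → Program
  if_<_then_else_     : Name → Name → Program → Program → Program
  ifʳ_≤_then_else_    : Cell → Cell → Program → Program → Program
  while_<_loop_        : Name → Name → Program → Program
  toss_heads_tails_   : Cell → Program → Program → Program

module RealRAM {c ℓ₁ ℓ₂ : Level} (ℝ : RealNumbers c ℓ₁ ℓ₂) where

  open RealNumbers ℝ
  open Sum +-monoid using (sum)

  record State : Set c where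
    field
      regs  : Name → ℕ
      ints  : Name → ℕ → ℕ
      reals : Name → ℕ → Carrier

  open State

  evalᶻ : IntExp → State → ℕ
  evalᶻ (const k)  s = k
  evalᶻ (reg x)    s = regs s x
  evalᶻ (x ⊞ y)    s = regs s x ℕ.+ regs s y
  evalᶻ (x ∸ y)    s = regs s x ℕ.∸ regs s y
  evalᶻ (x ⊠ y)    s = regs s x ℕ.* regs s y
  evalᶻ (half x)   s = ⌊ regs s x /2⌋
  evalᶻ (load a x) s = ints s a (regs s x)

  fetch : Cell → State → Carrier
  fetch (a ! x) s = reals s a (regs s x)

  evalʳ : RealExp → State → Carrier
  evalʳ zero     s = 0#
  evalʳ one      s = 1#
  evalʳ (copy p) s = fetch p s
  evalʳ (p ⊕ q)  s = fetch p s + fetch q s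
  evalʳ (p ⊖ q)  s = fetch p s - fetch q s
  evalʳ (p ⊗ q)  s = fetch p s * fetch q s
  evalʳ (p ⊘ q)  s = fetch p s * fetch q s ⁻¹

  Defined : RealExp → State → Set ℓ₁
  Defined (p ⊘ q) s = ¬ fetch q s ≈ 0#
  Defined _       s = ⊤

  setReg : Name → ℕ → State → State
  setReg x k s = record s { regs = regs s [ x ↦ k ] }

  setInt : Name → ℕ → ℕ → State → State
  setInt a i k s = record s { ints = ints s [ a , i ↦ k ] }

  setReal : Name → ℕ → Carrier → State → State
  setReal a i r s = record s { reals = reals s [ a , i ↦ r ] }

  -- "coin p l r" continues as l with probability p and as r otherwise.
  data Tree : Set c where
    done : State → Tree
    coin : Carrier → Tree → Tree → Tree

  _>>=_ : Tree → (State → Tree) → Tree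
  done s     >>= k = k s
  coin p l r >>= k = coin p (l >>= k) (r >>= k)

  data Leaves {ℓ} (P : Pred State ℓ) : Tree → Set (c ⊔ ℓ) where
    done : ∀ {s} → P s → Leaves P (done s)
    coin : ∀ {p l r} → Leaves P l → Leaves P r → Leaves P (coin p l r)

  -- Pr τ x k is the probability that register x finally holds k.
  Pr : Tree → Name → ℕ → Carrier
  Pr (done s)     x k = if does (regs s x ℕ.≟ k) then 1# else 0#
  Pr (coin p l r) x k = p * Pr l x k + (1# - p) * Pr r x k

  -- C ⊢ s ⇓[ t ] τ : started in s, the program C halts after at most t unit
  -- steps whatever the coins show, with tree of outcomes τ.  Every
  -- instruction and every test is one step.  Dividing by zero, or tossing a
  -- coin whose bias is not in [0,1], has no outcome.
  infix 2 _⊢_⇓[_]_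

  data _⊢_⇓[_]_ : Program → State → ℕ → Tree → Set (c ⊔ ℓ₁ ⊔ ℓ₂) where
    skip     : ∀ {s t} → skip ⊢ s ⇓[ t ] done s

    assign   : ∀ {x e s t} →
               x ≔ e ⊢ s ⇓[ suc t ] done (setReg x (evalᶻ e s) s)

    store    : ∀ {a x y s t} →
               a ! x ≔ᵃ y ⊢ s ⇓[ suc t ] done (setInt a (regs s x) (regs s y) s)

    assignʳ  : ∀ {a x e s t} → Defined e s →
               a ! x ≔ʳ e ⊢ s ⇓[ suc t ] done (setReal a (regs s x) (evalʳ e s) s)

    seq      : ∀ {C D s t u τ} {k : State → Tree} →
               C ⊢ s ⇓[ t ] τ →
               Leaves (λ s′ → D ⊢ s′ ⇓[ u ] k s′) τ →
               C ⨾ D ⊢ s ⇓[ t ℕ.+ u ] (τ >>= k)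

    ifTrue   : ∀ {x y C D s t τ} → regs s x ℕ.< regs s y →
               C ⊢ s ⇓[ t ] τ →
               if x < y then C else D ⊢ s ⇓[ suc t ] τ

    ifFalse  : ∀ {x y C D s t τ} → ¬ regs s x ℕ.< regs s y →
               D ⊢ s ⇓[ t ] τ →
               if x < y then C else D ⊢ s ⇓[ suc t ] τ

    ifʳTrue  : ∀ {p q C D s t τ} → fetch p s ≤ fetch q s →
               C ⊢ s ⇓[ t ] τ →
               ifʳ p ≤ q then C else D ⊢ s ⇓[ suc t ] τ

    ifʳFalse : ∀ {p q C D s t τ} → ¬ fetch p s ≤ fetch q s →
               D ⊢ s ⇓[ t ] τ →
               ifʳ p ≤ q then C else D ⊢ s ⇓[ suc t ] τ

    stop     : ∀ {x y C s t} → ¬ regs s x ℕ.< regs s y →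
               while x < y loop C ⊢ s ⇓[ suc t ] done s

    again    : ∀ {x y C s t τ} → regs s x ℕ.< regs s y →
               C ⨾ while x < y loop C ⊢ s ⇓[ t ] τ →
               while x < y loop C ⊢ s ⇓[ suc t ] τ

    toss     : ∀ {p C D s t τ υ} → 0# ≤ fetch p s → fetch p s ≤ 1# →
               C ⊢ s ⇓[ t ] τ → D ⊢ s ⇓[ t ] υ →
               toss p heads C tails D ⊢ s ⇓[ suc t ] coin (fetch p s) τ υ

  infix 2 _from_inTime_ensures_

  _from_inTime_ensures_ : ∀ {ℓ} → Program → State → Carrier → Pred Tree ℓ →
                          Set (c ⊔ ℓ₁ ⊔ ℓ₂ ⊔ ℓ)
  C from s inTime b ensures Post =
    ∃[ t ] ∃[ τ ] ((C ⊢ s ⇓[ t ] τ) × fromℕ t ≤ b × Post τ)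

  Vect : ℕ → Set c
  Vect d = Fin d → Carrier

  Matrix : ℕ → ℕ → Set c
  Matrix m n = Fin m → Fin n → Carrier

  mul : ∀ {l m n} → Matrix l m → Matrix m n → Matrix l n
  mul A B i k = sum (λ j → A i j * B j k)

  quadForm : ∀ {d} → Matrix d d → Vect d → Carrier
  quadForm A x = sum (λ i → sum (λ j → x i * A i j * x j))

  PSD : ∀ {d} → Matrix d d → Set (c ⊔ ℓ₁ ⊔ ℓ₂)
  PSD A = (∀ i j → A i j ≈ A j i) × (∀ x → 0# ≤ quadForm A x)

  HoldsVect : ∀ {n} → Name → Vect n → Pred State ℓ₁
  HoldsVect a x s = ∀ i → reals s a (toℕ i) ≈ x i

  HoldsMatrix : ∀ {m n} → Name → Matrix m n → Pred State ℓ₁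
  HoldsMatrix {n = n} a A s = ∀ i j → reals s a (toℕ i ℕ.* n ℕ.+ toℕ j) ≈ A i j

  -- Two d × d matrices can be multiplied in time O(d^ω).  All memory other
  -- than the inputs may initially contain anything.
  MatMulInTime : Carrier → Set (c ⊔ ℓ₁ ⊔ ℓ₂)
  MatMulInTime ω =
    ∃[ multiply ] ∃[ K ] ∀ d .{{_ : ℕ.NonZero d}} (A B : Matrix d d) s →
      regs s (io 0) ≡ d → HoldsMatrix (io 0) A s → HoldsMatrix (io 1) B s →
      multiply from s inTime fromℕ K * fromℕ d ^ ω
        ensures Leaves (HoldsMatrix (io 2) (mul A B))

  module _ {n d : ℕ} (v : Fin n → Vect d) (α : Vect n) (A : Matrix d d) where

    weight : Fin n → Carrier
    weight i = α i * quadForm A (v i)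

    𝒟 : Fin n → Carrier
    𝒟 i = weight i * sum weight ⁻¹

    -- The problem presupposes that 𝒟 is a probability distribution.  It sums
    -- to 1 as soon as its denominator is not 0.
    𝒟-IsDistribution : Set (ℓ₁ ⊔ ℓ₂)
    𝒟-IsDistribution = ¬ sum weight ≈ 0# × (∀ i → 0# ≤ 𝒟 i)

  InitInput : ∀ {n d} → (Fin n → Vect d) → Vect n → Pred State ℓ₁
  InitInput {n} {d} v α s =
    regs s (io 0) ≡ n × regs s (io 1) ≡ d ×
    HoldsMatrix (io 0) v s × HoldsVect (io 1) α s

  -- The memory of a data structure: for each k < K, the register var k and
  -- the first S cells of the arrays var k, i.e. K + 2KS cells in all.
  record SameMemory (K S : ℕ) (s s′ : State) : Set ℓ₁ where
    field
      sameRegs  : ∀ k → k ℕ.< K → regs s (var k) ≡ regs s′ (var k)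
      sameInts  : ∀ k i → k ℕ.< K → i ℕ.< S → ints s (var k) i ≡ ints s′ (var k) i
      sameReals : ∀ k i → k ℕ.< K → i ℕ.< S → reals s (var k) i ≈ reals s′ (var k) i

  -- The predicate only depends on that memory.
  OccupiesOnly : ∀ {ℓ} (K S : ℕ) → Pred State ℓ → Set (c ⊔ ℓ₁ ⊔ ℓ)
  OccupiesOnly K S Rep = ∀ s s′ → SameMemory K S s s′ → Rep s → Rep s′

{-# OPTIONS --safe #-}

-- Cut the vectors into ⌊n/d⌋ + 1 blocks of d.  The total weight of the blocks
-- before the x-th is ⟨A, Gₓ⟩, where Gₓ = Σ αᵣ vᵣ vᵣᵀ over these blocks, so once
-- the prefix sums Gₓ are stored (one d × d product per block), a binary search
-- which at each step tosses a coin with the relative weight of the lower half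
-- finds a random block in O(log (n/d)) steps of cost O(d²).  Inside a block with
-- rows V one product V A gives all weights, and the same search over their
-- prefix sums finishes the sample.
--
-- Correctness is an identity without divisions: the weight of an interval
-- times the probability of i, given that the search is in that interval, is
-- the weight of i.  It also holds for intervals of weight 0, which the search
-- must survive because both outcomes of every coin have to halt.

module Submission where

open import Defs
import Algebra.Properties.Monoid.Sum as MonoidSum
import Algebra.Properties.Ring as RingProperties
import Algebra.Properties.Semiring.Mult as SemiringMult
import Algebra.Solver.Ring.NaturalCoefficients.Default as SemiringSolver
open import Data.Bool using (Bool; true; false; _∨_; _∧_; not; if_then_else_; T)
open import Data.Bool.Properties using (∨-conicalˡ; ∨-conicalʳ; ∧-conicalˡ; ∧-conicalʳ; ∨-identityʳ)
open import Data.Fin as Fin using (Fin; toℕ; fromℕ<)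
import Data.Fin.Properties as Fin
open import Data.List.Base using (List; []; _∷_)
open import Data.List.Relation.Unary.All as All using (All; []; _∷_)
open import Data.Nat as ℕ using (ℕ; suc; z≤n; s≤s)
open import Data.Nat.Divisibility using (n∣m*n)
open import Data.Nat.DivMod
  using (_/_; _%_; m%n<n; m≡m%n+[m/n]*n; m<n⇒m%n≡m; m<n⇒m/n≡0; m*n/n≡m; m/n*n≤m; m<n*o⇒m/o<n;
      +-distrib-/-∣ˡ; [m+kn]%n≡m%n)
open import Data.Nat.Logarithm using (⌊log₂_⌋; ⌊log₂⌋-mono-≤; ⌊log₂[2^n]⌋≡n)
import Data.Nat.Properties as ℕ
open import Data.Nat.Solver using (module +-*-Solver)
open import Data.Product using (_×_; _,_; proj₁; proj₂; ∃-syntax; uncurry)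
open import Data.Sum using (_⊎_; inj₁; inj₂; [_,_]′)
open import Data.Sum.Properties using (inj₁-injective; inj₂-injective)
open import Function using (_∘_)
open import Level using (Level; _⊔_; Lift; lift)
open import Relation.Binary.PropositionalEquality as ≡ using (_≡_; _≢_; refl; cong; cong₂; subst)
import Relation.Binary.Reasoning.Setoid as SetoidReasoning
open import Relation.Binary.Structures using (IsDecTotalOrder)
open import Relation.Nullary using (¬_; Dec; yes; no; does; contradiction)
open import Relation.Nullary.Decidable using (dec-true; dec-false)
open import Relation.Unary using (Pred)

-- Ordered fields and finite sums

-- The coefficients may be negative. What is known is that every `𝒟 i` is non-negative and that the
-- total weight `W` is not 0, so all weights have the sign of `W`; multiplied by `W ⁻¹` they become
-- non-negative, which keeps every bias in [0,1].
--
-- The multiplication algorithm is an arbitrary program that may overwrite all memory. Hence it is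
-- renamed, and a frame property (a name that a program does not write keeps its contents) carries
-- the stored values across a call.
--
-- Time is a pair: unit steps, and calls at the price L d^ω each. Since ω ≥ 2 gives d ≤ d^(ω-1), the
-- n d steps of preprocessing are absorbed by n d^(ω-1) and the d² steps of a query by d^ω. The at
-- most 2n/d calls of preprocessing cost 2 L n d^(ω-1).
--
-- If n < d, even one d × d matrix exceeds n d cells; then there is a single block, no prefix sum is
-- stored, and the outer search ends at once. Otherwise the ⌊n/d⌋ + 2 prefix sums fit into 3 n d
-- cells. For the search inside a block the crude bound of d rounds is enough, because a round there
-- costs O(1) and loading the block already costs d².

module RealProperties {c ℓ₁ ℓ₂ : Level} (ℝ : RealNumbers c ℓ₁ ℓ₂) where

  open RealNumbers ℝ hiding (zero)
    renaming (refl to ≈-refl; sym to ≈-sym; trans to ≈-trans; reflexive to ≈-reflexive)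
  open IsDecTotalOrder isDecTotalOrder public
    using (_≤?_; antisym; ≤-respˡ-≈; ≤-respʳ-≈)
    renaming (refl to ≤-refl; trans to ≤-trans; reflexive to ≤-reflexive; total to ≤-total)
  open RingProperties ring using (-‿distribˡ-*; -‿distribʳ-*; -‿involutive)
  open SetoidReasoning setoid
  open SemiringSolver commutativeSemiring

  +-mono-≤ : ∀ {w x y z} → w ≤ x → y ≤ z → w + y ≤ x + z
  +-mono-≤ {w} {x} {y} {z} w≤x y≤z =
    ≤-trans (+-monoʳ-≤ w y≤z) (≤-respˡ-≈ (+-comm z w) (≤-respʳ-≈ (+-comm z x) (+-monoʳ-≤ z w≤x)))

  +-nonNegative : ∀ {x y} → 0# ≤ x → 0# ≤ y → 0# ≤ x + y
  +-nonNegative 0≤x 0≤y = ≤-respˡ-≈ (+-identityˡ 0#) (+-mono-≤ 0≤x 0≤y)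

  x≤x+y : ∀ {x y} → 0# ≤ y → x ≤ x + y
  x≤x+y {x} 0≤y = ≤-respˡ-≈ (+-identityʳ x) (+-monoʳ-≤ x 0≤y)

  [x-y]+y≈x : ∀ x y → (x - y) + y ≈ x
  [x-y]+y≈x x y = begin
    (x - y) + y    ≈⟨ +-assoc x (- y) y ⟩
    x + (- y + y)  ≈⟨ +-congˡ (-‿inverseˡ y) ⟩
    x + 0#         ≈⟨ +-identityʳ x ⟩
    x              ∎

  x-y≈z : ∀ {x y z} → x ≈ y + z → x - y ≈ z
  x-y≈z {x} {y} {z} x≈y+z = begin
    x - y          ≈⟨ +-congʳ (≈-trans x≈y+z (+-comm y z)) ⟩
    (z + y) - y    ≈⟨ +-assoc z y (- y) ⟩
    z + (y - y)    ≈⟨ +-congˡ (-‿inverseʳ y) ⟩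
    z + 0#         ≈⟨ +-identityʳ z ⟩
    z              ∎

  0≤y-x : ∀ {x y} → x ≤ y → 0# ≤ y - x
  0≤y-x {x} {y} x≤y = ≤-respˡ-≈ (-‿inverseˡ x) (≤-respʳ-≈ (+-comm (- x) y) (+-monoʳ-≤ (- x) x≤y))

  *-monoʳ-≤ : ∀ {z x y} → 0# ≤ z → x ≤ y → z * x ≤ z * y
  *-monoʳ-≤ {z} {x} {y} 0≤z x≤y =
    ≤-respʳ-≈ (≈-trans (≈-sym (distribˡ z x (y - x))) (*-congˡ (≈-trans (+-comm x _) ([x-y]+y≈x y x))))
      (x≤x+y (*-nonNegative 0≤z (0≤y-x x≤y)))

  *-monoˡ-≤ : ∀ {z x y} → 0# ≤ z → x ≤ y → x * z ≤ y * z
  *-monoˡ-≤ {z} {x} {y} 0≤z x≤y = ≤-respˡ-≈ (*-comm z x) (≤-respʳ-≈ (*-comm z y) (*-monoʳ-≤ 0≤z x≤y))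

  0≤x*x : ∀ x → 0# ≤ x * x
  0≤x*x x with ≤-total 0# x
  ... | inj₁ 0≤x = *-nonNegative 0≤x 0≤x
  ... | inj₂ x≤0 = ≤-respʳ-≈ -x*-x≈x*x (*-nonNegative 0≤-x 0≤-x)
    where
    0≤-x : 0# ≤ - x
    0≤-x = ≤-respʳ-≈ (+-identityˡ (- x)) (0≤y-x x≤0)
    -x*-x≈x*x : - x * - x ≈ x * x
    -x*-x≈x*x = begin
      - x * - x      ≈⟨ -‿distribˡ-* x (- x) ⟨
      - (x * - x)    ≈⟨ -‿cong (-‿distribʳ-* x x) ⟨
      - - (x * x)    ≈⟨ -‿involutive (x * x) ⟩
      x * x          ∎

  0≤1 : 0# ≤ 1#
  0≤1 = ≤-respʳ-≈ (*-identityˡ 1#) (0≤x*x 1#)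

  -- From x * y = 1 follows y = x * (y * y), a product of non-negative factors, so the sign of `y`
  -- needs no case distinction.
  inverse-nonNegative : ∀ {x y} → 0# ≤ x → x * y ≈ 1# → 0# ≤ y
  inverse-nonNegative {x} {y} 0≤x xy≈1 = ≤-respʳ-≈ eq (*-nonNegative 0≤x (0≤x*x y))
    where
    eq : x * (y * y) ≈ y
    eq = begin
      x * (y * y)   ≈⟨ *-assoc x y y ⟨
      (x * y) * y   ≈⟨ *-congʳ xy≈1 ⟩
      1# * y        ≈⟨ *-identityˡ y ⟩
      y             ∎

  open SemiringMult semiring using (×-homo-+; ×1-homo-*)

  fromℕ-+ : ∀ m n → fromℕ (m ℕ.+ n) ≈ fromℕ m + fromℕ n
  fromℕ-+ = ×-homo-+ 1#

  fromℕ-* : ∀ m n → fromℕ (m ℕ.* n) ≈ fromℕ m * fromℕ n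
  fromℕ-* = ×1-homo-*

  fromℕ-1 : fromℕ 1 ≈ 1#
  fromℕ-1 = +-identityʳ 1#

  fromℕ-nonNegative : ∀ n → 0# ≤ fromℕ n
  fromℕ-nonNegative ℕ.zero  = ≤-refl
  fromℕ-nonNegative (suc n) = +-nonNegative 0≤1 (fromℕ-nonNegative n)

  fromℕ-mono-≤ : ∀ {m n} → m ℕ.≤ n → fromℕ m ≤ fromℕ n
  fromℕ-mono-≤ {n = n} z≤n = fromℕ-nonNegative n
  fromℕ-mono-≤ (s≤s m≤n)   = +-monoʳ-≤ 1# (fromℕ-mono-≤ m≤n)

  -- The bias of the coin that picks the part of weight x in an interval of
  -- weight x + y.  The common sign of the weights is that of z.
  module Bias {x y z z⁻¹ : Carrier} (zz⁻¹≈1 : z⁻¹ * z ≈ 1#)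
              (0≤zx : 0# ≤ z * x) (0≤zy : 0# ≤ z * y) where

    cancel : ∀ {u} → z * u ≈ 0# → u ≈ 0#
    cancel {u} zu≈0 = begin
      u              ≈⟨ *-identityˡ u ⟨
      1# * u         ≈⟨ *-congʳ zz⁻¹≈1 ⟨
      (z⁻¹ * z) * u  ≈⟨ *-assoc z⁻¹ z u ⟩
      z⁻¹ * (z * u)  ≈⟨ *-congˡ zu≈0 ⟩
      z⁻¹ * 0#       ≈⟨ zeroʳ z⁻¹ ⟩
      0#             ∎

    -- Parts of a common sign cannot cancel. This is what makes any substitute divisor safe for an
    -- interval of weight 0.
    x+y≈0⇒x≈0 : x + y ≈ 0# → x ≈ 0#
    x+y≈0⇒x≈0 x+y≈0 = cancel (antisym zx≤0 0≤zx)
      where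
      zx≤0 : z * x ≤ 0#
      zx≤0 = ≤-respʳ-≈ (≈-trans (≈-sym (distribˡ z x y)) (≈-trans (*-congˡ x+y≈0) (zeroʳ z))) (x≤x+y 0≤zy)

    module _ {w} (inverse : (x + y) * w ≈ 1#) where

      -- `w` inverts `x + y`, so `z⁻¹ * w` inverts the non-negative `z * x + z * y`. The unknown
      -- sign then drops out of every product `u * w`, which equals `(z * u) * (z⁻¹ * w)`.
      0≤z⁻¹w : 0# ≤ z⁻¹ * w
      0≤z⁻¹w = inverse-nonNegative (+-nonNegative 0≤zx 0≤zy) (begin
        (z * x + z * y) * (z⁻¹ * w)
          ≈⟨ solve 5 (λ x y z u w → (z :* x :+ z :* y) :* (u :* w) := (u :* z) :* ((x :+ y) :* w)) ≈-refl x y z z⁻¹ w ⟩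
        (z⁻¹ * z) * ((x + y) * w)     ≈⟨ *-cong zz⁻¹≈1 inverse ⟩
        1# * 1#                       ≈⟨ *-identityˡ 1# ⟩
        1#                            ∎)

      0≤uw : ∀ {u} → 0# ≤ z * u → 0# ≤ u * w
      0≤uw {u} 0≤zu = ≤-respʳ-≈ (begin
        (z * u) * (z⁻¹ * w)
          ≈⟨ solve 4 (λ z u v w → (z :* u) :* (v :* w) := (v :* z) :* (u :* w)) ≈-refl z u z⁻¹ w ⟩
        (z⁻¹ * z) * (u * w)           ≈⟨ *-congʳ zz⁻¹≈1 ⟩
        1# * (u * w)                  ≈⟨ *-identityˡ _ ⟩
        u * w                         ∎) (*-nonNegative 0≤zu 0≤z⁻¹w)

      0≤xw : 0# ≤ x * w
      0≤xw = 0≤uw 0≤zx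

      xw≤1 : x * w ≤ 1#
      xw≤1 = ≤-respʳ-≈ (≈-trans (≈-sym (distribʳ w x y)) inverse) (x≤x+y (0≤uw 0≤zy))

      [x+y]xw≈x : (x + y) * (x * w) ≈ x
      [x+y]xw≈x = begin
        (x + y) * (x * w)   ≈⟨ solve 3 (λ x y w → (x :+ y) :* (x :* w) := ((x :+ y) :* w) :* x) ≈-refl x y w ⟩
        ((x + y) * w) * x   ≈⟨ *-congʳ inverse ⟩
        1# * x              ≈⟨ *-identityˡ x ⟩
        x                   ∎

  -- Arrays are addressed by ℕ, and sums over initial segments of ℕ can be split, flattened and
  -- shifted without casts between `Fin` types.
  Σ< : ℕ → (ℕ → Carrier) → Carrier
  Σ< ℕ.zero  f = 0#
  Σ< (suc n) f = Σ< n f + f n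

  Σ<-cong : ∀ n {f g} → (∀ i → i ℕ.< n → f i ≈ g i) → Σ< n f ≈ Σ< n g
  Σ<-cong ℕ.zero  f≈g = ≈-refl
  Σ<-cong (suc n) f≈g = +-cong (Σ<-cong n λ i i<n → f≈g i (ℕ.m<n⇒m<1+n i<n)) (f≈g n ℕ.≤-refl)

  Σ<-zero : ∀ n → Σ< n (λ _ → 0#) ≈ 0#
  Σ<-zero ℕ.zero  = ≈-refl
  Σ<-zero (suc n) = ≈-trans (+-identityʳ _) (Σ<-zero n)

  Σ<-+ : ∀ n f g → Σ< n (λ i → f i + g i) ≈ Σ< n f + Σ< n g
  Σ<-+ ℕ.zero  f g = ≈-sym (+-identityˡ 0#)
  Σ<-+ (suc n) f g = ≈-trans (+-congʳ (Σ<-+ n f g))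
    (solve 4 (λ a b c d → (a :+ b) :+ (c :+ d) := (a :+ c) :+ (b :+ d)) ≈-refl _ _ _ _)

  *-distribˡ-Σ< : ∀ n x f → x * Σ< n f ≈ Σ< n (λ i → x * f i)
  *-distribˡ-Σ< ℕ.zero  x f = zeroʳ x
  *-distribˡ-Σ< (suc n) x f = ≈-trans (distribˡ x _ _) (+-congʳ (*-distribˡ-Σ< n x f))

  *-distribʳ-Σ< : ∀ n x f → Σ< n f * x ≈ Σ< n (λ i → f i * x)
  *-distribʳ-Σ< ℕ.zero  x f = zeroˡ x
  *-distribʳ-Σ< (suc n) x f = ≈-trans (distribʳ x _ _) (+-congʳ (*-distribʳ-Σ< n x f))

  Σ<-swap : ∀ m n (f : ℕ → ℕ → Carrier) → Σ< m (λ i → Σ< n (f i)) ≈ Σ< n (λ j → Σ< m (λ i → f i j))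
  Σ<-swap ℕ.zero  n f = ≈-sym (Σ<-zero n)
  Σ<-swap (suc m) n f = ≈-trans (+-congʳ (Σ<-swap m n f)) (≈-sym (Σ<-+ n _ (f m)))

  Σ<-split : ∀ m n f → Σ< (m ℕ.+ n) f ≈ Σ< m f + Σ< n (λ i → f (m ℕ.+ i))
  Σ<-split m ℕ.zero  f rewrite ℕ.+-identityʳ m = ≈-sym (+-identityʳ _)
  Σ<-split m (suc n) f rewrite ℕ.+-suc m n     = ≈-trans (+-congʳ (Σ<-split m n f)) (+-assoc _ _ _)

  Σ<-flatten : ∀ m n f → Σ< (m ℕ.* n) f ≈ Σ< m (λ i → Σ< n (λ j → f (i ℕ.* n ℕ.+ j)))
  Σ<-flatten ℕ.zero  n f = ≈-refl
  Σ<-flatten (suc m) n f rewrite ℕ.+-comm n (m ℕ.* n) =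
    ≈-trans (Σ<-split (m ℕ.* n) n f) (+-congʳ (Σ<-flatten m n f))

  Σ<-nonNegative : ∀ n {f} → (∀ i → 0# ≤ f i) → 0# ≤ Σ< n f
  Σ<-nonNegative ℕ.zero  0≤f = ≤-refl
  Σ<-nonNegative (suc n) 0≤f = +-nonNegative (Σ<-nonNegative n 0≤f) (0≤f n)

  Σ<-single : ∀ {n i} (f : ℕ → Carrier) → i ℕ.< n → (∀ j → j ≢ i → f j ≈ 0#) → Σ< n f ≈ f i
  Σ<-single {suc n} {i} f i<1+n f≈0 with i ℕ.≟ n
  ... | yes refl = ≈-trans (+-congʳ (≈-trans (Σ<-cong n λ j j<n → f≈0 j (ℕ.<⇒≢ j<n)) (Σ<-zero n))) (+-identityˡ _)
  ... | no i≢n   = ≈-trans (+-cong (Σ<-single f (ℕ.≤∧≢⇒< (ℕ.≤-pred i<1+n) i≢n) f≈0) (f≈0 n (i≢n ∘ ≡.sym))) (+-identityʳ _)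

  open MonoidSum +-monoid using (sum)

  Σ<-suc : ∀ n f → Σ< (suc n) f ≈ f 0 + Σ< n (f ∘ suc)
  Σ<-suc ℕ.zero  f = +-comm 0# (f 0)
  Σ<-suc (suc n) f = ≈-trans (+-congʳ (Σ<-suc n f)) (+-assoc _ _ _)

  sum≈Σ< : ∀ n {t : Fin n → Carrier} {f} → (∀ i → t i ≈ f (toℕ i)) → sum t ≈ Σ< n f
  sum≈Σ< ℕ.zero  t≈f = ≈-refl
  sum≈Σ< (suc n) t≈f = ≈-trans (+-cong (t≈f Fin.zero) (sum≈Σ< n (t≈f ∘ Fin.suc))) (≈-sym (Σ<-suc n _))

  extend : ∀ {n} → (Fin n → Carrier) → ℕ → Carrier
  extend {n} t k with k ℕ.<? n
  ... | yes k<n = t (fromℕ< k<n)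
  ... | no _    = 0#

  extend-toℕ : ∀ {n} (t : Fin n → Carrier) i → extend t (toℕ i) ≡ t i
  extend-toℕ {n} t i with toℕ i ℕ.<? n
  ... | yes i<n = cong t (Fin.fromℕ<-toℕ i i<n)
  ... | no  i≮n = contradiction (Fin.toℕ<n i) i≮n

  extend-≥ : ∀ {n} (t : Fin n → Carrier) {k} → ¬ k ℕ.< n → extend t k ≡ 0#
  extend-≥ {n} t {k} k≮n with k ℕ.<? n
  ... | yes k<n = contradiction k<n k≮n
  ... | no _    = refl

-- Programs and their executions

-- The write set, as a Boolean, so that for concrete programs and names it is decided by evaluation.
-- A name stands for a register, an integer array and a real array at once; writing one of them
-- counts as touching all three.
touches : Program → Name → Bool
touches skip                        y = false
touches (x ≔ e)                     y = does (y ≟ᴺ x)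
touches (a ! x ≔ᵃ z)                y = does (y ≟ᴺ a)
touches (a ! x ≔ʳ e)                y = does (y ≟ᴺ a)
touches (C ⨾ D)                     y = touches C y ∨ touches D y
touches (if x < z then C else D)    y = touches C y ∨ touches D y
touches (ifʳ p ≤ q then C else D)   y = touches C y ∨ touches D y
touches (while x < z loop C)        y = touches C y
touches (toss p heads C tails D)    y = touches C y ∨ touches D y

Untouched : Program → List Name → Set
Untouched C = All (λ y → touches C y ≡ false)

untouched? : Program → List Name → Bool
untouched? C []       = true
untouched? C (y ∷ ys) = not (touches C y) ∧ untouched? C ys

-- Reflection: for a concrete program and list the premise is `refl`.
untouched : ∀ C {ys} → untouched? C ys ≡ true → Untouched C ys
untouched C {[]}     eq = []
untouched C {y ∷ ys} eq with touches C y in y≡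
... | false = y≡ ∷ untouched C eq

-- Meant as a time bound for straight-line programs. A test is charged both branches instead of the
-- longer one, which affects only constants.
size : Program → ℕ
size skip                        = 0
size (x ≔ e)                     = 1
size (a ! x ≔ᵃ z)                = 1
size (a ! x ≔ʳ e)                = 1
size (C ⨾ D)                     = size C ℕ.+ size D
size (if x < z then C else D)    = suc (size C ℕ.+ size D)
size (ifʳ p ≤ q then C else D)   = suc (size C ℕ.+ size D)
size (while x < z loop C)        = suc (size C)
size (toss p heads C tails D)    = suc (size C ℕ.+ size D)

-- The fragment that halts from every state with a single outcome; division is excluded because the
-- divisor may be 0.
straight : Program → Bool
straight (a ! x ≔ʳ p ⊘ q)            = false
straight (while x < z loop C)        = false
straight (toss p heads C tails D)    = false
straight (C ⨾ D)                     = straight C ∧ straight D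
straight (if x < z then C else D)    = straight C ∧ straight D
straight (ifʳ p ≤ q then C else D)   = straight C ∧ straight D
straight _                           = true

update-same : ∀ {b} {B : Set b} (f : Name → B) x v → (f [ x ↦ v ]) x ≡ v
update-same f x v rewrite dec-true (x ≟ᴺ x) refl = refl

update-other : ∀ {b} {B : Set b} (f : Name → B) {x y} v → does (y ≟ᴺ x) ≡ false → (f [ x ↦ v ]) y ≡ f y
update-other f v y≢x rewrite y≢x = refl

update₂-same : ∀ {b} {B : Set b} (f : Name → ℕ → B) a i v → (_[_,_↦_] f a i v) a i ≡ v
update₂-same f a i v rewrite dec-true (a ≟ᴺ a) refl | dec-true (i ℕ.≟ i) refl = refl

update₂-other : ∀ {b} {B : Set b} (f : Name → ℕ → B) {a b} i v j → does (b ≟ᴺ a) ≡ false →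
                (_[_,_↦_] f a i v) b j ≡ f b j
update₂-other f i v j b≢a rewrite b≢a = refl

update₂-index : ∀ {b} {B : Set b} (f : Name → ℕ → B) a {i} v {j} → j ≢ i → (_[_,_↦_] f a i v) a j ≡ f a j
update₂-index f a {i} v {j} j≢i rewrite dec-true (a ≟ᴺ a) refl | dec-false (j ℕ.≟ i) j≢i = refl

unit : Name
unit = var 0

increment : Name → Program
increment i = unit ≔ const 1 ⨾ i ≔ i ⊞ unit

for_<_loop_ : Name → Name → Program → Program
for i < n loop C = i ≔ const 0 ⨾ while i < n loop (C ⨾ increment i)

-- The given multiplication algorithm may overwrite any memory, so it is run on
-- names from 100 on, which nothing else uses except to pass matrices to it.
shift : Name → Name
shift (io k)  = io (100 ℕ.+ k)
shift (var k) = var (100 ℕ.+ k)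

shift-injective : ∀ x y → shift x ≡ shift y → x ≡ y
shift-injective (io x)  (io y)  eq = cong io (ℕ.+-cancelˡ-≡ 100 x y (inj₁-injective eq))
shift-injective (var x) (var y) eq = cong var (ℕ.+-cancelˡ-≡ 100 x y (inj₂-injective eq))

shiftᶻ : IntExp → IntExp
shiftᶻ (const k)  = const k
shiftᶻ (reg x)    = reg (shift x)
shiftᶻ (x ⊞ y)    = shift x ⊞ shift y
shiftᶻ (x ∸ y)    = shift x ∸ shift y
shiftᶻ (x ⊠ y)    = shift x ⊠ shift y
shiftᶻ (half x)   = half (shift x)
shiftᶻ (load a x) = load (shift a) (shift x)

shiftᶜ : Cell → Cell
shiftᶜ (a ! x) = shift a ! shift x

shiftʳ : RealExp → RealExp
shiftʳ zero     = zero
shiftʳ one      = one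
shiftʳ (copy p) = copy (shiftᶜ p)
shiftʳ (p ⊕ q)  = shiftᶜ p ⊕ shiftᶜ q
shiftʳ (p ⊖ q)  = shiftᶜ p ⊖ shiftᶜ q
shiftʳ (p ⊗ q)  = shiftᶜ p ⊗ shiftᶜ q
shiftʳ (p ⊘ q)  = shiftᶜ p ⊘ shiftᶜ q

shiftᴾ : Program → Program
shiftᴾ skip                        = skip
shiftᴾ (x ≔ e)                     = shift x ≔ shiftᶻ e
shiftᴾ (a ! x ≔ᵃ y)                = shift a ! shift x ≔ᵃ shift y
shiftᴾ (p ≔ʳ e)                    = shiftᶜ p ≔ʳ shiftʳ e
shiftᴾ (C ⨾ D)                     = shiftᴾ C ⨾ shiftᴾ D
shiftᴾ (if x < y then C else D)    = if shift x < shift y then shiftᴾ C else shiftᴾ D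
shiftᴾ (ifʳ p ≤ q then C else D)   = ifʳ shiftᶜ p ≤ shiftᶜ q then shiftᴾ C else shiftᴾ D
shiftᴾ (while x < y loop C)        = while shift x < shift y loop shiftᴾ C
shiftᴾ (toss p heads C tails D)    = toss shiftᶜ p heads shiftᴾ C tails shiftᴾ D

Unshifted : Name → Set
Unshifted y = ∀ x → does (y ≟ᴺ shift x) ≡ false

-- Every written name is in the image of `shift`. This is all that is ever used about what the
-- multiplication algorithm overwrites.
touches-shiftᴾ : ∀ C {y} → Unshifted y → touches (shiftᴾ C) y ≡ false
touches-shiftᴾ skip                      y∉ = refl
touches-shiftᴾ (x ≔ e)                   y∉ = y∉ x
touches-shiftᴾ (a ! x ≔ᵃ z)              y∉ = y∉ a
touches-shiftᴾ (a ! x ≔ʳ e)              y∉ = y∉ a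
touches-shiftᴾ (C ⨾ D)                   y∉ = cong₂ _∨_ (touches-shiftᴾ C y∉) (touches-shiftᴾ D y∉)
touches-shiftᴾ (if x < z then C else D)  y∉ = cong₂ _∨_ (touches-shiftᴾ C y∉) (touches-shiftᴾ D y∉)
touches-shiftᴾ (ifʳ p ≤ q then C else D) y∉ = cong₂ _∨_ (touches-shiftᴾ C y∉) (touches-shiftᴾ D y∉)
touches-shiftᴾ (while x < z loop C)      y∉ = touches-shiftᴾ C y∉
touches-shiftᴾ (toss p heads C tails D)  y∉ = cong₂ _∨_ (touches-shiftᴾ C y∉) (touches-shiftᴾ D y∉)

does-shift : ∀ x y → does (shift x ≟ᴺ shift y) ≡ does (x ≟ᴺ y)
does-shift x y with x ≟ᴺ y
... | yes x≡y = dec-true (shift x ≟ᴺ shift y) (cong shift x≡y)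
... | no x≢y  = dec-false (shift x ≟ᴺ shift y) (x≢y ∘ shift-injective x y)

module Semantics {c ℓ₁ ℓ₂ : Level} (ℝ : RealNumbers c ℓ₁ ℓ₂) where

  open RealNumbers ℝ hiding (zero)
    renaming (refl to ≈-refl; sym to ≈-sym; trans to ≈-trans; reflexive to ≈-reflexive)
  open RealProperties ℝ
  open RealRAM ℝ
  open State

  private variable
    ℓ ℓ′ ℓ″ : Level
    C D : Program
    s s′ : State
    t t′ u u′ m m′ : ℕ
    τ : Tree

  Leaves-map : {P : Pred State ℓ} {Q : Pred State ℓ′} → (∀ {s} → P s → Q s) → Leaves P τ → Leaves Q τ
  Leaves-map f (done p)   = done (f p)
  Leaves-map f (coin l r) = coin (Leaves-map f l) (Leaves-map f r)

  Leaves-zip : {P : Pred State ℓ} {Q : Pred State ℓ′} → Leaves P τ → Leaves Q τ → Leaves (λ s → P s × Q s) τ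
  Leaves-zip (done p)   (done q)     = done (p , q)
  Leaves-zip (coin l r) (coin l′ r′) = coin (Leaves-zip l l′) (Leaves-zip r r′)

  Leaves-bind : ∀ {k : State → Tree} {P : Pred State ℓ} → Leaves (λ s → Leaves P (k s)) τ → Leaves P (τ >>= k)
  Leaves-bind (done p)   = p
  Leaves-bind (coin l r) = coin (Leaves-bind l) (Leaves-bind r)

  Leaves-unbind : ∀ {k : State → Tree} {P : Pred State ℓ} τ → Leaves P (τ >>= k) → Leaves (λ s → Leaves P (k s)) τ
  Leaves-unbind (done s)     p          = done p
  Leaves-unbind (coin p _ _) (coin l r) = coin (Leaves-unbind _ l) (Leaves-unbind _ r)

  >>=-cong : ∀ {k k′ : State → Tree} → Leaves (λ s → k s ≡ k′ s) τ → (τ >>= k) ≡ (τ >>= k′)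
  >>=-cong (done eq)  = eq
  >>=-cong (coin l r) = cong₂ (coin _) (>>=-cong l) (>>=-cong r)

  weaken  : C ⊢ s ⇓[ t ] τ → t ℕ.≤ t′ → C ⊢ s ⇓[ t′ ] τ
  weakens : ∀ {k : State → Tree} → Leaves (λ s → D ⊢ s ⇓[ t ] k s) τ → t ℕ.≤ t′ → Leaves (λ s → D ⊢ s ⇓[ t′ ] k s) τ

  weaken skip                 t≤t′ = skip
  weaken assign       (ℕ.s≤s t≤t′) = assign
  weaken store        (ℕ.s≤s t≤t′) = store
  weaken (assignʳ d)  (ℕ.s≤s t≤t′) = assignʳ d
  weaken {t′ = t′} (seq {D = D} {t = t} {u = u} {τ = τ} {k = k} p q) t+u≤t′ =
    -- The first program keeps its bound and the second one receives all the slack.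
    subst (λ t′ → _ ⨾ D ⊢ _ ⇓[ t′ ] (τ >>= k)) (ℕ.m+[n∸m]≡n t≤t′) (seq p (weakens q u≤t′∸t))
    where
    t≤t′ : t ℕ.≤ t′
    t≤t′ = ℕ.≤-trans (ℕ.m≤m+n t u) t+u≤t′
    u≤t′∸t : u ℕ.≤ t′ ℕ.∸ t
    u≤t′∸t = ℕ.≤-trans (ℕ.≤-reflexive (≡.sym (ℕ.m+n∸m≡n t u))) (ℕ.∸-monoˡ-≤ t t+u≤t′)
  weaken (ifTrue b p)   (ℕ.s≤s t≤t′) = ifTrue b (weaken p t≤t′)
  weaken (ifFalse b p)  (ℕ.s≤s t≤t′) = ifFalse b (weaken p t≤t′)
  weaken (ifʳTrue b p)  (ℕ.s≤s t≤t′) = ifʳTrue b (weaken p t≤t′)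
  weaken (ifʳFalse b p) (ℕ.s≤s t≤t′) = ifʳFalse b (weaken p t≤t′)
  weaken (stop b)       (ℕ.s≤s t≤t′) = stop b
  weaken (again b p)    (ℕ.s≤s t≤t′) = again b (weaken p t≤t′)
  weaken (toss a b p q) (ℕ.s≤s t≤t′) = toss a b (weaken p t≤t′) (weaken q t≤t′)

  weakens (done p)   t≤t′ = done (weaken p t≤t′)
  weakens (coin l r) t≤t′ = coin (weakens l t≤t′) (weakens r t≤t′)

  -- An interpreter, with t bounding the number of iterations of loops.  It
  -- supplies the total function k : State → Tree that the rule seq asks for.
  run : ℕ → Program → State → Tree
  run t skip          s = done s
  run t (x ≔ e)       s = done (setReg x (evalᶻ e s) s)
  run t (a ! x ≔ᵃ y)  s = done (setInt a (regs s x) (regs s y) s)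
  run t (a ! x ≔ʳ e)  s = done (setReal a (regs s x) (evalʳ e s) s)
  run t (C ⨾ D)       s = run t C s >>= run t D
  run t (if x < y then C else D)  s =
    if does (regs s x ℕ.<? regs s y) then run t C s else run t D s
  run t (ifʳ p ≤ q then C else D) s =
    if does (fetch p s ≤? fetch q s) then run t C s else run t D s
  run ℕ.zero  (while x < y loop C) s = done s
  run (suc t) (while x < y loop C) s =
    if does (regs s x ℕ.<? regs s y) then (run t C s >>= run t (while x < y loop C)) else done s
  run t (toss p heads C tails D) s = coin (fetch p s) (run t C s) (run t D s)

  -- The time bound doubles as fuel: every iteration consumes a unit of time, and each part of a
  -- `seq` takes at most the whole. In particular the outcome tree is unique.
  run-complete  : C ⊢ s ⇓[ t ] τ → t ℕ.≤ t′ → run t′ C s ≡ τ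
  runs-complete : ∀ {k : State → Tree} → Leaves (λ s → D ⊢ s ⇓[ t ] k s) τ → t ℕ.≤ t′ → Leaves (λ s → run t′ D s ≡ k s) τ

  run-complete skip         t≤t′ = refl
  run-complete assign       t≤t′ = refl
  run-complete store        t≤t′ = refl
  run-complete (assignʳ d)  t≤t′ = refl
  run-complete (seq {t = t} {u = u} p q) t+u≤t′
    rewrite run-complete p (ℕ.≤-trans (ℕ.m≤m+n t u) t+u≤t′) =
    >>=-cong (runs-complete q (ℕ.≤-trans (ℕ.m≤n+m u t) t+u≤t′))
  run-complete (ifTrue b p)   t≤t′
    rewrite dec-true (_ ℕ.<? _) b = run-complete p (ℕ.<⇒≤ t≤t′)
  run-complete (ifFalse b p)  t≤t′
    rewrite dec-false (_ ℕ.<? _) b = run-complete p (ℕ.<⇒≤ t≤t′)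
  run-complete (ifʳTrue b p)  t≤t′
    rewrite dec-true (_ ≤? _) b = run-complete p (ℕ.<⇒≤ t≤t′)
  run-complete (ifʳFalse b p) t≤t′
    rewrite dec-false (_ ≤? _) b = run-complete p (ℕ.<⇒≤ t≤t′)
  run-complete (stop b)       (ℕ.s≤s t≤t′)
    rewrite dec-false (_ ℕ.<? _) b = refl
  run-complete (again b p)    (ℕ.s≤s t≤t′)
    rewrite dec-true (_ ℕ.<? _) b = run-complete p t≤t′
  run-complete (toss a b p q) t≤t′ =
    cong₂ (coin _) (run-complete p (ℕ.<⇒≤ t≤t′)) (run-complete q (ℕ.<⇒≤ t≤t′))

  runs-complete (done p)   t≤t′ = done (run-complete p t≤t′)
  runs-complete (coin l r) t≤t′ = coin (runs-complete l t≤t′) (runs-complete r t≤t′)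

  run-sound : C ⊢ s ⇓[ t ] τ → t ℕ.≤ t′ → C ⊢ s ⇓[ t′ ] run t′ C s
  run-sound p t≤t′ = subst (_ ⊢ _ ⇓[ _ ]_) (≡.sym (run-complete p t≤t′)) (weaken p t≤t′)

  -- The single outcome of a straight-line program as a state, so that most facts about such code
  -- hold by evaluation. The last clause is the meaning of `skip`; for loops and coins it is a
  -- default that `straight` rules out.
  exec : Program → State → State
  exec (x ≔ e)       s = setReg x (evalᶻ e s) s
  exec (a ! x ≔ᵃ y)  s = setInt a (regs s x) (regs s y) s
  exec (a ! x ≔ʳ e)  s = setReal a (regs s x) (evalʳ e s) s
  exec (C ⨾ D)       s = exec D (exec C s)
  exec (if x < y then C else D)  s = if does (regs s x ℕ.<? regs s y) then exec C s else exec D s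
  exec (ifʳ p ≤ q then C else D) s = if does (fetch p s ≤? fetch q s) then exec C s else exec D s
  exec _             s = s

  exec-sound : ∀ C s → straight C ≡ true → C ⊢ s ⇓[ size C ] done (exec C s)
  exec-sound skip                 s eq = skip
  exec-sound (x ≔ e)              s eq = assign
  exec-sound (a ! x ≔ᵃ y)         s eq = store
  exec-sound (a ! x ≔ʳ zero)      s eq = assignʳ _
  exec-sound (a ! x ≔ʳ one)       s eq = assignʳ _
  exec-sound (a ! x ≔ʳ copy p)    s eq = assignʳ _
  exec-sound (a ! x ≔ʳ p ⊕ q)     s eq = assignʳ _
  exec-sound (a ! x ≔ʳ p ⊖ q)     s eq = assignʳ _
  exec-sound (a ! x ≔ʳ p ⊗ q)     s eq = assignʳ _
  exec-sound (C ⨾ D)              s eq =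
    seq {k = λ s → done (exec D s)} (exec-sound C s (∧-conicalˡ _ _ eq))
      (done (exec-sound D (exec C s) (∧-conicalʳ (straight C) _ eq)))
  exec-sound (if x < y then C else D) s eq with regs s x ℕ.<? regs s y
  ... | yes b rewrite dec-true (regs s x ℕ.<? regs s y) b =
    ifTrue b (weaken (exec-sound C s (∧-conicalˡ _ _ eq)) (ℕ.m≤m+n _ _))
  ... | no b  rewrite dec-false (regs s x ℕ.<? regs s y) b =
    ifFalse b (weaken (exec-sound D s (∧-conicalʳ (straight C) _ eq)) (ℕ.m≤n+m _ (size C)))
  exec-sound (ifʳ p ≤ q then C else D) s eq with fetch p s ≤? fetch q s
  ... | yes b = ifʳTrue b (weaken (exec-sound C s (∧-conicalˡ _ _ eq)) (ℕ.m≤m+n _ _))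
  ... | no b  = ifʳFalse b (weaken (exec-sound D s (∧-conicalʳ (straight C) _ eq)) (ℕ.m≤n+m _ (size C)))

  -- Frames: what a program leaves alone

  record Unchanged (y : Name) (s s′ : State) : Set c where
    constructor unchanged
    field
      sameReg  : regs s′ y ≡ regs s y
      sameInt  : ∀ i → ints s′ y i ≡ ints s y i
      sameReal : ∀ i → reals s′ y i ≡ reals s y i
  open Unchanged public

  Unchanged-refl : ∀ {y} → Unchanged y s s
  Unchanged-refl = unchanged refl (λ _ → refl) (λ _ → refl)

  Unchanged-trans : ∀ {y s₁ s₂ s₃} → Unchanged y s₁ s₂ → Unchanged y s₂ s₃ → Unchanged y s₁ s₃
  Unchanged-trans p q = unchanged (≡.trans (sameReg q) (sameReg p)) (λ i → ≡.trans (sameInt q i) (sameInt p i))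
                                  (λ i → ≡.trans (sameReal q i) (sameReal p i))

  Frame : Program → State → State → Set c
  Frame C s s′ = ∀ y → touches C y ≡ false → Unchanged y s s′

  Frame-trans : ∀ {s₁ s₂ s₃} → Frame C s₁ s₂ → Frame C s₂ s₃ → Frame C s₁ s₃
  Frame-trans f g y eq = Unchanged-trans (f y eq) (g y eq)

  Frame-ˡ : ∀ C D → Frame C s s′ → Frame (C ⨾ D) s s′
  Frame-ˡ C D f y eq = f y (∨-conicalˡ (touches C y) (touches D y) eq)

  Frame-ʳ : ∀ C D → Frame D s s′ → Frame (C ⨾ D) s s′
  Frame-ʳ C D f y eq = f y (∨-conicalʳ (touches C y) (touches D y) eq)

  frame-bind : ∀ {k : State → Tree} → Leaves (Frame C s) τ → Leaves (λ s′ → Leaves (Frame D s′) (k s′)) τ →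
               Leaves (λ s′ → ∀ y → touches C y ∨ touches D y ≡ false → Unchanged y s s′) (τ >>= k)
  frame-bind {C = C} {D = D} (done f)   (done fs)     = Leaves-map
    (λ g y eq → Unchanged-trans (f y (∨-conicalˡ (touches C y) _ eq)) (g y (∨-conicalʳ (touches C y) _ eq))) fs
  frame-bind {C = C} {D = D} (coin l r) (coin ls rs) = coin (frame-bind {C = C} {D = D} l ls)
      (frame-bind {C = C} {D = D} r rs)

  frame  : C ⊢ s ⇓[ t ] τ → Leaves (Frame C s) τ
  frames : ∀ {k : State → Tree} → Leaves (λ s → D ⊢ s ⇓[ t ] k s) τ → Leaves (λ s → Leaves (Frame D s) (k s)) τ

  frame skip           = done λ y eq → Unchanged-refl
  frame {s = s} assign = done λ y eq →
    unchanged (update-other (regs s) _ eq) (λ _ → refl) (λ _ → refl)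
  frame {s = s} store = done λ y eq →
    unchanged refl (λ j → update₂-other (ints s) _ _ j eq) (λ _ → refl)
  frame {s = s} (assignʳ d) = done λ y eq →
    unchanged refl (λ _ → refl) (λ j → update₂-other (reals s) _ _ j eq)
  frame {C = C ⨾ D} (seq p q)  = frame-bind {C = C} {D = D} (frame p) (frames q)
  frame {C = if x < z then C else D} (ifTrue b p) =
    Leaves-map (λ f y eq → f y (∨-conicalˡ (touches C y) _ eq)) (frame p)
  frame {C = if x < z then C else D} (ifFalse b p) =
    Leaves-map (λ f y eq → f y (∨-conicalʳ (touches C y) _ eq)) (frame p)
  frame {C = ifʳ x ≤ z then C else D} (ifʳTrue b p) =
    Leaves-map (λ f y eq → f y (∨-conicalˡ (touches C y) _ eq)) (frame p)
  frame {C = ifʳ x ≤ z then C else D} (ifʳFalse b p) =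
    Leaves-map (λ f y eq → f y (∨-conicalʳ (touches C y) _ eq)) (frame p)
  frame (stop b)               = done λ y eq → Unchanged-refl
  -- `again` unfolds the loop to a sequence, whose write set is the disjunction of `touches C y`
  -- with itself.
  frame (again b p)            = Leaves-map (λ f y eq → f y (cong₂ _∨_ eq eq)) (frame p)
  frame {C = toss x heads C tails D} (toss a b p q) =
    coin (Leaves-map (λ f y eq → f y (∨-conicalˡ (touches C y) _ eq)) (frame p))
         (Leaves-map (λ f y eq → f y (∨-conicalʳ (touches C y) _ eq)) (frame q))

  frames (done p)   = done (frame p)
  frames (coin l r) = coin (frames l) (frames r)

  -- Invariance of executions under renaming

  record Shifted (s s′ : State) : Set c where
    constructor shifted
    field
      shiftedRegs  : ∀ x → regs s′ (shift x) ≡ regs s x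
      shiftedInts  : ∀ a i → ints s′ (shift a) i ≡ ints s a i
      shiftedReals : ∀ a i → reals s′ (shift a) i ≡ reals s a i
  open Shifted

  data ShiftedTree : Tree → Tree → Set c where
    done : Shifted s s′ → ShiftedTree (done s) (done s′)
    coin : ∀ {p l l′ r r′} → ShiftedTree l l′ → ShiftedTree r r′ → ShiftedTree (coin p l r) (coin p l′ r′)

  evalᶻ-shift : ∀ e → Shifted s s′ → evalᶻ (shiftᶻ e) s′ ≡ evalᶻ e s
  evalᶻ-shift (const k)  σ = refl
  evalᶻ-shift (reg x)    σ = shiftedRegs σ x
  evalᶻ-shift (x ⊞ y)    σ = cong₂ ℕ._+_ (shiftedRegs σ x) (shiftedRegs σ y)
  evalᶻ-shift (x ∸ y)    σ = cong₂ ℕ._∸_ (shiftedRegs σ x) (shiftedRegs σ y)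
  evalᶻ-shift (x ⊠ y)    σ = cong₂ ℕ._*_ (shiftedRegs σ x) (shiftedRegs σ y)
  evalᶻ-shift (half x)   σ = cong ℕ.⌊_/2⌋ (shiftedRegs σ x)
  evalᶻ-shift {s = s} (load a x) σ = ≡.trans (shiftedInts σ a _) (cong (ints s a) (shiftedRegs σ x))

  fetch-shift : ∀ p → Shifted s s′ → fetch (shiftᶜ p) s′ ≡ fetch p s
  fetch-shift {s = s} (a ! x) σ = ≡.trans (shiftedReals σ a _) (cong (reals s a) (shiftedRegs σ x))

  evalʳ-shift : ∀ e → Shifted s s′ → evalʳ (shiftʳ e) s′ ≡ evalʳ e s
  evalʳ-shift zero     σ = refl
  evalʳ-shift one      σ = refl
  evalʳ-shift (copy p) σ = fetch-shift p σ
  evalʳ-shift (p ⊕ q)  σ = cong₂ _+_ (fetch-shift p σ) (fetch-shift q σ)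
  evalʳ-shift (p ⊖ q)  σ = cong₂ _-_ (fetch-shift p σ) (fetch-shift q σ)
  evalʳ-shift (p ⊗ q)  σ = cong₂ _*_ (fetch-shift p σ) (fetch-shift q σ)
  evalʳ-shift (p ⊘ q)  σ = cong₂ (λ x y → x * y ⁻¹) (fetch-shift p σ) (fetch-shift q σ)

  Defined-shift : ∀ e → Shifted s s′ → Defined e s → Defined (shiftʳ e) s′
  Defined-shift zero     σ d = _
  Defined-shift one      σ d = _
  Defined-shift (copy p) σ d = _
  Defined-shift (p ⊕ q)  σ d = _
  Defined-shift (p ⊖ q)  σ d = _
  Defined-shift (p ⊗ q)  σ d = _
  Defined-shift (p ⊘ q)  σ d = subst (λ x → ¬ x ≈ 0#) (≡.sym (fetch-shift q σ)) d

  setReg-shift : ∀ x {k k′} → k′ ≡ k → Shifted s s′ → Shifted (setReg x k s) (setReg (shift x) k′ s′)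
  setReg-shift {s = s} {s′ = s′} x {k} refl σ = shifted at (shiftedInts σ) (shiftedReals σ)
    where
    at : ∀ y → (regs s′ [ shift x ↦ k ]) (shift y) ≡ (regs s [ x ↦ k ]) y
    at y rewrite does-shift y x = cong (if does (y ≟ᴺ x) then k else_) (shiftedRegs σ y)

  update₂-shift : ∀ {b} {B : Set b} (f f′ : Name → ℕ → B) a i v → (∀ b j → f′ (shift b) j ≡ f b j) →
                  ∀ b j → (_[_,_↦_] f′ (shift a) i v) (shift b) j ≡ (_[_,_↦_] f a i v) b j
  update₂-shift f f′ a i v eq b j rewrite does-shift b a =
    cong (λ x → if does (b ≟ᴺ a) then (if does (j ℕ.≟ i) then v else x) else x) (eq b j)

  setInt-shift : ∀ a {i i′ k k′} → i′ ≡ i → k′ ≡ k → Shifted s s′ →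
                 Shifted (setInt a i k s) (setInt (shift a) i′ k′ s′)
  setInt-shift {s = s} {s′ = s′} a refl refl σ =
    shifted (shiftedRegs σ) (update₂-shift (ints s) (ints s′) a _ _ (shiftedInts σ)) (shiftedReals σ)

  setReal-shift : ∀ a {i i′ r r′} → i′ ≡ i → r′ ≡ r → Shifted s s′ →
                  Shifted (setReal a i r s) (setReal (shift a) i′ r′ s′)
  setReal-shift {s = s} {s′ = s′} a refl refl σ =
    shifted (shiftedRegs σ) (shiftedInts σ) (update₂-shift (reals s) (reals s′) a _ _ (shiftedReals σ))

  -- The renamed continuation is known only leaf by leaf, as an existence statement; the interpreter
  -- `run u D` glues these outcomes into the one function that `seq` needs.
  ShiftedTree-bind : ∀ {τ′} {k : State → Tree} {u} → ShiftedTree τ τ′ →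
    Leaves (λ s → ∀ {s′} → Shifted s s′ → ∃[ υ ] ((D ⊢ s′ ⇓[ u ] υ) × ShiftedTree (k s) υ)) τ →
    Leaves (λ s′ → D ⊢ s′ ⇓[ u ] run u D s′) τ′ × ShiftedTree (τ >>= k) (τ′ >>= run u D)
  ShiftedTree-bind (done σ) (done f) with f σ
  ... | υ , p , eq =
    done (run-sound p ℕ.≤-refl) , subst (ShiftedTree _) (≡.sym (run-complete p ℕ.≤-refl)) eq
  ShiftedTree-bind (coin σ ς) (coin l r) with ShiftedTree-bind σ l | ShiftedTree-bind ς r
  ... | p , eq | q , eq′ = coin p q , coin eq eq′

  -- Related states agree by propositional equality on everything a program can read, so tests,
  -- divisors and biases coincide and the two trees have the same shape.
  shift-sound  : C ⊢ s ⇓[ t ] τ → Shifted s s′ → ∃[ τ′ ] ((shiftᴾ C ⊢ s′ ⇓[ t ] τ′) × ShiftedTree τ τ′)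
  shifts-sound : ∀ {k : State → Tree} → Leaves (λ s → D ⊢ s ⇓[ t ] k s) τ →
    Leaves (λ s → ∀ {s′} → Shifted s s′ → ∃[ υ ] ((shiftᴾ D ⊢ s′ ⇓[ t ] υ) × ShiftedTree (k s) υ)) τ

  shift-sound skip σ = _ , skip , done σ
  shift-sound {C = x ≔ e} assign σ = _ , assign , done (setReg-shift x (evalᶻ-shift e σ) σ)
  shift-sound {C = a ! x ≔ᵃ y} store σ =
    _ , store , done (setInt-shift a (shiftedRegs σ x) (shiftedRegs σ y) σ)
  shift-sound {C = a ! x ≔ʳ e} (assignʳ d) σ =
    _ , assignʳ (Defined-shift e σ d) , done (setReal-shift a (shiftedRegs σ x) (evalʳ-shift e σ) σ)
  shift-sound (seq p q) σ with shift-sound p σ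
  ... | τ′ , p′ , ς with ShiftedTree-bind ς (shifts-sound q)
  ... | q′ , ς′ = _ , seq p′ q′ , ς′
  shift-sound {C = if x < y then C else D} (ifTrue b p) σ with shift-sound p σ
  ... | _ , p′ , ς = _ , ifTrue (≡.subst₂ ℕ._<_ (≡.sym (shiftedRegs σ x)) (≡.sym (shiftedRegs σ y)) b) p′ , ς
  shift-sound {C = if x < y then C else D} (ifFalse b p) σ with shift-sound p σ
  ... | _ , p′ , ς = _ , ifFalse (b ∘ ≡.subst₂ ℕ._<_ (shiftedRegs σ x) (shiftedRegs σ y)) p′ , ς
  shift-sound {C = ifʳ x ≤ y then C else D} (ifʳTrue b p) σ with shift-sound p σ
  ... | _ , p′ , ς = _ , ifʳTrue (≡.subst₂ _≤_ (≡.sym (fetch-shift x σ)) (≡.sym (fetch-shift y σ)) b) p′ , ς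
  shift-sound {C = ifʳ x ≤ y then C else D} (ifʳFalse b p) σ with shift-sound p σ
  ... | _ , p′ , ς = _ , ifʳFalse (b ∘ ≡.subst₂ _≤_ (fetch-shift x σ) (fetch-shift y σ)) p′ , ς
  shift-sound {C = while x < y loop C} (stop b) σ =
    _ , stop (b ∘ ≡.subst₂ ℕ._<_ (shiftedRegs σ x) (shiftedRegs σ y)) , done σ
  shift-sound {C = while x < y loop C} (again b p) σ with shift-sound p σ
  ... | _ , p′ , ς = _ , again (≡.subst₂ ℕ._<_ (≡.sym (shiftedRegs σ x)) (≡.sym (shiftedRegs σ y)) b) p′ , ς
  shift-sound {C = toss x heads C tails D} {s′ = s′} (toss {τ = τ} {υ = υ} a b p q) σ
    with shift-sound p σ | shift-sound q σ
  ... | l , p′ , ς | r , q′ , ς′ =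
    _ , toss (subst (0# ≤_) (≡.sym eq) a) (subst (_≤ 1#) (≡.sym eq) b) p′ q′ ,
    subst (λ x → ShiftedTree (coin x τ υ) (coin (fetch (shiftᶜ cell) s′) l r)) eq (coin ς ς′)
    where
    cell = x
    eq : fetch (shiftᶜ x) s′ ≡ _
    eq = fetch-shift x σ

  shifts-sound (done p)   = done (shift-sound p)
  shifts-sound (coin l r) = coin (shifts-sound l) (shifts-sound r)

  Leaves-shift : ∀ {τ′} {P : Pred State ℓ} → ShiftedTree τ τ′ → Leaves P τ →
                 Leaves (λ s′ → ∃[ s ] (Shifted s s′ × P s)) τ′
  Leaves-shift (done σ)   (done p)   = done (_ , σ , p)
  Leaves-shift (coin σ ς) (coin l r) = coin (Leaves-shift σ l) (Leaves-shift ς r)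

  exec-frame : ∀ C s → straight C ≡ true → Frame C s (exec C s)
  exec-frame C s eq with frame (exec-sound C s eq)
  ... | done f = f

  -- What is needed to prove a postcondition of a sequence separately after each leaf of its first
  -- part: it must pass from two trees to any mixture of them.
  CoinClosed : Pred Tree ℓ → Set _
  CoinClosed Φ = ∀ p l r → Φ l → Φ r → Φ (coin p l r)

  Leaves-closed : {P : Pred State ℓ} → CoinClosed (Leaves P)
  Leaves-closed _ _ _ = coin

  bind-closed : {Φ : Pred Tree ℓ} → CoinClosed Φ → ∀ {k : State → Tree} → Leaves (λ s → Φ (k s)) τ → Φ (τ >>= k)
  bind-closed closed (done p)   = p
  bind-closed closed (coin l r) = closed _ _ _ (bind-closed closed l) (bind-closed closed r)

  -- Running times are counted in unit steps and in calls of the given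
  -- multiplication algorithm, whose price is M.
  module Logic (M : Carrier) (0≤M : 0# ≤ M) where

    cost : ℕ → ℕ → Carrier
    cost u m = fromℕ u + fromℕ m * M

    cost-+ : ∀ u m u′ m′ → cost u m + cost u′ m′ ≈ cost (u ℕ.+ u′) (m ℕ.+ m′)
    cost-+ u m u′ m′ = ≈-trans
      (solve 5 (λ a b a′ b′ x → (a :+ b :* x) :+ (a′ :+ b′ :* x) := (a :+ a′) :+ (b :+ b′) :* x)
         ≈-refl (fromℕ u) (fromℕ m) (fromℕ u′) (fromℕ m′) M)
      (+-cong (≈-sym (fromℕ-+ u u′)) (*-congʳ (≈-sym (fromℕ-+ m m′))))
      where
      open SemiringSolver commutativeSemiring

    cost-mono : u ℕ.≤ u′ → m ℕ.≤ m′ → cost u m ≤ cost u′ m′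
    cost-mono u≤u′ m≤m′ = +-mono-≤ (fromℕ-mono-≤ u≤u′) (*-monoˡ-≤ 0≤M (fromℕ-mono-≤ m≤m′))

    -- A record rather than a synonym, so that unification can recover the program, the state and
    -- the costs.
    record Runs (C : Program) (s : State) (u m : ℕ) (Φ : Pred Tree ℓ) : Set (c ⊔ ℓ₁ ⊔ ℓ₂ ⊔ ℓ) where
      constructor runs
      field
        outcome : C from s inTime cost u m ensures Φ
    open Runs public

    Runs-map : {Φ : Pred Tree ℓ} {Ψ : Pred Tree ℓ′} → (∀ {τ} → Φ τ → Ψ τ) → Runs C s u m Φ → Runs C s u m Ψ
    Runs-map f (runs (t , τ , p , t≤ , φ)) = runs (t , τ , p , t≤ , f φ)

    Runs-≤ : {Φ : Pred Tree ℓ} → u ℕ.≤ u′ → m ℕ.≤ m′ → Runs C s u m Φ → Runs C s u′ m′ Φ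
    Runs-≤ u≤u′ m≤m′ (runs (t , τ , p , t≤ , φ)) =
      runs (t , τ , p , ≤-trans t≤ (cost-mono u≤u′ m≤m′) , φ)

    Runs-inTime : ∀ {b} {Φ : Pred Tree ℓ} {Ψ : Pred Tree ℓ′} → Runs C s u m Φ → cost u m ≤ b → (∀ {τ} → Φ τ → Ψ τ) →
                  C from s inTime b ensures Ψ
    Runs-inTime (runs (t , τ , p , t≤ , φ)) ≤b f = t , τ , p , ≤-trans t≤ ≤b , f φ

    Runs-frame : {Φ : Pred Tree ℓ} → Runs C s u m Φ → Runs C s u m (λ τ → Φ τ × Leaves (Frame C s) τ)
    Runs-frame (runs (t , τ , p , t≤ , φ)) = runs (t , τ , p , t≤ , φ , frame p)

    Runs-Leaves-frame : {P : Pred State ℓ} → Runs C s u m (Leaves P) →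
                        Runs C s u m (Leaves (λ s′ → P s′ × Frame C s s′))
    Runs-Leaves-frame r = Runs-map (λ (φ , f) → Leaves-zip φ f) (Runs-frame r)

    -- Each leaf brings its own number of steps, while `seq` asks for one bound and one
    -- continuation. The maximum over the leaves serves as bound and the interpreter as
    -- continuation; quantifying over all larger `t′` lets both subtrees be raised to the maximum.
    common-time : {Ψ : State → Pred Tree ℓ} → ∀ {b} →
                  Leaves (λ s → D from s inTime b ensures Ψ s) τ →
                  ∃[ t ] (fromℕ t ≤ b ×
                    (∀ t′ → t ℕ.≤ t′ → Leaves (λ s → (D ⊢ s ⇓[ t′ ] run t′ D s) × Ψ s (run t′ D s)) τ))
    common-time {Ψ = Ψ} (done {s} (t , τ , p , t≤ , ψ)) =
      t , t≤ , λ t′ t≤t′ → done (run-sound p t≤t′ , subst (Ψ s) (≡.sym (run-complete p t≤t′)) ψ)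
    common-time (coin l r) with common-time l | common-time r
    ... | t , t≤ , ls | u , u≤ , rs with ℕ.≤-total t u
    ... | inj₁ t≤u = u , u≤ , λ t′ u≤t′ → coin (ls t′ (ℕ.≤-trans t≤u u≤t′)) (rs t′ u≤t′)
    ... | inj₂ u≤t = t , t≤ , λ t′ t≤t′ → coin (ls t′ t≤t′) (rs t′ (ℕ.≤-trans u≤t t≤t′))

    -- `Ψ` may mention the intermediate state and `combine` sees whole trees: the distribution of a
    -- sample is not a property of single leaves.
    Runs-seq : {Φ : Pred Tree ℓ} {Ψ : State → Pred Tree ℓ′} {Φ′ : Pred Tree ℓ″} →
               Runs C s u m Φ →
               (∀ {τ} → Φ τ → Leaves (λ s′ → Runs D s′ u′ m′ (Ψ s′)) τ) →
               (∀ {τ} {k : State → Tree} → Φ τ → Leaves (λ s′ → Ψ s′ (k s′)) τ → Φ′ (τ >>= k)) →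
               Runs (C ⨾ D) s (u ℕ.+ u′) (m ℕ.+ m′) Φ′
    Runs-seq {u = u} {m = m} {D = D} {u′ = u′} {m′ = m′} (runs (t , τ , p , t≤ , φ)) next combine with common-time
        (Leaves-map outcome (next φ))
    ... | v , v≤ , qs = runs (
      t ℕ.+ v , (τ >>= run v D) , seq p (Leaves-map proj₁ (qs v ℕ.≤-refl)) ,
      ≤-respˡ-≈ (≈-sym (fromℕ-+ t v)) (≤-respʳ-≈ (cost-+ u m u′ m′) (+-mono-≤ t≤ v≤)) ,
      combine φ (Leaves-map proj₂ (qs v ℕ.≤-refl)))

    infixr 3 _then_
    _then_ : {P : Pred State ℓ} {Φ : Pred Tree ℓ′} → Runs C s u m (Leaves P) →
             (CoinClosed Φ × (∀ {s′} → P s′ → Runs D s′ u′ m′ Φ)) →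
             Runs (C ⨾ D) s (u ℕ.+ u′) (m ℕ.+ m′) Φ
    r then (closed , next) = Runs-seq r (Leaves-map next) (λ _ → bind-closed closed)

    Runs-exec : {P : Pred State ℓ} → straight C ≡ true → P (exec C s) → Runs C s (size C) 0 (Leaves P)
    Runs-exec {C = C} {s = s} eq p = runs (
      size C , done (exec C s) , exec-sound C s eq ,
      ≤-reflexive (≈-sym (≈-trans (+-congˡ (zeroˡ M)) (+-identityʳ _))) , done p)

    Runs-again : ∀ {x y} {Φ : Pred Tree ℓ} → regs s x ℕ.< regs s y →
                 Runs (C ⨾ while x < y loop C) s u m Φ → Runs (while x < y loop C) s (suc u) m Φ
    Runs-again b (runs (t , τ , p , t≤ , φ)) =
      runs (suc t , τ , again b p , ≤-respʳ-≈ (≈-sym (+-assoc _ _ _)) (+-monoʳ-≤ 1# t≤) , φ)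

    Runs-stop : ∀ {x y} {Φ : Pred Tree ℓ} → ¬ regs s x ℕ.< regs s y → Φ (done s) →
                Runs (while x < y loop C) s 1 0 Φ
    Runs-stop b φ = runs (1 , _ , stop b , ≤-reflexive (≈-sym (≈-trans (+-congˡ (zeroˡ M)) (+-identityʳ _))) , φ)

    -- Each round pays one extra step for its test, and the last test costs one more. The frame from
    -- `s₀` is handed to `step` and `exit`, so that the invariant need not repeat what the loop
    -- never writes.
    Runs-while : ∀ {x y s₀} N (I : ℕ → Pred State ℓ) →
      (∀ j s → j ℕ.< N → Frame C s₀ s → I j s → (regs s x ℕ.< regs s y) × Runs C s u m (Leaves (I (suc j)))) →
      (∀ s → Frame C s₀ s → I N s → ¬ regs s x ℕ.< regs s y) →
      I 0 s₀ → Runs (while x < y loop C) s₀ (N ℕ.* suc u ℕ.+ 1) (N ℕ.* m) (Leaves (I N))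
    Runs-while {C = C} {u = u} {m = m} {x = x} {y = y} {s₀ = s₀} N I step exit start =
      go N 0 s₀ refl (λ _ _ → Unchanged-refl) start
      where
      go : ∀ k j s → j ℕ.+ k ≡ N → Frame C s₀ s → I j s →
           Runs (while x < y loop C) s (k ℕ.* suc u ℕ.+ 1) (k ℕ.* m) (Leaves (I N))
      go ℕ.zero j s refl f i rewrite ℕ.+-identityʳ j = Runs-stop (exit s f i) (done i)
      go (suc k) j s refl f i =
        let b , r = step j s (ℕ.m<m+n j (ℕ.s≤s ℕ.z≤n)) f i in
        Runs-≤ (ℕ.≤-reflexive (cong suc (≡.sym (ℕ.+-assoc u (k ℕ.* suc u) 1)))) ℕ.≤-refl
          (Runs-again b (Runs-Leaves-frame r then
            (Leaves-closed , λ (i′ , g) → go k (suc j) _ (≡.sym (ℕ.+-suc j k)) (Frame-trans {C = C} f g) i′)))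

    -- A round costs `u`, two steps for the increment and one for the test. The invariant is asked
    -- for after the increment; with concrete names it evaluates through these two register writes.
    for-sound : ∀ {i n C s₀} N (I : ℕ → Pred State ℓ) → regs s₀ n ≡ N →
      does (n ≟ᴺ i) ≡ false → does (n ≟ᴺ unit) ≡ false → does (i ≟ᴺ unit) ≡ false →
      touches C i ≡ false → touches C n ≡ false →
      I 0 (setReg i 0 s₀) →
      (∀ j s → j ℕ.< N → Frame (for i < n loop C) s₀ s → regs s i ≡ j → I j s →
         Runs C s u m (Leaves (λ s′ → I (suc j) (exec (increment i) s′)))) →
      Runs (for i < n loop C) s₀ (suc (N ℕ.* suc (u ℕ.+ 2) ℕ.+ 1)) (N ℕ.* m) (Leaves (I N))
    for-sound {u = u} {m = m} {i = i} {n = n} {C = C} {s₀ = s₀} N I n≡N n≢i n≢unit i≢unit C∌i C∌n start step =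
      Runs-exec {P = _≡ s₁} refl refl then (Leaves-closed , λ { refl →
        Runs-map (Leaves-map proj₂) (Runs-while N (λ j s → regs s i ≡ j × I j s)
          (λ j s j<N f (i≡j , p) →
            (≡.subst₂ ℕ._<_ (≡.sym i≡j) (≡.sym (n≡ s f)) j<N) ,
            subst (λ m → Runs _ s _ m _) (ℕ.+-identityʳ m) (
              Runs-Leaves-frame (step j s j<N (Frame₀ s f) i≡j p) then (Leaves-closed ,
              λ {s′} (p′ , g) → Runs-exec refl (
                (begin′ s′ g i≡j) , p′))))
          (λ s f (i≡N , _) i<n → ℕ.<-irrefl refl (≡.subst₂ ℕ._<_ i≡N (n≡ s f) i<n))
          (update-same (regs s₀) i 0 , start)) })
      where
      body = C ⨾ increment i
      s₁ = setReg i 0 s₀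
      n≡ : ∀ s → Frame body s₁ s → regs s n ≡ N
      n≡ s f = ≡.trans (sameReg (f n (cong₂ _∨_ C∌n (cong₂ _∨_ n≢unit n≢i)))) (≡.trans (update-other (regs s₀) 0 n≢i) n≡N)
      Frame₀ : ∀ s → Frame body s₁ s → Frame (for i < n loop C) s₀ s
      Frame₀ s f y eq = Unchanged-trans (unchanged (update-other (regs s₀) 0 (∨-conicalˡ (does (y ≟ᴺ i)) _ eq))
          (λ _ → refl) (λ _ → refl))
        (f y (∨-conicalʳ (does (y ≟ᴺ i)) _ eq))
      begin′ : ∀ {j s} s′ → Frame C s s′ → regs s i ≡ j → regs (exec (increment i) s′) i ≡ suc j
      begin′ {j} {s} s′ g i≡j =
        ≡.trans (update-same (regs s″) i _)
          (≡.trans (cong₂ ℕ._+_ (≡.trans (update-other (regs s′) 1 i≢unit) (≡.trans (sameReg (g i C∌i)) i≡j))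
              (update-same (regs s′) unit 1))
                   (ℕ.+-comm j 1))
        where s″ = setReg unit 1 s′

-- Probabilities

Unshifted-io : ∀ {k} → k ℕ.< 100 → Unshifted (io k)
Unshifted-io {k} k<100 (io x)  = dec-false (io k ≟ᴺ shift (io x)) λ { refl → ℕ.<⇒≱ k<100 (ℕ.m≤m+n 100 x) }
Unshifted-io k<100 (var x) = refl

Unshifted-var : ∀ {k} → k ℕ.< 100 → Unshifted (var k)
Unshifted-var k<100 (io x)  = refl
Unshifted-var {k} k<100 (var x) = dec-false (var k ≟ᴺ shift (var x)) λ { refl → ℕ.<⇒≱ k<100 (ℕ.m≤m+n 100 x) }

module Expectation {c ℓ₁ ℓ₂ : Level} (ℝ : RealNumbers c ℓ₁ ℓ₂) where

  open RealNumbers ℝ hiding (zero)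
    renaming (refl to ≈-refl; sym to ≈-sym; trans to ≈-trans; reflexive to ≈-reflexive)
  open RealProperties ℝ
  open RealRAM ℝ
  open Semantics ℝ
  open State
  module ≈-Reasoning = SetoidReasoning setoid

  E : Tree → (State → Carrier) → Carrier
  E (done s)     h = h s
  E (coin p l r) h = p * E l h + (1# - p) * E r h

  indicator : ℕ → ℕ → Carrier
  indicator k i = if does (k ℕ.≟ i) then 1# else 0#

  Pr-bind : ∀ τ k x i → Pr (τ >>= k) x i ≡ E τ (λ s → Pr (k s) x i)
  Pr-bind (done s)     k x i = refl
  Pr-bind (coin p l r) k x i = cong₂ (λ a b → p * a + (1# - p) * b) (Pr-bind l k x i) (Pr-bind r k x i)

  E-bind : ∀ τ k h → E (τ >>= k) h ≡ E τ (λ s → E (k s) h)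
  E-bind (done s)     k h = refl
  E-bind (coin p l r) k h = cong₂ (λ a b → p * a + (1# - p) * b) (E-bind l k h) (E-bind r k h)

  mixture-const : ∀ p x → p * x + (1# - p) * x ≈ x
  mixture-const p x = begin
    p * x + (1# - p) * x  ≈⟨ distribʳ x p (1# - p) ⟨
    (p + (1# - p)) * x    ≈⟨ *-congʳ (≈-trans (+-comm p _) ([x-y]+y≈x 1# p)) ⟩
    1# * x                ≈⟨ *-identityˡ x ⟩
    x                     ∎
    where open ≈-Reasoning

  mixture-scale : ∀ q p x y → q * (p * x + (1# - p) * y) ≈ p * (q * x) + (1# - p) * (q * y)
  mixture-scale q p x y =
    solve 5 (λ q p p′ x y → q :* (p :* x :+ p′ :* y) := p :* (q :* x) :+ p′ :* (q :* y)) ≈-refl q p (1# - p) x y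
    where open SemiringSolver commutativeSemiring

  Distributed : Carrier → (ℕ → Carrier) → Name → Pred Tree ℓ₁
  Distributed q g x τ = ∀ i → q * Pr τ x i ≈ g i

  -- For fixed `q` and `g` the condition is affine in the probabilities, so it survives every
  -- mixture. Coins that change the weight of the current interval are the business of `Balanced`.
  Distributed-closed : ∀ {q g x} → CoinClosed (Distributed q g x)
  Distributed-closed {q} {g} {x} p l r f g′ i = begin
    q * (p * Pr l x i + (1# - p) * Pr r x i)              ≈⟨ mixture-scale q p _ _ ⟩
    p * (q * Pr l x i) + (1# - p) * (q * Pr r x i)        ≈⟨ +-cong (*-congˡ (f i)) (*-congˡ (g′ i)) ⟩
    p * g i + (1# - p) * g i                              ≈⟨ mixture-const p (g i) ⟩
    g i                                                   ∎
    where open ≈-Reasoning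

  Distributed-Leaves : ∀ {q g x τ} → Leaves (λ s → ∀ i → q * indicator (regs s x) i ≈ g i) τ → Distributed q g x τ
  Distributed-Leaves (done p)                   = p
  Distributed-Leaves {q} {g} {x} {coin p l r} (coin ls rs) =
    Distributed-closed {q} {g} {x} p l r (Distributed-Leaves {q} {g} {x} ls) (Distributed-Leaves {q} {g} {x} rs)

  Sampled-closed : ∀ {ℓ q g x} {Q : Pred State ℓ} → CoinClosed (λ τ → Distributed q g x τ × Leaves Q τ)
  Sampled-closed {q = q} {g} {x} p l r (dl , ql) (dr , qr) = Distributed-closed {q} {g} {x} p l r dl dr , coin ql qr

  -- The interval of a state is [lo, lo + len), with lo and len the contents
  -- of two registers.
  module Intervals (LO LEN : Name) (W : ℕ → Carrier) where

    total : (ℕ → Carrier) → State → Carrier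
    total f s = Σ< (regs s LEN) (λ i → f (regs s LO ℕ.+ i))

    -- Weighted by the intervals, the expectation of h is additive: if at each
    -- leaf the value of h times the weight of its interval is the total of H,
    -- then the same holds of the expectation of h at the root.
    Balanced : State → Pred Tree (c ⊔ ℓ₁)
    Balanced s τ = ∀ h H → Leaves (λ s′ → total W s′ * h s′ ≈ total H s′) τ → total W s * E τ h ≈ total H s

    Balanced-closed : ∀ {s} → CoinClosed (Balanced s)
    Balanced-closed {s} p l r bl br h H (coin ls rs) = begin
      total W s * (p * E l h + (1# - p) * E r h)                   ≈⟨ mixture-scale (total W s) p _ _ ⟩
      p * (total W s * E l h) + (1# - p) * (total W s * E r h)     ≈⟨ +-cong (*-congˡ (bl h H ls)) (*-congˡ (br h H rs)) ⟩
      p * total H s + (1# - p) * total H s                         ≈⟨ mixture-const p (total H s) ⟩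
      total H s                                                    ∎
      where open ≈-Reasoning

    -- The tower rule: the outer balance is applied to the conditional expectation
    -- `λ s′ → E (k s′) h`, and its premise at a leaf is the inner balance there.
    Balanced-bind : ∀ {s τ} {k : State → Tree} → Balanced s τ →
                    Leaves (λ s′ → Balanced s′ (k s′)) τ → Balanced s (τ >>= k)
    Balanced-bind {s} {τ} {k} b bs h H ls =
      ≈-trans (*-congˡ (≈-reflexive (E-bind τ k h)))
        (b (λ s′ → E (k s′) h) H (Leaves-map (λ (b′ , l) → b′ h H l) (Leaves-zip bs (Leaves-unbind τ ls))))

    Balanced-done : ∀ {s s′} → regs s′ LO ≡ regs s LO → regs s′ LEN ≡ regs s LEN → Balanced s (done s′)
    Balanced-done lo≡ len≡ h H (done l) =
      ≡.subst₂ (λ a b → Σ< b (λ i → W (a ℕ.+ i)) * _ ≈ Σ< b (λ i → H (a ℕ.+ i))) lo≡ len≡ l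

    total-single : ∀ {s} f → regs s LEN ≡ 1 → total f s ≈ f (regs s LO)
    total-single {s} f len≡1 rewrite len≡1 =
      ≈-trans (+-identityˡ _) (≈-reflexive (cong f (ℕ.+-identityʳ (regs s LO))))

    total-split : ∀ {s sˡ sʳ} f → regs s LEN ≡ regs sˡ LEN ℕ.+ regs sʳ LEN → regs sˡ LO ≡ regs s LO →
                  regs sʳ LO ≡ regs s LO ℕ.+ regs sˡ LEN → total f s ≈ total f sˡ + total f sʳ
    total-split {s} {sˡ} {sʳ} f len≡ loˡ≡ loʳ≡ rewrite len≡ | loˡ≡ | loʳ≡ =
      ≈-trans (Σ<-split (regs sˡ LEN) (regs sʳ LEN) _)
        (+-congˡ (Σ<-cong (regs sʳ LEN) λ i _ → ≈-reflexive (cong f (≡.sym (ℕ.+-assoc (regs s LO) _ i)))))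

    -- The equation for the lower part suffices: the one for the upper part, with `1# - p`, follows
    -- by subtraction. No division by the total occurs, so a total of 0 is covered.
    Balanced-toss : ∀ {s sˡ sʳ p} → regs s LEN ≡ regs sˡ LEN ℕ.+ regs sʳ LEN → regs sˡ LO ≡ regs s LO →
                    regs sʳ LO ≡ regs s LO ℕ.+ regs sˡ LEN → total W s * p ≈ total W sˡ →
                    Balanced s (coin p (done sˡ) (done sʳ))
    Balanced-toss {s} {sˡ} {sʳ} {p} len≡ loˡ≡ loʳ≡ qp≈ h H (coin (done l) (done r)) = begin
      q * (p * h sˡ + (1# - p) * h sʳ)
        ≈⟨ solve 5 (λ q p p′ x y → q :* (p :* x :+ p′ :* y) := (q :* p) :* x :+ (q :* p′) :* y) ≈-refl q p (1# - p) _ _ ⟩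
      (q * p) * h sˡ + (q * (1# - p)) * h sʳ   ≈⟨ +-cong (*-congʳ qp≈) (*-congʳ q[1-p]≈) ⟩
      total W sˡ * h sˡ + total W sʳ * h sʳ    ≈⟨ +-cong l r ⟩
      total H sˡ + total H sʳ                  ≈⟨ total-split {s} {sˡ} {sʳ} H len≡ loˡ≡ loʳ≡ ⟨
      total H s                                ∎
      where
      open ≈-Reasoning
      open SemiringSolver commutativeSemiring
      q = total W s
      q[1-p]≈ : q * (1# - p) ≈ total W sʳ
      q[1-p]≈ = begin
        q * (1# - p)         ≈⟨ x-y≈z (≈-trans
            (≈-trans (≈-sym (*-identityʳ q)) (*-congˡ (≈-sym (≈-trans (+-comm p _) ([x-y]+y≈x 1# p)))))
                (distribˡ q p _)) ⟨
        q - q * p            ≈⟨ x-y≈z (≈-trans (total-split {s} {sˡ} {sʳ} W len≡ loˡ≡ loʳ≡) (+-congʳ (≈-sym qp≈))) ⟩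
        total W sʳ           ∎

  -- The relocated multiplication algorithm

  module Multiplication (M : Carrier) (0≤M : 0# ≤ M) {d : ℕ} (multiply : Program)
    (correct : ∀ (A B : Matrix d d) s → regs s (io 0) ≡ d → HoldsMatrix (io 0) A s → HoldsMatrix (io 1) B s →
       multiply from s inTime M ensures Leaves (HoldsMatrix (io 2) (mul A B)))
    where

    open Logic M 0≤M

    call : Program
    call = shiftᴾ multiply

    -- The original program is run in `s⁻`, which is `s` read through `shift`. The factors are
    -- declared to be whatever the two arrays hold there, so that these preconditions hold by
    -- reflexivity. The charge is one call and no unit step.
    call-sound : ∀ {s} → regs s (shift (io 0)) ≡ d →
      Runs call s 0 1 (Leaves (λ s′ → ∀ i j → i ℕ.< d → j ℕ.< d → reals s′ (shift (io 2)) (i ℕ.* d ℕ.+ j) ≈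
        Σ< d (λ k → reals s (shift (io 0)) (i ℕ.* d ℕ.+ k) * reals s (shift (io 1)) (k ℕ.* d ℕ.+ j))))
    call-sound {s} d≡ =
      let t , τ , p , t≤ , ls = correct A B s⁻ d≡ (λ _ _ → ≈-refl) (λ _ _ → ≈-refl)
          τ′ , p′ , ς = shift-sound p (shifted (λ _ → refl) (λ _ _ → refl) (λ _ _ → refl))
      in runs (t , τ′ , p′ ,
           ≤-respʳ-≈ (≈-sym (≈-trans (+-identityˡ _) (≈-trans (*-congʳ fromℕ-1) (*-identityˡ M)))) t≤ ,
           Leaves-map (λ (s₀ , σ , holds) i j i<d j<d → entry s₀ _ σ holds i j i<d j<d) (Leaves-shift ς ls))
      where
      s⁻ : State
      s⁻ = record { regs = regs s ∘ shift ; ints = ints s ∘ shift ; reals = reals s ∘ shift }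
      A B : Matrix d d
      A i j = reals s⁻ (io 0) (toℕ i ℕ.* d ℕ.+ toℕ j)
      B i j = reals s⁻ (io 1) (toℕ i ℕ.* d ℕ.+ toℕ j)
      entry : ∀ s₀ s′ → Shifted s₀ s′ → HoldsMatrix (io 2) (mul A B) s₀ → ∀ i j → i ℕ.< d → j ℕ.< d →
              reals s′ (shift (io 2)) (i ℕ.* d ℕ.+ j) ≈
              Σ< d (λ k → reals s (shift (io 0)) (i ℕ.* d ℕ.+ k) * reals s (shift (io 1)) (k ℕ.* d ℕ.+ j))
      entry s₀ s′ σ holds i j i<d j<d =
        ≡.subst₂ (λ i j → reals s′ (shift (io 2)) (i ℕ.* d ℕ.+ j) ≈
              Σ< d (λ k → reals s (shift (io 0)) (i ℕ.* d ℕ.+ k) * reals s (shift (io 1)) (k ℕ.* d ℕ.+ j)))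
          (Fin.toℕ-fromℕ< i<d) (Fin.toℕ-fromℕ< j<d)
          (≈-trans (≈-reflexive (Shifted.shiftedReals σ (io 2) _))
            (≈-trans (holds (fromℕ< i<d) (fromℕ< j<d)) (sum≈Σ< d λ k → ≈-refl)))

-- Binary search

-- All numbers stay below 60 and hence apart from the relocated names; disequalities between names
-- hold by evaluation.
count dim blocks dim² index row column base current position block offset next : Name
count    = var 1
dim      = var 2
blocks   = var 3
dim²     = var 4
index    = var 5
row      = var 6
column   = var 7
base     = var 8
current  = var 9
position = var 10
block    = var 11
offset   = var 12
next     = var 13

arg lo len lower mid hi least : Name
arg   = var 14
lo    = var 15
len   = var 16
lower = var 17
mid   = var 18
hi    = var 19
least = var 20

result F-lo F-mid F-hi part whole divisor origin bias : Name
result  = var 50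
F-lo    = var 51
F-mid   = var 52
F-hi    = var 53
part    = var 54
whole   = var 55
divisor = var 56
origin  = var 57
bias    = var 58

-- Reals live only in arrays, so a real scalar is kept in the cell addressed by `dim`, a register
-- that stays constant.
evaluateAt : Program → Name → Name → Program
evaluateAt evaluate x F = arg ≔ reg x ⨾ evaluate ⨾ F ! dim ≔ʳ copy (result ! dim)

bisect : Program
bisect = lower ≔ half len ⨾ mid ≔ lo ⊞ lower ⨾ hi ≔ lo ⊞ len

weigh : Program
weigh =
  part ! dim ≔ʳ (F-mid ! dim) ⊖ (F-lo ! dim) ⨾
  whole ! dim ≔ʳ (F-hi ! dim) ⊖ (F-lo ! dim) ⨾
  divisor ! dim ≔ʳ copy (whole ! dim) ⨾
  origin ! dim ≔ʳ zero ⨾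
  -- Only ≤ can be tested, so equality with 0 takes two comparisons.
  ifʳ whole ! dim ≤ origin ! dim
    then (ifʳ origin ! dim ≤ whole ! dim then divisor ! dim ≔ʳ one else skip)
    else skip

-- Separate from `weigh`, which is straight-line: a division first needs the proof that its divisor
-- is not 0.
divide : Program
divide = bias ! dim ≔ʳ (part ! dim) ⊘ (divisor ! dim)

choose : Program
choose = toss bias ! dim heads len ≔ reg lower tails (lo ≔ reg mid ⨾ len ≔ len ∸ lower)

-- "evaluate" computes the prefix sums F of the weights, from the register arg
-- into the cell result ! dim.  If an interval has weight 0, then the divisor is
-- replaced by 1; this is harmless, since then the lower part has weight 0 too.
halve : Program → Program
halve evaluate =
  bisect ⨾ evaluateAt evaluate lo F-lo ⨾ evaluateAt evaluate mid F-mid ⨾ evaluateAt evaluate hi F-hi ⨾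
  weigh ⨾ divide ⨾ choose

search : Program → Program
search evaluate = while least < len loop halve evaluate

searchNames : List Name
searchNames = dim ∷ least ∷ lo ∷ len ∷ lower ∷ mid ∷ hi ∷ F-lo ∷ F-mid ∷ []

module Search {c ℓ₁ ℓ₂ : Level} (ℝ : RealNumbers c ℓ₁ ℓ₂)
  (M : RealNumbers.Carrier ℝ) (0≤M : RealNumbers._≤_ ℝ (RealNumbers.0# ℝ) M) where

  open RealNumbers ℝ hiding (zero)
    renaming (refl to ≈-refl; sym to ≈-sym; trans to ≈-trans; reflexive to ≈-reflexive)
  open RealProperties ℝ
  open RealRAM ℝ
  open Semantics ℝ
  open Logic M 0≤M
  open Expectation ℝ
  open State

  Runs-outcome : ∀ {ℓ C s t τ} {Φ : Pred Tree ℓ} → C ⊢ s ⇓[ t ] τ → Φ τ → Runs C s t 0 Φ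
  Runs-outcome {t = t} {τ = τ} p φ =
    runs (t , τ , p , ≤-reflexive (≈-sym (≈-trans (+-congˡ (zeroˡ M)) (+-identityʳ _))) , φ)

  scalar : Name → State → Carrier
  scalar a s = reals s a (regs s dim)

  weigh-sound : ∀ s → let x = scalar F-mid s - scalar F-lo s
                          q = scalar F-hi s - scalar F-lo s in
    Runs weigh s (size weigh) 0 (Leaves (λ s′ → (scalar part s′ ≡ x) ×
      ((q ≈ 0#) × (scalar divisor s′ ≡ 1#) ⊎ (¬ q ≈ 0#) × (scalar divisor s′ ≡ q))))
  weigh-sound s = Runs-exec refl post
    where
    post : (scalar part (exec weigh s) ≡ scalar F-mid s - scalar F-lo s) ×
           ((scalar F-hi s - scalar F-lo s ≈ 0#) × (scalar divisor (exec weigh s) ≡ 1#) ⊎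
            (¬ scalar F-hi s - scalar F-lo s ≈ 0#) × (scalar divisor (exec weigh s) ≡ scalar F-hi s - scalar F-lo s))
    post rewrite dec-true (regs s dim ℕ.≟ regs s dim) refl
      with (scalar F-hi s - scalar F-lo s) ≤? 0# | 0# ≤? (scalar F-hi s - scalar F-lo s)
    ... | yes q≤0 | yes 0≤q rewrite dec-true (regs s dim ℕ.≟ regs s dim) refl =
      refl , inj₁ (antisym q≤0 0≤q , refl)
    ... | yes q≤0 | no ¬0≤q rewrite dec-true (regs s dim ℕ.≟ regs s dim) refl =
      refl , inj₂ ((λ q≈0 → ¬0≤q (≤-reflexive (≈-sym q≈0))) , refl)
    ... | no ¬q≤0 | _       rewrite dec-true (regs s dim ℕ.≟ regs s dim) refl =
      refl , inj₂ ((λ q≈0 → ¬q≤0 (≤-reflexive q≈0)) , refl)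

  -- `G j i` is the share of the weight of position `j` that goes to outcome `i`. The balance of `C`
  -- is applied to the probability of `i` after `D`; at a leaf one position is left, and its weight
  -- is the factor in the assumption on `D`. Both levels of the search use this.
  sample : ∀ {W : ℕ → Carrier} {C D s u m u′ m′ ℓ ℓ′} {P : Pred State ℓ} {Q : Pred State ℓ′} {G : ℕ → ℕ → Carrier} {x} →
    let open Intervals lo len W in
    Runs C s u m (λ τ → Balanced s τ × Leaves (λ s′ → regs s′ len ≡ 1 × P s′) τ) →
    (∀ {s′} → P s′ → Runs D s′ u′ m′ (λ τ → Distributed (W (regs s′ lo)) (G (regs s′ lo)) x τ × Leaves Q τ)) →
    Runs (C ⨾ D) s (u ℕ.+ u′) (m ℕ.+ m′)
      (λ τ → Distributed (total W s) (λ i → total (λ j → G j i) s) x τ × Leaves Q τ)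
  sample {W} {P = P} {Q} {G} {x} r next = Runs-seq r
    (λ (_ , ls) → Leaves-map (λ (_ , p) → next p) ls)
    (λ {τ} {k} (balanced , ls) ds →
      (λ i → ≈-trans (*-congˡ (≈-reflexive (Pr-bind τ k x i)))
        (balanced (λ s′ → Pr (k s′) x i) (λ j → G j i) (Leaves-map
          (λ {s′} ((len≡1 , _) , (d , _)) → ≈-trans (*-congʳ (total-single {s′} W len≡1))
              (≈-trans (d i) (≈-sym (total-single {s′} (λ j → G j i) len≡1))))
          (Leaves-zip ls ds)))) ,
      Leaves-bind (Leaves-map proj₂ ds))
    where open Intervals lo len W

  evaluateAt-free : ∀ evaluate x F {y} → touches evaluate y ≡ false → does (y ≟ᴺ arg) ≡ false →
                    does (y ≟ᴺ F) ≡ false → touches (evaluateAt evaluate x F) y ≡ false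
  evaluateAt-free evaluate x F e a f = cong₂ _∨_ a (cong₂ _∨_ e f)

  -- Evaluation is assumed to be correct only up to `bound`, where the stored prefix sums end, and
  -- only in states that differ from `s₀` by writes of the search.
  module Evaluated (evaluate : Program) (U bound : ℕ) (W : ℕ → Carrier) (s₀ : State)
    (free : Untouched evaluate searchNames)
    (evaluates : ∀ s → Frame (halve evaluate) s₀ s → regs s arg ℕ.≤ bound →
       Runs evaluate s U 0 (Leaves (λ s′ → scalar result s′ ≈ Σ< (regs s arg) W)))
    {z z⁻¹ : Carrier} (z⁻¹z≈1 : z⁻¹ * z ≈ 1#) (0≤zW : ∀ i → 0# ≤ z * W i)
    where

    open Intervals lo len W

    evaluateAt-sound : ∀ x F s → (∀ {s′} → Frame (evaluateAt evaluate x F) s s′ → Frame (halve evaluate) s₀ s′) →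
      regs s x ℕ.≤ bound →
      Runs (evaluateAt evaluate x F) s (U ℕ.+ 2) 0 (Leaves (λ s′ → scalar F s′ ≈ Σ< (regs s x) W))
    evaluateAt-sound x F s f x≤ =
      Runs-≤ (ℕ.≤-reflexive (≡.trans (cong suc (ℕ.+-comm U 1)) (ℕ.+-comm 2 U))) ℕ.≤-refl
        (Runs-exec {P = _≡ setReg arg (regs s x) s} refl refl then (Leaves-closed , λ { refl →
          evaluates (setReg arg (regs s x) s)
            (f (Frame-ˡ (arg ≔ reg x) (evaluate ⨾ assignment) λ y y≢arg →
              unchanged (update-other (regs s) (regs s x) y≢arg) (λ _ → refl) (λ _ → refl))) x≤
          then (Leaves-closed , λ {s′} p → Runs-exec refl
            (≈-trans (≈-reflexive (update₂-same (reals s′) F (regs s′ dim) _)) p)) }))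
      where assignment = F ! dim ≔ʳ copy (result ! dim)

    Interval : Pred State _
    Interval s = 1 ℕ.≤ regs s len × regs s lo ℕ.+ regs s len ℕ.≤ bound

    total≈ : ∀ s {a b} → a ≈ Σ< (regs s lo) W → b ≈ Σ< (regs s lo ℕ.+ regs s len) W → b - a ≈ total W s
    total≈ s a≈ b≈ = x-y≈z (≈-trans b≈ (≈-trans (Σ<-split (regs s lo) (regs s len) W) (+-congʳ (≈-sym a≈))))

    0≤z*total : ∀ s → 0# ≤ z * total W s
    0≤z*total s = ≤-respʳ-≈ (≈-sym (*-distribˡ-Σ< (regs s len) z _)) (Σ<-nonNegative (regs s len) λ i → 0≤zW _)

    halve-sound : ∀ s → Frame (halve evaluate) s₀ s → 1 ℕ.< regs s len → regs s lo ℕ.+ regs s len ℕ.≤ bound →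
      Runs (halve evaluate) s (3 ℕ.* U ℕ.+ 20) 0 (λ τ → Balanced s τ ×
        Leaves (λ s′ → Interval s′ × regs s′ len ℕ.≤ ℕ.⌈ regs s len /2⌉) τ)
    halve-sound s f 1<n ≤bound =
      -- Bisecting takes 3 steps, each evaluation adds 2, `weigh` takes 7, the division 1, and the
      -- coin with its longer branch 3.
      Runs-≤ (ℕ.≤-reflexive (solve 1 (λ U → con 3 :+
          ((U :+ con 2) :+ ((U :+ con 2) :+ ((U :+ con 2) :+ (con (size weigh) :+ (con 1 :+ con 3)))))
                                     := con 3 :* U :+ con 20) refl U)) ℕ.≤-refl
        (Runs-exec {P = _≡ s₁} refl refl then (closed , λ { refl →
         Runs-Leaves-frame (evaluateAt-sound lo F-lo s₁ (lift₁ f₁) (ℕ.m+n≤o⇒m≤o (regs s lo) ≤bound))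
             then (closed , λ {s₂} (F-lo≈ , g₂) →
         Runs-Leaves-frame (evaluateAt-sound mid F-mid s₂ (lift₂ (lift₁ f₁ g₂))
           (≡.subst (ℕ._≤ bound) (≡.sym (sameReg (g₂ mid (free₁ refl mid-free refl)))) mid≤))
               then (closed , λ {s₃} (F-mid≈ , g₃) →
         Runs-Leaves-frame (evaluateAt-sound hi F-hi s₃ (lift₃ (lift₂ (lift₁ f₁ g₂) g₃))
           (≡.subst (ℕ._≤ bound) (≡.sym (≡.trans (sameReg (g₃ hi (free₂ refl hi-free refl)))
               (sameReg (g₂ hi (free₁ refl hi-free refl))))) ≤bound))
           then (closed , λ {s₄} (F-hi≈ , g₄) →
         Runs-Leaves-frame (weigh-sound s₄) then (closed , λ {s₅} ((part≡ , divisor≡) , g₅) →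
         finish s₂ s₃ s₄ s₅ g₂ g₃ g₄ g₅ F-lo≈ F-mid≈ F-hi≈ part≡ divisor≡)))) }))
      where
      open +-*-Solver
      s₁ = exec bisect s
      e₁ = evaluateAt evaluate lo F-lo
      e₂ = evaluateAt evaluate mid F-mid
      e₃ = evaluateAt evaluate hi F-hi
      r₃ = weigh ⨾ divide ⨾ choose
      n = regs s len
      n₁ = ℕ.⌊ n /2⌋
      dim-free   = All.head free
      lo-free    = All.head (All.tail (All.tail free))
      len-free   = All.head (All.tail (All.tail (All.tail free)))
      lower-free = All.head (All.tail (All.tail (All.tail (All.tail free))))
      mid-free   = All.head (All.tail (All.tail (All.tail (All.tail (All.tail free)))))
      hi-free    = All.head (All.tail (All.tail (All.tail (All.tail (All.tail (All.tail free))))))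
      F-lo-free  = All.head (All.tail (All.tail (All.tail (All.tail (All.tail (All.tail (All.tail free)))))))
      F-mid-free = All.head (All.tail (All.tail (All.tail (All.tail (All.tail (All.tail (All.tail (All.tail free))))))))

      free₁ : ∀ {y} → does (y ≟ᴺ arg) ≡ false → touches evaluate y ≡ false → does (y ≟ᴺ F-lo) ≡ false →
          touches e₁ y ≡ false
      free₁ a e b = evaluateAt-free evaluate lo F-lo e a b
      free₂ : ∀ {y} → does (y ≟ᴺ arg) ≡ false → touches evaluate y ≡ false → does (y ≟ᴺ F-mid) ≡ false →
          touches e₂ y ≡ false
      free₂ a e b = evaluateAt-free evaluate mid F-mid e a b
      free₃ : ∀ {y} → does (y ≟ᴺ arg) ≡ false → touches evaluate y ≡ false → does (y ≟ᴺ F-hi) ≡ false →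
          touches e₃ y ≡ false
      free₃ a e b = evaluateAt-free evaluate hi F-hi e a b

      n₁≤n : n₁ ℕ.≤ n
      n₁≤n = ℕ.⌊n/2⌋≤n n
      mid≤ : regs s lo ℕ.+ n₁ ℕ.≤ bound
      mid≤ = ℕ.≤-trans (ℕ.+-monoʳ-≤ (regs s lo) n₁≤n) ≤bound

      f₁ : Frame (halve evaluate) s₀ s₁
      f₁ = Frame-trans {C = halve evaluate} f (Frame-ˡ bisect (e₁ ⨾ e₂ ⨾ e₃ ⨾ r₃)
        (exec-frame bisect s refl))
      lift₁ : ∀ {s s′} → Frame (halve evaluate) s₀ s → Frame e₁ s s′ → Frame (halve evaluate) s₀ s′
      lift₁ f g = Frame-trans {C = halve evaluate} f (Frame-ʳ bisect (e₁ ⨾ e₂ ⨾ e₃ ⨾ r₃) (Frame-ˡ e₁ (e₂ ⨾ e₃ ⨾ r₃) g))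
      lift₂ : ∀ {s s′} → Frame (halve evaluate) s₀ s → Frame e₂ s s′ → Frame (halve evaluate) s₀ s′
      lift₂ f g = Frame-trans {C = halve evaluate} f
          (Frame-ʳ bisect (e₁ ⨾ e₂ ⨾ e₃ ⨾ r₃) (Frame-ʳ e₁ (e₂ ⨾ e₃ ⨾ r₃) (Frame-ˡ e₂ (e₃ ⨾ r₃) g)))
      lift₃ : ∀ {s s′} → Frame (halve evaluate) s₀ s → Frame e₃ s s′ → Frame (halve evaluate) s₀ s′
      lift₃ f g = Frame-trans {C = halve evaluate} f
          (Frame-ʳ bisect (e₁ ⨾ e₂ ⨾ e₃ ⨾ r₃) (Frame-ʳ e₁ (e₂ ⨾ e₃ ⨾ r₃) (Frame-ʳ e₂ (e₃ ⨾ r₃) (Frame-ˡ e₃ r₃ g))))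

      Post : Pred Tree _
      Post τ = Balanced s τ × Leaves (λ s′ → Interval s′ × regs s′ len ℕ.≤ ℕ.⌈ n /2⌉) τ
      closed : CoinClosed Post
      closed p l r (b , ls) (b′ , rs) = Balanced-closed {s} p l r b b′ , coin ls rs

      sˡ sʳ : State → State
      sˡ t = setReg len (regs t lower) t
      sʳ t = setReg len (regs t len ℕ.∸ regs t lower) (setReg lo (regs t mid) t)

      finish : ∀ s₂ s₃ s₄ s₅ → Frame e₁ s₁ s₂ → Frame e₂ s₂ s₃ → Frame e₃ s₃ s₄ → Frame weigh s₄ s₅ →
        scalar F-lo s₂ ≈ Σ< (regs s lo) W → scalar F-mid s₃ ≈ Σ< (regs s₂ mid) W → scalar F-hi s₄ ≈ Σ< (regs s₃ hi) W →
        scalar part s₅ ≡ scalar F-mid s₄ - scalar F-lo s₄ →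
        ((scalar F-hi s₄ - scalar F-lo s₄ ≈ 0#) × (scalar divisor s₅ ≡ 1#) ⊎
         (¬ scalar F-hi s₄ - scalar F-lo s₄ ≈ 0#) × (scalar divisor s₅ ≡ scalar F-hi s₄ - scalar F-lo s₄)) →
        Runs (divide ⨾ choose) s₅ 4 0 Post
      finish s₂ s₃ s₄ s₅ g₂ g₃ g₄ g₅ F-lo≈ F-mid≈ F-hi≈ part≡ divisor≡ =
        Runs-outcome {t = 4} {τ = coin p (done (sˡ s₆)) (done (sʳ s₆))}
          (seq {t = 1} {k = λ t → coin (fetch (bias ! dim) t) (done (sˡ t)) (done (sʳ t))} (assignʳ (proj₁ fair))
            (done (toss (subst (0# ≤_) (≡.sym p≡) (proj₁ (proj₂ fair)))
                (subst (_≤ 1#) (≡.sym p≡) (proj₁ (proj₂ (proj₂ fair))))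
              assign (seq {t = 1} {k = λ t → done (setReg len (regs t len ℕ.∸ regs t lower) t)} assign (done assign)))))
          (Balanced-toss {s} {sˡ s₆} {sʳ s₆} len≡ lo₅ (≡.trans mid₅ (cong (regs s lo ℕ.+_) (≡.sym lower₅)))
             (≈-trans (*-congˡ (≈-reflexive p≡)) (proj₂ (proj₂ (proj₂ fair)))) ,
           coin (done ((1≤n₁ , ≤boundˡ) , ≤⌈n/2⌉ˡ)) (done ((1≤n₂ , ≤boundʳ) , ≤⌈n/2⌉ʳ)))
        where
        keep : ∀ y → does (y ≟ᴺ arg) ≡ false → touches evaluate y ≡ false → does (y ≟ᴺ F-lo) ≡ false →
               does (y ≟ᴺ F-mid) ≡ false → does (y ≟ᴺ F-hi) ≡ false → touches weigh y ≡ false → regs s₅ y ≡ regs s₁ y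
        keep y a e b b′ b″ w = ≡.trans (sameReg (g₅ y w)) (≡.trans (sameReg (g₄ y (free₃ a e b″)))
          (≡.trans (sameReg (g₃ y (free₂ a e b′))) (sameReg (g₂ y (free₁ a e b)))))

        lo₅ : regs s₅ lo ≡ regs s lo
        lo₅ = keep lo refl lo-free refl refl refl refl
        len₅ : regs s₅ len ≡ n
        len₅ = keep len refl len-free refl refl refl refl
        lower₅ : regs s₅ lower ≡ n₁
        lower₅ = keep lower refl lower-free refl refl refl refl
        mid₅ : regs s₅ mid ≡ regs s lo ℕ.+ n₁
        mid₅ = keep mid refl mid-free refl refl refl refl

        n₂ = n ℕ.∸ n₁
        n₂≡ : n₂ ≡ ℕ.⌈ n /2⌉
        n₂≡ = ≡.trans (cong (ℕ._∸ n₁) (≡.sym (ℕ.⌊n/2⌋+⌈n/2⌉≡n n))) (ℕ.m+n∸m≡n n₁ ℕ.⌈ n /2⌉)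
        len₂ : regs s₅ len ℕ.∸ regs s₅ lower ≡ n₂
        len₂ = cong₂ ℕ._∸_ len₅ lower₅
        len≡ : n ≡ regs s₅ lower ℕ.+ (regs s₅ len ℕ.∸ regs s₅ lower)
        len≡ = ≡.sym (≡.trans (cong₂ ℕ._+_ lower₅ len₂) (ℕ.m+[n∸m]≡n n₁≤n))

        0<n₁ : 1 ℕ.≤ n₁
        0<n₁ = ℕ.⌊n/2⌋-mono 1<n
        1≤n₁ : 1 ℕ.≤ regs s₅ lower
        1≤n₁ = subst (1 ℕ.≤_) (≡.sym lower₅) 0<n₁
        1≤n₂ : 1 ℕ.≤ regs s₅ len ℕ.∸ regs s₅ lower
        1≤n₂ = subst (1 ℕ.≤_) (≡.sym (≡.trans len₂ n₂≡)) (ℕ.≤-trans 0<n₁ (ℕ.⌊n/2⌋≤⌈n/2⌉ n))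
        ≤⌈n/2⌉ˡ : regs s₅ lower ℕ.≤ ℕ.⌈ n /2⌉
        ≤⌈n/2⌉ˡ = subst (ℕ._≤ _) (≡.sym lower₅) (ℕ.⌊n/2⌋≤⌈n/2⌉ n)
        ≤⌈n/2⌉ʳ : regs s₅ len ℕ.∸ regs s₅ lower ℕ.≤ ℕ.⌈ n /2⌉
        ≤⌈n/2⌉ʳ = ℕ.≤-reflexive (≡.trans len₂ n₂≡)
        ≤boundˡ : regs s₅ lo ℕ.+ regs s₅ lower ℕ.≤ bound
        ≤boundˡ = subst (ℕ._≤ bound) (≡.sym (cong₂ ℕ._+_ lo₅ lower₅)) mid≤
        ≤boundʳ : regs s₅ mid ℕ.+ (regs s₅ len ℕ.∸ regs s₅ lower) ℕ.≤ bound
        ≤boundʳ = subst (ℕ._≤ bound) (≡.sym (≡.trans (cong₂ ℕ._+_ mid₅ len₂)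
          (≡.trans (ℕ.+-assoc (regs s lo) n₁ n₂) (cong (regs s lo ℕ.+_) (ℕ.m+[n∸m]≡n n₁≤n))))) ≤bound

        scalar-keep : ∀ {a s s′} → Unchanged a s s′ → Unchanged dim s s′ → scalar a s′ ≡ scalar a s
        scalar-keep {a} {s} f d = ≡.trans (sameReal f _) (cong (reals s a) (sameReg d))
        dim₃ = g₃ dim (free₂ refl dim-free refl)
        dim₄ = g₄ dim (free₃ refl dim-free refl)
        F-lo₄ : scalar F-lo s₄ ≈ Σ< (regs s lo) W
        F-lo₄ = ≈-trans (≈-reflexive (≡.trans (scalar-keep {F-lo} (g₄ F-lo (free₃ refl F-lo-free refl)) dim₄)
                                              (scalar-keep {F-lo} (g₃ F-lo (free₂ refl F-lo-free refl)) dim₃))) F-lo≈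
        F-mid₄ : scalar F-mid s₄ ≈ Σ< (regs s lo ℕ.+ n₁) W
        F-mid₄ = ≈-trans (≈-reflexive (scalar-keep {F-mid} (g₄ F-mid (free₃ refl F-mid-free refl)) dim₄))
                  (≈-trans F-mid≈ (≈-reflexive (cong (λ x → Σ< x W) (sameReg (g₂ mid (free₁ refl mid-free refl))))))
        F-hi₄ : scalar F-hi s₄ ≈ Σ< (regs s lo ℕ.+ n) W
        F-hi₄ = ≈-trans F-hi≈ (≈-reflexive (cong (λ x → Σ< x W)
                  (≡.trans (sameReg (g₃ hi (free₂ refl hi-free refl))) (sameReg (g₂ hi (free₁ refl hi-free refl))))))

        X = total W (sˡ s₅)
        Y = total W (sʳ s₅)
        part≈ : scalar part s₅ ≈ X
        part≈ = ≈-trans (≈-reflexive part≡) (total≈ (sˡ s₅)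
          (≈-trans F-lo₄ (≈-reflexive (cong (λ x → Σ< x W) (≡.sym lo₅))))
          (≈-trans F-mid₄ (≈-reflexive (cong (λ x → Σ< x W) (≡.sym (cong₂ ℕ._+_ lo₅ lower₅))))))
        whole≈ : scalar F-hi s₄ - scalar F-lo s₄ ≈ total W s
        whole≈ = total≈ s F-lo₄ F-hi₄
        X+Y≈ : total W s ≈ X + Y
        X+Y≈ = total-split {s} {sˡ s₅} {sʳ s₅} W len≡ lo₅ (≡.trans mid₅ (cong (regs s lo ℕ.+_) (≡.sym lower₅)))

        p₀ = scalar part s₅ * scalar divisor s₅ ⁻¹
        s₆ = setReal bias (regs s₅ dim) p₀ s₅
        p = fetch (bias ! dim) s₆
        p≡ : p ≡ p₀
        p≡ = update₂-same (reals s₅) bias (regs s₅ dim) p₀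

        open Bias {X} {Y} {z} {z⁻¹} z⁻¹z≈1 (0≤z*total (sˡ s₅)) (0≤z*total (sʳ s₅))
        open ≈-Reasoning

        Fair : Set _
        Fair = (¬ scalar divisor s₅ ≈ 0#) × (0# ≤ p₀) × (p₀ ≤ 1#) × (total W s * p₀ ≈ X)
        fair-empty : scalar F-hi s₄ - scalar F-lo s₄ ≈ 0# → scalar divisor s₅ ≡ 1# → Fair
        fair-empty q≈0 divisor≡1 =
          (λ divisor≈0 → 0≉1 (≈-trans (≈-sym divisor≈0) (≈-reflexive divisor≡1))) ,
          ≤-reflexive (≈-sym p₀≈0) , ≤-respˡ-≈ (≈-sym p₀≈0) 0≤1 ,
          (begin
            total W s * p₀   ≈⟨ *-congˡ p₀≈0 ⟩
            total W s * 0#   ≈⟨ zeroʳ _ ⟩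
            0#               ≈⟨ X≈0 ⟨
            X                ∎)
          where
          X≈0 : X ≈ 0#
          X≈0 = x+y≈0⇒x≈0 (≈-trans (≈-sym X+Y≈) (≈-trans (≈-sym whole≈) q≈0))
          p₀≈0 : p₀ ≈ 0#
          p₀≈0 = ≈-trans (*-congʳ (≈-trans part≈ X≈0)) (zeroˡ _)
        fair-nonempty : ¬ scalar F-hi s₄ - scalar F-lo s₄ ≈ 0# →
            scalar divisor s₅ ≡ scalar F-hi s₄ - scalar F-lo s₄ → Fair
        fair-nonempty q≉0 divisor≡q =
          divisor≉0 , ≤-respʳ-≈ (≈-sym p₀≈) (0≤xw inverse) , ≤-respˡ-≈ (≈-sym p₀≈) (xw≤1 inverse) ,
          ≈-trans (*-cong X+Y≈ p₀≈) ([x+y]xw≈x inverse)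
          where
          divisor≉0 : ¬ scalar divisor s₅ ≈ 0#
          divisor≉0 divisor≈0 = q≉0 (≈-trans (≈-reflexive (≡.sym divisor≡q)) divisor≈0)
          inverse : (X + Y) * scalar divisor s₅ ⁻¹ ≈ 1#
          inverse = ≈-trans (*-congʳ (≈-trans (≈-sym X+Y≈) (≈-trans (≈-sym whole≈) (≈-reflexive (≡.sym divisor≡q)))))
                            (⁻¹-inverseʳ divisor≉0)
          p₀≈ : p₀ ≈ X * scalar divisor s₅ ⁻¹
          p₀≈ = *-congʳ part≈
        fair : Fair
        fair = [ uncurry fair-empty , uncurry fair-nonempty ]′ divisor≡

    -- The longer half ⌈len/2⌉ of an interval of length at most 2^(L+1) has length at most 2^L, so
    -- uneven halves cost no extra round.
    search-sound : ∀ L s → Frame (halve evaluate) s₀ s → regs s least ≡ 1 → regs s len ℕ.≤ 2 ℕ.^ L → Interval s →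
      Runs (search evaluate) s (L ℕ.* (3 ℕ.* U ℕ.+ 21) ℕ.+ 1) 0 (λ τ → Balanced s τ × Leaves (λ s′ → regs s′ len ≡ 1) τ)
    search-sound L s f least≡ ≤2^L (1≤len , ≤bound) with regs s least ℕ.<? regs s len
    ... | no ≮ = Runs-≤ (ℕ.m≤n+m 1 _) ℕ.z≤n
      (Runs-stop ≮ (Balanced-done {s} {s} refl refl ,
          done (ℕ.≤-antisym (subst (regs s len ℕ.≤_) least≡ (ℕ.≮⇒≥ ≮)) 1≤len)))
    search-sound ℕ.zero s f least≡ ≤2^L (1≤len , ≤bound) | yes 1< =
      contradiction ≤2^L (ℕ.<⇒≱ (subst (ℕ._< regs s len) least≡ 1<))
    search-sound (suc L) s f least≡ ≤2^L (1≤len , ≤bound) | yes 1< =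
      Runs-≤ (ℕ.≤-reflexive (solve 2 (λ L U → con 1 :+ ((con 3 :* U :+ con 20) :+ (L :* (con 3 :* U :+ con 21) :+ con 1))
                                     := (con 1 :+ L) :* (con 3 :* U :+ con 21) :+ con 1) refl L U)) ℕ.≤-refl
        (Runs-again 1< (Runs-seq {Φ′ = Post}
          (Runs-frame (halve-sound s f (subst (ℕ._< regs s len) least≡ 1<) ≤bound))
          (λ ((_ , ls) , gs) → Leaves-map (λ {s′} ((interval , len≤) , g) →
            search-sound L s′ (Frame-trans {C = halve evaluate} f g)
              (≡.trans (sameReg (g least least-free)) least≡) (ℕ.≤-trans len≤ ⌈len/2⌉≤) interval) (Leaves-zip ls gs))
          (λ ((b , _) , _) ls → Balanced-bind {s} b (Leaves-map proj₁ ls) , Leaves-bind (Leaves-map proj₂ ls))))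
      where
      open +-*-Solver
      Post : Pred Tree _
      Post τ = Balanced s τ × Leaves (λ s′ → regs s′ len ≡ 1) τ
      ⌈len/2⌉≤ : ℕ.⌈ regs s len /2⌉ ℕ.≤ 2 ℕ.^ L
      ⌈len/2⌉≤ = subst (ℕ.⌈ regs s len /2⌉ ℕ.≤_)
        (≡.sym (≡.trans (ℕ.n≡⌈n+n/2⌉ (2 ℕ.^ L)) (cong (λ x → ℕ.⌈ 2 ℕ.^ L ℕ.+ x /2⌉) (≡.sym (ℕ.+-identityʳ _)))))
            (ℕ.⌈n/2⌉-mono ≤2^L)
      least-free : touches (halve evaluate) least ≡ false
      least-free = cong₂ _∨_ e (cong₂ _∨_ e (cong (_∨ false) e))
        where e : touches evaluate least ∨ false ≡ false
              e = ≡.trans (∨-identityʳ _) (All.head (All.tail free))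

-- Elementary loops

vectors coefficients gram rows columns scaled coefficient sums product : Name
vectors      = var 40
coefficients = var 41
gram         = var 42
rows         = var 43
columns      = var 44
scaled       = var 45
coefficient  = var 46
sums         = var 47
product      = var 48

copyArray : Name → Name → Name → Program
copyArray dst src n = for index < n loop (dst ! index ≔ʳ copy (src ! index))

-- One loop for two purposes: the last cell is the inner product of the query with a stored matrix,
-- and the cells at multiples of `dim` are the prefix weights inside a block.
prefixSums : Name → Name → Program
prefixSums X Y =
  position ≔ const 0 ⨾ sums ! position ≔ʳ zero ⨾
  for index < dim² loop
    (position ≔ offset ⊞ index ⨾
     product ! index ≔ʳ (X ! index) ⊗ (Y ! position) ⨾
     next ≔ const 1 ⨾ next ≔ index ⊞ next ⨾
     sums ! next ≔ʳ (sums ! index) ⊕ (product ! index))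

clear : Program
clear = for index < dim² loop (gram ! index ≔ʳ zero)

accumulate : Program
accumulate = for index < dim² loop
  (position ≔ offset ⊞ index ⨾ next ≔ offset ⊞ dim² ⨾ next ≔ next ⊞ index ⨾
   gram ! next ≔ʳ (gram ! position) ⊕ (shift (io 2) ! index))

loadCell : Name → Name → Name → Program
loadCell dst src x = if current < count then dst ! index ≔ʳ copy (src ! x) else (dst ! index ≔ʳ zero)

locate : Name → Name → Program
locate i j = current ≔ base ⊞ i ⨾ position ≔ current ⊠ dim ⨾ position ≔ position ⊞ j

-- There is no instruction for integer division, so the row and the column of a flat index are
-- advanced like an odometer.
carry : Program
carry =
  next ≔ const 1 ⨾ column ≔ column ⊞ next ⨾
  if column < dim then skip else (column ≔ const 0 ⨾ row ≔ row ⊞ next)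

loadEntry : Program
loadEntry =
  (locate row column ⨾ loadCell rows vectors position) ⨾
  loadCell coefficient coefficients current ⨾
  scaled ! index ≔ʳ (coefficient ! index) ⊗ (rows ! index) ⨾
  (locate column row ⨾ loadCell columns vectors position) ⨾
  carry

-- Here index = row * dim + column throughout.
load-block : Program
load-block = base ≔ block ⊠ dim ⨾ row ≔ const 0 ⨾ column ≔ const 0 ⨾ for index < dim² loop loadEntry

[i*d+j]/d≡i : ∀ i {j d} .{{_ : ℕ.NonZero d}} → j ℕ.< d → (i ℕ.* d ℕ.+ j) / d ≡ i
[i*d+j]/d≡i i {j} {d} j<d = ≡.trans (+-distrib-/-∣ˡ j (n∣m*n i))
  (≡.trans (cong₂ ℕ._+_ (m*n/n≡m i d) (m<n⇒m/n≡0 j<d)) (ℕ.+-identityʳ i))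

[i*d+j]%d≡j : ∀ i {j d} .{{_ : ℕ.NonZero d}} → j ℕ.< d → (i ℕ.* d ℕ.+ j) % d ≡ j
[i*d+j]%d≡j i {j} {d} j<d = ≡.trans (cong (_% d) (ℕ.+-comm (i ℕ.* d) j))
  (≡.trans ([m+kn]%n≡m%n j i d) (m<n⇒m%n≡m j<d))

i*d+j<m*d : ∀ {i j m d} → i ℕ.< m → j ℕ.< d → i ℕ.* d ℕ.+ j ℕ.< m ℕ.* d
i*d+j<m*d {i} {j} {m} {d} i<m j<d = ℕ.≤-trans (ℕ.+-monoʳ-< (i ℕ.* d) j<d)
  (ℕ.≤-trans (ℕ.≤-reflexive (ℕ.+-comm (i ℕ.* d) d)) (ℕ.*-monoˡ-≤ d i<m))

-- The common step of all loops that fill an array from the left.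
update₂-fill : ∀ {b p} {B : Set b} (P : ℕ → B → Set p) (f : Name → ℕ → B) a j v →
               (∀ t → t ℕ.< j → P t (f a t)) → P j v → ∀ t → t ℕ.< suc j → P t ((_[_,_↦_] f a j v) a t)
update₂-fill P f a j v below at t t<1+j with t ℕ.≟ j
... | yes refl = subst (P t) (≡.sym (update₂-same f a t v)) at
... | no t≢j   = subst (P t) (≡.sym (update₂-index f a v t≢j)) (below t (ℕ.≤∧≢⇒< (ℕ.≤-pred t<1+j) t≢j))

module Extension {c ℓ₁ ℓ₂ : Level} (ℝ : RealNumbers c ℓ₁ ℓ₂) {n d : ℕ}
  (v : Fin n → Fin d → RealNumbers.Carrier ℝ) (α : Fin n → RealNumbers.Carrier ℝ) where

  open RealNumbers ℝ using (Carrier)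
  open RealProperties ℝ

  -- Padding by zeros makes the last block complete.
  v⁺ : ℕ → ℕ → Carrier
  v⁺ r j = extend (λ i → extend (v i) j) r

  α⁺ : ℕ → Carrier
  α⁺ = extend α

  v⁺-toℕ : ∀ i j → v⁺ (toℕ i) (toℕ j) ≡ v i j
  v⁺-toℕ i j = ≡.trans (extend-toℕ (λ i → extend (v i) (toℕ j)) i) (extend-toℕ (v i) j)

module Loops {c ℓ₁ ℓ₂ : Level} (ℝ : RealNumbers c ℓ₁ ℓ₂)
  (M : RealNumbers.Carrier ℝ) (0≤M : RealNumbers._≤_ ℝ (RealNumbers.0# ℝ) M) where

  open RealNumbers ℝ hiding (zero)
    renaming (refl to ≈-refl; sym to ≈-sym; trans to ≈-trans; reflexive to ≈-reflexive)
  open RealProperties ℝ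
  open RealRAM ℝ
  open Semantics ℝ
  open Logic M 0≤M
  open State

  copyArray-sound : ∀ {dst src n s₀} → does (n ≟ᴺ index) ≡ false → does (n ≟ᴺ unit) ≡ false →
    does (n ≟ᴺ dst) ≡ false → does (index ≟ᴺ dst) ≡ false → touches (copyArray dst src n) src ≡ false →
    Runs (copyArray dst src n) s₀ (suc (regs s₀ n ℕ.* 4 ℕ.+ 1)) 0
      (Leaves (λ s → ∀ t → t ℕ.< regs s₀ n → reals s dst t ≡ reals s₀ src t))
  copyArray-sound {dst} {src} {n} {s₀} n≢index n≢unit n≢dst index≢dst src-free =
    subst (λ m → Runs (copyArray dst src n) s₀ (suc (N ℕ.* 4 ℕ.+ 1)) m (Leaves (I N))) (ℕ.*-zeroʳ N)
      (for-sound {m = 0} N I refl n≢index n≢unit refl index≢dst n≢dst (λ _ ()) step)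
    where
    N = regs s₀ n
    I : ℕ → State → Set c
    I j s = ∀ t → t ℕ.< j → reals s dst t ≡ reals s₀ src t
    step : ∀ j s → j ℕ.< N → Frame (copyArray dst src n) s₀ s → regs s index ≡ j → I j s →
           Runs (dst ! index ≔ʳ copy (src ! index)) s 1 0 (Leaves (λ s′ → I (suc j) (exec (increment index) s′)))
    step _ s _ f refl ih = Runs-exec refl
      (update₂-fill (λ t r → r ≡ reals s₀ src t) (reals s) dst (regs s index) _ ih (sameReal (f src src-free) _))

  prefixSums-sound : ∀ {X Y s₀} → touches (prefixSums X Y) X ≡ false → touches (prefixSums X Y) Y ≡ false →
    Runs (prefixSums X Y) s₀ (3 ℕ.+ (regs s₀ dim² ℕ.* 8 ℕ.+ 1)) 0
      (Leaves (λ s → ∀ t → t ℕ.≤ regs s₀ dim² →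
        reals s sums t ≈ Σ< t (λ k → reals s₀ X k * reals s₀ Y (regs s₀ offset ℕ.+ k))))
  prefixSums-sound {X} {Y} {s₀} X-free Y-free =
    Runs-exec {P = _≡ s₁} refl refl then (Leaves-closed , λ { refl →
      Runs-exec {P = _≡ s₂} refl refl then (Leaves-closed , λ { refl →
        Runs-map (Leaves-map λ p t t≤N → p t (ℕ.s≤s t≤N))
          (subst (λ m → Runs (for index < dim² loop body) s₂ (suc (N ℕ.* 8 ℕ.+ 1)) m (Leaves (I N))) (ℕ.*-zeroʳ N)
            (for-sound {m = 0} N I refl refl refl refl refl refl
              (λ { ℕ.zero _ → ≈-reflexive (update₂-same (reals s₀) sums 0 0#) ; (suc _) (ℕ.s≤s ()) }) step)) }) })
    where
    N = regs s₀ dim²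
    s₁ = exec (position ≔ const 0) s₀
    s₂ = exec (sums ! position ≔ʳ zero) s₁
    body = position ≔ offset ⊞ index ⨾
     product ! index ≔ʳ (X ! index) ⊗ (Y ! position) ⨾
     next ≔ const 1 ⨾ next ≔ index ⊞ next ⨾
     sums ! next ≔ʳ (sums ! index) ⊕ (product ! index)
    rest = sums ! position ≔ʳ zero ⨾ for index < dim² loop body
    term : ℕ → Carrier
    term k = reals s₀ X k * reals s₀ Y (regs s₀ offset ℕ.+ k)
    I : ℕ → State → Set ℓ₁
    -- After j products there are j + 1 prefix sums: cell 0 holds the empty one.
    I j s = ∀ t → t ℕ.< suc j → reals s sums t ≈ Σ< t term
    whole-frame : ∀ {s} → Frame (for index < dim² loop body) s₂ s → Frame (prefixSums X Y) s₀ s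
    whole-frame f = Frame-trans {C = prefixSums X Y} g
        (Frame-ʳ (position ≔ const 0) rest (Frame-ʳ (sums ! position ≔ʳ zero) (for index < dim² loop body) f))
      where
      g : Frame (prefixSums X Y) s₀ s₂
      g = Frame-trans {C = prefixSums X Y}
        (Frame-ˡ (position ≔ const 0) rest λ y e → unchanged (update-other (regs s₀) 0 e) (λ _ → refl) (λ _ → refl))
        (Frame-ʳ (position ≔ const 0) rest (Frame-ˡ (sums ! position ≔ʳ zero) (for index < dim² loop body) λ y e →
          unchanged refl (λ _ → refl) (λ j → update₂-other (reals s₁) 0 0# j e)))
    step : ∀ j s → j ℕ.< N → Frame (for index < dim² loop body) s₂ s → regs s index ≡ j → I j s →
           Runs body s 5 0 (Leaves (λ s′ → I (suc j) (exec (increment index) s′)))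
    step _ s _ f refl ih = Runs-exec refl λ t t< → extended t (subst (λ k → t ℕ.< suc k) (ℕ.+-comm 1 (regs s index)) t<)
      where
      i = regs s index
      value : reals s X i * reals s Y (regs s offset ℕ.+ i) ≈ term i
      value = ≈-reflexive (cong₂ _*_ (sameReal (whole-frame f X X-free) i)
        (≡.trans (sameReal (whole-frame f Y Y-free) _) (cong (λ o → reals s₀ Y (o ℕ.+ i)) (sameReg (f offset refl)))))
      extended : ∀ t → t ℕ.< suc (i ℕ.+ 1) → reals (exec body s) sums t ≈ Σ< t term
      extended = update₂-fill (λ t r → r ≈ Σ< t term) (reals s) sums (i ℕ.+ 1) _
        (λ t t<i+1 → ih t (subst (t ℕ.<_) (ℕ.+-comm i 1) t<i+1))
        (≈-trans (+-cong (ih i ℕ.≤-refl) (≈-trans (≈-reflexive (update₂-same (reals s) product i _)) value))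
                 (≈-reflexive (cong (λ k → Σ< k term) (ℕ.+-comm 1 i))))

  clear-sound : ∀ {s₀} → Runs clear s₀ (suc (regs s₀ dim² ℕ.* 4 ℕ.+ 1)) 0
    (Leaves (λ s → ∀ t → t ℕ.< regs s₀ dim² → reals s gram t ≡ 0#))
  clear-sound {s₀} =
    subst (λ m → Runs clear s₀ (suc (N ℕ.* 4 ℕ.+ 1)) m (Leaves (I N))) (ℕ.*-zeroʳ N)
      (for-sound {m = 0} N I refl refl refl refl refl refl (λ _ ()) (λ { _ s _ f refl ih →
         Runs-exec refl (update₂-fill (λ t r → r ≡ 0#) (reals s) gram (regs s index) _ ih refl) }))
    where
    N = regs s₀ dim²
    I : ℕ → State → Set c
    I j s = ∀ t → t ℕ.< j → reals s gram t ≡ 0#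

  -- Each matrix is written directly behind its predecessor, so the filled cells always form an
  -- initial segment and one function `g` describes them all.
  accumulate-sound : ∀ {s₀ b N} (g : ℕ → Carrier) → regs s₀ offset ≡ b → regs s₀ dim² ≡ N →
    (∀ k → k ℕ.< b ℕ.+ N → reals s₀ gram k ≈ g k) →
    (∀ t → t ℕ.< N → g (b ℕ.+ t) + reals s₀ (shift (io 2)) t ≈ g (b ℕ.+ N ℕ.+ t)) →
    Runs accumulate s₀ (suc (N ℕ.* 7 ℕ.+ 1)) 0 (Leaves (λ s → ∀ k → k ℕ.< b ℕ.+ N ℕ.+ N → reals s gram k ≈ g k))
  accumulate-sound {s₀} g refl refl below recurrence =
    subst (λ m → Runs accumulate s₀ (suc (N ℕ.* 7 ℕ.+ 1)) m (Leaves (I N))) (ℕ.*-zeroʳ N)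
      (for-sound {m = 0} N I refl refl refl refl refl refl
        (λ k k< → below k (subst (k ℕ.<_) (ℕ.+-identityʳ _) k<)) step)
    where
    b = regs s₀ offset
    N = regs s₀ dim²
    I : ℕ → State → Set ℓ₁
    I j s = ∀ k → k ℕ.< b ℕ.+ N ℕ.+ j → reals s gram k ≈ g k
    body = position ≔ offset ⊞ index ⨾ next ≔ offset ⊞ dim² ⨾ next ≔ next ⊞ index ⨾
           gram ! next ≔ʳ (gram ! position) ⊕ (shift (io 2) ! index)
    step : ∀ j s → j ℕ.< N → Frame accumulate s₀ s → regs s index ≡ j → I j s →
           Runs body s 4 0 (Leaves (λ s′ → I (suc j) (exec (increment index) s′)))
    step _ s i<N f refl ih = Runs-exec refl λ k k< →
      update₂-fill (λ k r → r ≈ g k) (reals s) gram at _ (λ k k< → ih k (subst (k ℕ.<_) at≡ k<))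
        (≈-trans (+-cong (≈-trans (ih _ before) (≈-reflexive (cong (λ o → g (o ℕ.+ i)) offset≡)))
                         (≈-reflexive (sameReal (f (shift (io 2)) refl) i)))
          (≈-trans (recurrence i i<N) (≈-reflexive (cong g (≡.sym at≡))))) k
        (subst (k ℕ.<_) (≡.trans (ℕ.+-suc (b ℕ.+ N) i) (cong suc (≡.sym at≡))) k<)
      where
      i = regs s index
      offset≡ = sameReg (f offset refl)
      at = regs s offset ℕ.+ regs s dim² ℕ.+ i
      at≡ : at ≡ b ℕ.+ N ℕ.+ i
      at≡ = cong (ℕ._+ i) (cong₂ ℕ._+_ offset≡ (sameReg (f dim² refl)))
      -- The cell that is read lies one whole matrix back; `N` is positive because the current index
      -- is below it.
      before : regs s offset ℕ.+ i ℕ.< b ℕ.+ N ℕ.+ i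
      before = subst (λ o → o ℕ.+ i ℕ.< b ℕ.+ N ℕ.+ i) (≡.sym offset≡)
        (ℕ.+-monoˡ-< i (ℕ.m<m+n b (ℕ.≤-trans (ℕ.s≤s ℕ.z≤n) i<N)))

  module Blocks {n d : ℕ} .{{_ : ℕ.NonZero d}} (v : Fin n → Vect d) (α : Vect n) where

    open Extension ℝ v α public

    record Stored (s : State) : Set ℓ₁ where
      field
        count≡        : regs s count ≡ n
        dim≡          : regs s dim ≡ d
        vectors≈      : ∀ r j → r ℕ.< n → j ℕ.< d → reals s vectors (r ℕ.* d ℕ.+ j) ≈ v⁺ r j
        coefficients≈ : ∀ r → r ℕ.< n → reals s coefficients r ≈ α⁺ r
    open Stored

    loaded : State → Name → ℕ → ℕ → Carrier
    loaded s src r k = if does (r ℕ.<? regs s count) then reals s src k else 0#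

    -- Both branches write the same cell, so the test can be moved from the state into the value,
    -- and the states after it need no case distinction.
    exec-loadCell : ∀ dst src x s →
      exec (loadCell dst src x) s ≡ setReal dst (regs s index) (loaded s src (regs s current) (regs s x)) s
    exec-loadCell dst src x s with regs s current ℕ.<? regs s count
    ... | yes b rewrite dec-true (regs s current ℕ.<? regs s count) b = refl
    ... | no b  rewrite dec-false (regs s current ℕ.<? regs s count) b = refl

    loaded-< : ∀ s src r k → r ℕ.< regs s count → loaded s src r k ≡ reals s src k
    loaded-< s src r k r<n rewrite dec-true (r ℕ.<? regs s count) r<n = refl

    loaded-≮ : ∀ s src r k → ¬ r ℕ.< regs s count → loaded s src r k ≡ 0#
    loaded-≮ s src r k r≮n rewrite dec-false (r ℕ.<? regs s count) r≮n = refl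

    loaded-vectors : ∀ {s} → Stored s → ∀ r j → j ℕ.< d → loaded s vectors r (r ℕ.* d ℕ.+ j) ≈ v⁺ r j
    loaded-vectors {s} st r j j<d with r ℕ.<? regs s count
    ... | yes r<n = ≈-trans (≈-reflexive (loaded-< s vectors r _ r<n))
        (vectors≈ st r j (subst (r ℕ.<_) (count≡ st) r<n) j<d)
    ... | no r≮n  = ≈-trans (≈-reflexive (loaded-≮ s vectors r _ r≮n))
                            (≈-reflexive (≡.sym (extend-≥ _ (r≮n ∘ subst (r ℕ.<_) (≡.sym (count≡ st))))))

    loaded-coefficients : ∀ {s} → Stored s → ∀ r → loaded s coefficients r r ≈ α⁺ r
    loaded-coefficients {s} st r with r ℕ.<? regs s count
    ... | yes r<n = ≈-trans (≈-reflexive (loaded-< s coefficients r _ r<n))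
        (coefficients≈ st r (subst (r ℕ.<_) (count≡ st) r<n))
    ... | no r≮n  = ≈-trans (≈-reflexive (loaded-≮ s coefficients r _ r≮n))
                            (≈-reflexive (≡.sym (extend-≥ _ (r≮n ∘ subst (r ℕ.<_) (≡.sym (count≡ st))))))

    Stored-frame : ∀ C {s s′} → Untouched C (count ∷ dim ∷ vectors ∷ coefficients ∷ []) →
                   Frame C s s′ → Stored s → Stored s′
    Stored-frame C (e₁ ∷ e₂ ∷ e₃ ∷ e₄ ∷ []) f st = record
      { count≡        = ≡.trans (sameReg (f count e₁)) (count≡ st)
      ; dim≡          = ≡.trans (sameReg (f dim e₂)) (dim≡ st)
      ; vectors≈      = λ r j r<n j<d → ≈-trans (≈-reflexive (sameReal (f vectors e₃) _)) (vectors≈ st r j r<n j<d)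
      ; coefficients≈ = λ r r<n → ≈-trans (≈-reflexive (sameReal (f coefficients e₄) _)) (coefficients≈ st r r<n)
      }

    At : ℕ → State → Set
    At t s = (regs s row ℕ.* d ℕ.+ regs s column ≡ t) × (regs s column ℕ.< d)

    carry-sound : ∀ {s t} → regs s dim ≡ d → At t s →
                  Runs carry s (size carry) 0 (Leaves (λ s′ → At (suc t) s′ × reals s′ ≡ reals s ×
                      regs s′ index ≡ regs s index))
    carry-sound {s} {t} refl (refl , q<d) with regs s column ℕ.+ 1 ℕ.<? regs s dim
    ... | yes q+1<d = Runs-exec refl post
      where
      Post : State → Set c
      Post s′ = At (suc t) s′ × reals s′ ≡ reals s × regs s′ index ≡ regs s index
      post : Post (exec carry s)
      post rewrite dec-true (regs s column ℕ.+ 1 ℕ.<? regs s dim) q+1<d =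
        (≡.trans (cong (regs s row ℕ.* d ℕ.+_) (ℕ.+-comm (regs s column) 1))
            (ℕ.+-suc (regs s row ℕ.* d) (regs s column)) ,
         q+1<d) , refl , refl
    ... | no q+1≮d = Runs-exec refl post
      where
      Post : State → Set c
      Post s′ = At (suc t) s′ × reals s′ ≡ reals s × regs s′ index ≡ regs s index
      q+1≡d : suc (regs s column) ≡ regs s dim
      q+1≡d = ℕ.≤-antisym q<d (subst (regs s dim ℕ.≤_) (ℕ.+-comm (regs s column) 1) (ℕ.≮⇒≥ q+1≮d))
      next-row : (regs s row ℕ.+ 1) ℕ.* regs s dim ℕ.+ 0 ≡ suc (regs s row ℕ.* regs s dim ℕ.+ regs s column)
      next-row = ≡.trans (ℕ.+-identityʳ _) (≡.trans (cong (ℕ._* regs s dim) (ℕ.+-comm (regs s row) 1))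
        (≡.trans (ℕ.+-comm (regs s dim) _) (≡.trans (cong (regs s row ℕ.* regs s dim ℕ.+_) (≡.sym q+1≡d))
          (ℕ.+-suc (regs s row ℕ.* regs s dim) (regs s column)))))
      post : Post (exec carry s)
      post rewrite dec-false (regs s column ℕ.+ 1 ℕ.<? regs s dim) q+1≮d =
        (next-row , ℕ.≤-trans (ℕ.s≤s ℕ.z≤n) q<d) , refl , refl

    record Block (b : ℕ) (s : State) : Set ℓ₁ where
      field
        rows≈    : ∀ i j → i ℕ.< d → j ℕ.< d → reals s rows (i ℕ.* d ℕ.+ j) ≈ v⁺ (b ℕ.* d ℕ.+ i) j
        columns≈ : ∀ i j → i ℕ.< d → j ℕ.< d → reals s columns (i ℕ.* d ℕ.+ j) ≈ v⁺ (b ℕ.* d ℕ.+ j) i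
        scaled≈  : ∀ i j → i ℕ.< d → j ℕ.< d →
                   reals s scaled (i ℕ.* d ℕ.+ j) ≈ α⁺ (b ℕ.* d ℕ.+ i) * v⁺ (b ℕ.* d ℕ.+ i) j

    load-block-sound : ∀ {s₀} → Stored s₀ → regs s₀ dim² ≡ d ℕ.* d →
      Runs load-block s₀ (4 ℕ.+ (d ℕ.* d ℕ.* suc (size loadEntry ℕ.+ 2) ℕ.+ 1)) 0 (Leaves (Block (regs s₀ block)))
    load-block-sound {s₀} st dim²≡ =
      Runs-exec {P = _≡ s₁} refl refl then (Leaves-closed , λ { refl →
      Runs-exec {P = _≡ s₂} refl refl then (Leaves-closed , λ { refl →
      Runs-exec {P = _≡ s₃} refl refl then (Leaves-closed , λ { refl →
        Runs-map (Leaves-map filled) (subst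
            (λ m → Runs (for index < dim² loop loadEntry) s₃
                (suc (N ℕ.* suc (size loadEntry ℕ.+ 2) ℕ.+ 1)) m (Leaves (I N)))
          (ℕ.*-zeroʳ N)
          (for-sound {m = 0} N I dim²≡ refl refl refl refl refl
            ((refl , ℕ.>-nonZero⁻¹ d) , (λ _ ()) , (λ _ ()) , (λ _ ())) step)) }) }) })
      where
      N = d ℕ.* d
      b = regs s₀ block
      s₁ = exec (base ≔ block ⊠ dim) s₀
      s₂ = exec (row ≔ const 0) s₁
      s₃ = exec (column ≔ const 0) s₂
      R C S : ℕ → Carrier → Set ℓ₁
      -- Cell `t` stands for the entry (t / d, t % d); `C` exchanges the two coordinates.
      R t x = x ≈ v⁺ (b ℕ.* d ℕ.+ t / d) (t % d)
      C t x = x ≈ v⁺ (b ℕ.* d ℕ.+ t % d) (t / d)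
      S t x = x ≈ α⁺ (b ℕ.* d ℕ.+ t / d) * v⁺ (b ℕ.* d ℕ.+ t / d) (t % d)
      I : ℕ → State → Set ℓ₁
      I j s = At j s × (∀ t → t ℕ.< j → R t (reals s rows t)) × (∀ t → t ℕ.< j → C t (reals s columns t)) ×
              (∀ t → t ℕ.< j → S t (reals s scaled t))

      filled : ∀ {s} → I N s → Block b s
      filled {s} (_ , R′ , C′ , S′) = record
        { rows≈    = λ i j i<d j<d → unflatten (λ p q → reals s rows (i ℕ.* d ℕ.+ j) ≈ v⁺ (b ℕ.* d ℕ.+ p) q) i j<d
            (R′ _ (i*d+j<m*d i<d j<d))
        ; columns≈ = λ i j i<d j<d → unflatten (λ p q → reals s columns (i ℕ.* d ℕ.+ j) ≈ v⁺ (b ℕ.* d ℕ.+ q) p) i j<d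
            (C′ _ (i*d+j<m*d i<d j<d))
        ; scaled≈  = λ i j i<d j<d → unflatten (λ p q → reals s scaled (i ℕ.* d ℕ.+ j) ≈ α⁺ (b ℕ.* d ℕ.+ p) *
            v⁺ (b ℕ.* d ℕ.+ p) q) i j<d (S′ _ (i*d+j<m*d i<d j<d))
        }
        where
        unflatten : ∀ {ℓ} (P : ℕ → ℕ → Set ℓ) i {j} → j ℕ.< d → P ((i ℕ.* d ℕ.+ j) / d) ((i ℕ.* d ℕ.+ j) % d) → P i j
        unflatten P i j<d = ≡.subst₂ P ([i*d+j]/d≡i i j<d) ([i*d+j]%d≡j i j<d)

      step : ∀ j s → j ℕ.< N → Frame (for index < dim² loop loadEntry) s₃ s → regs s index ≡ j → I j s →
             Runs loadEntry s (size loadEntry) 0 (Leaves (λ s′ → I (suc j) (exec (increment index) s′)))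
      step j s j<N f refl ((t≡ , q<d) , R′ , C′ , S′) =
        Runs-exec {P = _≡ u₁} refl (exec-loadCell rows vectors position (exec (locate row column) s))
            then (Leaves-closed , λ { refl →
        Runs-exec {P = _≡ u₂} refl (exec-loadCell coefficient coefficients current u₁) then (Leaves-closed , λ { refl →
        Runs-exec {P = _≡ u₃} refl refl then (Leaves-closed , λ { refl →
        Runs-exec {P = _≡ u₄} refl (exec-loadCell columns vectors position (exec (locate column row) u₃))
            then (Leaves-closed , λ { refl →
        Runs-map (Leaves-map λ {s′} (at , reals≡ , _) → at ,
            (λ t t< → subst (λ r → R t (r rows t)) (≡.sym reals≡) (update₂-fill R (reals s) rows i x R′ x≈ t t<)) ,
            (λ t t< → subst (λ r → C t (r columns t)) (≡.sym reals≡) (update₂-fill C (reals s) columns i y C′ y≈ t t<)) ,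
            (λ t t< → subst (λ r → S t (r scaled t)) (≡.sym reals≡) (update₂-fill S (reals s) scaled i _ S′ z≈ t t<)))
          (carry-sound {u₄} dim-s (t≡ , q<d)) }) }) }) })
        where
        i = regs s index
        p = regs s row
        q = regs s column
        dim-s : regs s dim ≡ d
        dim-s = ≡.trans (sameReg (f dim refl)) (dim≡ st)
        base-s : regs s base ≡ b ℕ.* d
        base-s = ≡.trans (sameReg (f base refl)) (cong (b ℕ.*_) (dim≡ st))
        st′ : Stored s
        st′ = Stored-frame (for index < dim² loop loadEntry) (untouched (for index < dim² loop loadEntry) refl) f
          (Stored-frame (base ≔ block ⊠ dim ⨾ row ≔ const 0 ⨾ column ≔ const 0) {s₀} {s₃}
              (untouched (base ≔ block ⊠ dim ⨾ row ≔ const 0 ⨾ column ≔ const 0) refl)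
            (exec-frame (base ≔ block ⊠ dim ⨾ row ≔ const 0 ⨾ column ≔ const 0) s₀ refl) st)
        i/d≡p : i / d ≡ p
        i/d≡p = ≡.trans (cong (_/ d) (≡.sym t≡)) ([i*d+j]/d≡i p q<d)
        i%d≡q : i % d ≡ q
        i%d≡q = ≡.trans (cong (_% d) (≡.sym t≡)) ([i*d+j]%d≡j p q<d)
        -- The transposed entry reads component `p` of a vector, so the row needs a bound as well;
        -- it comes from the bound on the flat index.
        p<d : p ℕ.< d
        p<d = ℕ.*-cancelʳ-< d p d (ℕ.≤-<-trans (ℕ.≤-trans (ℕ.m≤m+n _ q) (ℕ.≤-reflexive t≡)) j<N)

        x = loaded s vectors (regs s base ℕ.+ p) ((regs s base ℕ.+ p) ℕ.* regs s dim ℕ.+ q)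
        a = loaded s coefficients (regs s base ℕ.+ p) (regs s base ℕ.+ p)
        y = loaded s vectors (regs s base ℕ.+ q) ((regs s base ℕ.+ q) ℕ.* regs s dim ℕ.+ p)
        u₁ = setReal rows i x (exec (locate row column) s)
        u₂ = setReal coefficient i a u₁
        u₃ = exec (scaled ! index ≔ʳ (coefficient ! index) ⊗ (rows ! index)) u₂
        u₄ = setReal columns i y (exec (locate column row) u₃)

        entry : ∀ {k l} → l ℕ.< d → loaded s vectors (regs s base ℕ.+ k) ((regs s base ℕ.+ k) ℕ.* regs s dim ℕ.+ l) ≈ v⁺
            (b ℕ.* d ℕ.+ k) l
        entry {k} {l} l<d = ≡.subst₂ (λ e o → loaded s vectors (o ℕ.+ k) ((o ℕ.+ k) ℕ.* e ℕ.+ l) ≈ v⁺ (b ℕ.* d ℕ.+ k) l)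
          (≡.sym dim-s) (≡.sym base-s) (loaded-vectors st′ (b ℕ.* d ℕ.+ k) l l<d)

        x≈ : R i x
        x≈ = ≡.subst₂ (λ k l → x ≈ v⁺ (b ℕ.* d ℕ.+ k) l) (≡.sym i/d≡p) (≡.sym i%d≡q) (entry q<d)
        y≈ : C i y
        y≈ = ≡.subst₂ (λ k l → y ≈ v⁺ (b ℕ.* d ℕ.+ l) k) (≡.sym i/d≡p) (≡.sym i%d≡q) (entry p<d)
        a≈ : a ≈ α⁺ (b ℕ.* d ℕ.+ i / d)
        a≈ = ≈-trans (loaded-coefficients st′ (regs s base ℕ.+ p))
            (≈-reflexive (cong α⁺ (cong₂ ℕ._+_ base-s (≡.sym i/d≡p))))
        z≈ : S i (evalʳ ((coefficient ! index) ⊗ (rows ! index)) u₂)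
        z≈ = *-cong (≈-trans (≈-reflexive (update₂-same (reals u₁) coefficient i a)) a≈)
                    (≈-trans (≈-reflexive (update₂-same (reals s) rows i x)) x≈)

-- Gram matrices

module Gram {c ℓ₁ ℓ₂ : Level} (ℝ : RealNumbers c ℓ₁ ℓ₂) (d : ℕ) .{{_ : ℕ.NonZero d}}
  (v : ℕ → ℕ → RealNumbers.Carrier ℝ) (α : ℕ → RealNumbers.Carrier ℝ) where

  open RealNumbers ℝ hiding (zero)
    renaming (refl to ≈-refl; sym to ≈-sym; trans to ≈-trans; reflexive to ≈-reflexive)
  open RealProperties ℝ

  instance
    d*d≢0 : ℕ.NonZero (d ℕ.* d)
    d*d≢0 = ℕ.m*n≢0 d d

  -- Bracketed as the product of `columns` and `scaled` delivers it, namely Vᵀ (diag(α) V) for the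
  -- block with rows V.
  blockGram : ℕ → ℕ → ℕ → Carrier
  blockGram b i j = Σ< d (λ k → v (b ℕ.* d ℕ.+ k) i * (α (b ℕ.* d ℕ.+ k) * v (b ℕ.* d ℕ.+ k) j))

  prefixGram : ℕ → ℕ → Carrier
  prefixGram x t = Σ< x (λ b → blockGram b (t / d) (t % d))

  -- The intended content of the whole array `gram`: prefix sum number x starts at position x * (d *
  -- d).
  flatGram : ℕ → Carrier
  flatGram k = prefixGram (k / (d ℕ.* d)) (k % (d ℕ.* d))

  flatGram-≈ : ∀ x {t} → t ℕ.< d ℕ.* d → flatGram (x ℕ.* (d ℕ.* d) ℕ.+ t) ≡ prefixGram x t
  flatGram-≈ x t<dd = cong₂ prefixGram ([i*d+j]/d≡i x t<dd) ([i*d+j]%d≡j x t<dd)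

module Weights {c ℓ₁ ℓ₂ : Level} (ℝ : RealNumbers c ℓ₁ ℓ₂) (d : ℕ) .{{_ : ℕ.NonZero d}}
  (v : ℕ → ℕ → RealNumbers.Carrier ℝ) (α a : ℕ → RealNumbers.Carrier ℝ) where

  open RealNumbers ℝ hiding (zero)
    renaming (refl to ≈-refl; sym to ≈-sym; trans to ≈-trans; reflexive to ≈-reflexive)
  open RealProperties ℝ
  open Gram ℝ d v α
  open SemiringSolver commutativeSemiring
  open SetoidReasoning setoid

  weight⁺ : ℕ → Carrier
  weight⁺ r = α r * Σ< d (λ i → Σ< d (λ j → v r i * a (i ℕ.* d ℕ.+ j) * v r j))

  blockWeight : ℕ → Carrier
  blockWeight b = Σ< d (λ k → weight⁺ (b ℕ.* d ℕ.+ k))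

  Σ<-flatten-/% : ∀ m (f : ℕ → ℕ → ℕ → Carrier) →
    Σ< (m ℕ.* d) (λ t → f t (t / d) (t % d)) ≈ Σ< m (λ i → Σ< d (λ j → f (i ℕ.* d ℕ.+ j) i j))
  Σ<-flatten-/% m f = ≈-trans (Σ<-flatten m d _) (Σ<-cong m λ i _ → Σ<-cong d λ j j<d →
    ≈-reflexive (cong₂ (f (i ℕ.* d ℕ.+ j)) ([i*d+j]/d≡i i j<d) ([i*d+j]%d≡j i j<d)))

  *-distribˡ-ΣΣ : ∀ x (f : ℕ → ℕ → Carrier) → x * Σ< d (λ i → Σ< d (f i)) ≈ Σ< d (λ i → Σ< d (λ j → x * f i j))
  *-distribˡ-ΣΣ x f = ≈-trans (*-distribˡ-Σ< d x _) (Σ<-cong d λ i _ → *-distribˡ-Σ< d x (f i))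

  -- ⟨A, Σ α v vᵀ⟩ = Σ α vᵀ A v, by exchanging the sum over the entries with the sum over the
  -- vectors.
  blockWeight-gram : ∀ b → Σ< (d ℕ.* d) (λ t → a t * blockGram b (t / d) (t % d)) ≈ blockWeight b
  blockWeight-gram b = begin
    Σ< (d ℕ.* d) (λ t → a t * blockGram b (t / d) (t % d))
      ≈⟨ Σ<-flatten-/% d (λ t i j → a t * blockGram b i j) ⟩
    Σ< d (λ i → Σ< d (λ j → a (i ℕ.* d ℕ.+ j) * blockGram b i j))
      ≈⟨ Σ<-cong d (λ i _ → ≈-trans (Σ<-cong d λ j _ → *-distribˡ-Σ< d _ _) (Σ<-swap d d _)) ⟩
    Σ< d (λ i → Σ< d (λ k → Σ< d (λ j → a (i ℕ.* d ℕ.+ j) * (v (r k) i * (α (r k) * v (r k) j)))))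
      ≈⟨ Σ<-swap d d _ ⟩
    Σ< d (λ k → Σ< d (λ i → Σ< d (λ j → a (i ℕ.* d ℕ.+ j) * (v (r k) i * (α (r k) * v (r k) j)))))
      ≈⟨ Σ<-cong d (λ k _ → Σ<-cong d λ i _ → Σ<-cong d λ j _ →
           solve 4 (λ a x y z → a :* (x :* (y :* z)) := y :* (x :* a :* z)) ≈-refl _ _ _ _) ⟩
    Σ< d (λ k → Σ< d (λ i → Σ< d (λ j → α (r k) * (v (r k) i * a (i ℕ.* d ℕ.+ j) * v (r k) j))))
      ≈⟨ Σ<-cong d (λ k _ → *-distribˡ-ΣΣ (α (r k)) _) ⟨
    blockWeight b ∎
    where
    r : ℕ → ℕ
    r k = b ℕ.* d ℕ.+ k

  prefixGram-weight : ∀ x → Σ< (d ℕ.* d) (λ t → a t * prefixGram x t) ≈ Σ< x blockWeight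
  prefixGram-weight ℕ.zero  = ≈-trans (Σ<-cong (d ℕ.* d) λ t _ → zeroʳ (a t)) (Σ<-zero (d ℕ.* d))
  prefixGram-weight (suc x) = begin
    Σ< (d ℕ.* d) (λ t → a t * (prefixGram x t + blockGram x (t / d) (t % d)))
      ≈⟨ Σ<-cong (d ℕ.* d) (λ t _ → distribˡ (a t) _ _) ⟩
    Σ< (d ℕ.* d) (λ t → a t * prefixGram x t + a t * blockGram x (t / d) (t % d))
      ≈⟨ Σ<-+ (d ℕ.* d) _ _ ⟩
    Σ< (d ℕ.* d) (λ t → a t * prefixGram x t) + Σ< (d ℕ.* d) (λ t → a t * blockGram x (t / d) (t % d))
      ≈⟨ +-cong (prefixGram-weight x) (blockWeight-gram x) ⟩
    Σ< x blockWeight + blockWeight x ∎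

  weight⁺-product : ∀ r → Σ< d (λ j → Σ< d (λ i → v r i * a (i ℕ.* d ℕ.+ j)) * (α r * v r j)) ≈ weight⁺ r
  weight⁺-product r = begin
    Σ< d (λ j → Σ< d (λ i → v r i * a (i ℕ.* d ℕ.+ j)) * (α r * v r j))
      ≈⟨ Σ<-cong d (λ j _ → *-distribʳ-Σ< d _ _) ⟩
    Σ< d (λ j → Σ< d (λ i → v r i * a (i ℕ.* d ℕ.+ j) * (α r * v r j)))
      ≈⟨ Σ<-swap d d _ ⟩
    Σ< d (λ i → Σ< d (λ j → v r i * a (i ℕ.* d ℕ.+ j) * (α r * v r j)))
      ≈⟨ Σ<-cong d (λ i _ → Σ<-cong d λ j _ →
           solve 4 (λ a x y z → x :* a :* (y :* z) := y :* (x :* a :* z)) ≈-refl _ _ _ _) ⟩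
    Σ< d (λ i → Σ< d (λ j → α r * (v r i * a (i ℕ.* d ℕ.+ j) * v r j)))
      ≈⟨ *-distribˡ-ΣΣ (α r) _ ⟨
    weight⁺ r ∎

  -- Row i of V A times row i of `scaled` is the weight of vector i, so the running sum over the
  -- flat arrays passes through the prefix weights at the ends of the rows.
  prefix-product : ∀ {b : ℕ} {R S : ℕ → Carrier} →
    (∀ i j → i ℕ.< d → j ℕ.< d → R (i ℕ.* d ℕ.+ j) ≈ Σ< d (λ k → v (b ℕ.* d ℕ.+ i) k * a (k ℕ.* d ℕ.+ j))) →
    (∀ i j → i ℕ.< d → j ℕ.< d → S (i ℕ.* d ℕ.+ j) ≈ α (b ℕ.* d ℕ.+ i) * v (b ℕ.* d ℕ.+ i) j) →
    ∀ x → x ℕ.≤ d → Σ< (x ℕ.* d) (λ t → R t * S t) ≈ Σ< x (λ i → weight⁺ (b ℕ.* d ℕ.+ i))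
  prefix-product {b} R≈ S≈ x x≤d = ≈-trans (Σ<-flatten x d _) (Σ<-cong x λ i i<x →
    let i<d = ℕ.<-≤-trans i<x x≤d in
    ≈-trans (Σ<-cong d λ j j<d → *-cong (R≈ i j i<d j<d) (S≈ i j i<d j<d)) (weight⁺-product (b ℕ.* d ℕ.+ i)))

-- Queries

left right outcomes : Name
left     = shift (io 0)
right    = shift (io 1)
outcomes = shift (io 2)

evaluateGram : Program
evaluateGram = offset ≔ arg ⊠ dim² ⨾ prefixSums (io 0) gram ⨾ result ! dim ≔ʳ copy (sums ! dim²)

evaluateBlock : Program
evaluateBlock = position ≔ arg ⊠ dim ⨾ result ! dim ≔ʳ copy (sums ! position)

prepareBlock : Program → Program
prepareBlock multiply =
  load-block ⨾ copyArray left rows dim² ⨾ copyArray right (io 0) dim² ⨾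
  -- Here `left` is the register that passes the dimension; the array of the same name already holds
  -- the first factor.
  left ≔ reg dim ⨾ shiftᴾ multiply ⨾ offset ≔ const 0 ⨾ prefixSums outcomes scaled

sampleBlock : Program
sampleBlock = (lo ≔ const 0 ⨾ len ≔ reg dim) ⨾ search evaluateBlock ⨾ offset ≔ block ⊠ dim ⨾ io 0 ≔ offset ⊞ lo

query : Program → Program
query multiply =
  (dim² ≔ dim ⊠ dim ⨾ lo ≔ const 0 ⨾ len ≔ reg blocks ⨾ least ≔ const 1) ⨾
  search evaluateGram ⨾ block ≔ reg lo ⨾ prepareBlock multiply ⨾ sampleBlock

prepareTime : ℕ → ℕ
prepareTime N = (4 ℕ.+ (N ℕ.* suc (size loadEntry ℕ.+ 2) ℕ.+ 1)) ℕ.+ (suc (N ℕ.* 4 ℕ.+ 1) ℕ.+ (suc (N ℕ.* 4 ℕ.+ 1) ℕ.+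
                (1 ℕ.+ (0 ℕ.+ (1 ℕ.+ (3 ℕ.+ (N ℕ.* 8 ℕ.+ 1)))))))

-- `ℓ` is ⌊log₂ (n / d)⌋; each of the `suc ℓ` rounds computes three inner products. A round with
-- `evaluateBlock`, which takes 2 steps, costs 27 = 3 * 2 + 21.
queryTime : ℕ → ℕ → ℕ
queryTime d ℓ =
  4 ℕ.+ (suc ℓ ℕ.* (3 ℕ.* (d ℕ.* d ℕ.* 8 ℕ.+ 6) ℕ.+ 21) ℕ.+ 1 ℕ.+
    (1 ℕ.+ (prepareTime (d ℕ.* d) ℕ.+ (2 ℕ.+ (d ℕ.* 27 ℕ.+ 1 ℕ.+ 2)))))

-- Strictness makes the same exponent cover the `suc (n / d)` blocks.
n<2^[1+⌊log₂n⌋] : ∀ n → n ℕ.< 2 ℕ.^ suc ⌊log₂ n ⌋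
n<2^[1+⌊log₂n⌋] n with n ℕ.<? 2 ℕ.^ suc ⌊log₂ n ⌋
... | yes n< = n<
... | no n≮  = contradiction
  (ℕ.≤-trans (ℕ.≤-reflexive (≡.sym (⌊log₂[2^n]⌋≡n (suc ⌊log₂ n ⌋)))) (⌊log₂⌋-mono-≤ (ℕ.≮⇒≥ n≮))) ℕ.1+n≰n

-- The crude depth of the search inside a block.
n≤2^n : ∀ n → n ℕ.≤ 2 ℕ.^ n
n≤2^n ℕ.zero  = ℕ.z≤n
n≤2^n (suc n) = ℕ.+-mono-≤ {1} (ℕ.m^n>0 2 n) (ℕ.≤-trans (n≤2^n n) (ℕ.≤-reflexive (≡.sym (ℕ.+-identityʳ _))))

readyNames : List Name
readyNames = count ∷ dim ∷ blocks ∷ vectors ∷ coefficients ∷ gram ∷ io 0 ∷ dim² ∷ least ∷ []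

module Algorithm {c ℓ₁ ℓ₂ : Level} (ℝ : RealNumbers c ℓ₁ ℓ₂)
  (M : RealNumbers.Carrier ℝ) (0≤M : RealNumbers._≤_ ℝ (RealNumbers.0# ℝ) M)
  {n d : ℕ} .{{_ : ℕ.NonZero d}} (v : Fin n → Fin d → RealNumbers.Carrier ℝ) (α : Fin n → RealNumbers.Carrier ℝ)
  (multiply : Program) where

  open RealNumbers ℝ hiding (zero)
    renaming (refl to ≈-refl; sym to ≈-sym; trans to ≈-trans; reflexive to ≈-reflexive)
  open RealProperties ℝ
  open RealRAM ℝ
  open Semantics ℝ
  open Logic M 0≤M
  open Expectation ℝ
  open Search ℝ M 0≤M
  open Loops ℝ M 0≤M
  open Blocks v α
  open Gram ℝ d v⁺ α⁺
  open State
  open Stored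
  open Block

  N m : ℕ
  N = d ℕ.* d
  m = suc (n / d)

  -- For n < d there is only one block, and no room for a d × d matrix.
  record Rep (s : State) : Set ℓ₁ where
    field
      stored  : Stored s
      blocks≡ : regs s blocks ≡ m
      gram≈   : d ℕ.≤ n → ∀ k → k ℕ.< suc m ℕ.* N → reals s gram k ≈ flatGram k
  open Rep

  call-free-var : ∀ k {_ : T (k ℕ.<ᵇ 100)} → touches (shiftᴾ multiply) (var k) ≡ false
  call-free-var k {k<100} = touches-shiftᴾ multiply (Unshifted-var (ℕ.<ᵇ⇒< k 100 k<100))

  call-free-io : ∀ k {_ : T (k ℕ.<ᵇ 100)} → touches (shiftᴾ multiply) (io k) ≡ false
  call-free-io k {k<100} = touches-shiftᴾ multiply (Unshifted-io (ℕ.<ᵇ⇒< k 100 k<100))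

  copied : ∀ dst src s → regs s dim² ≡ N → does (dim² ≟ᴺ dst) ≡ false → does (index ≟ᴺ dst) ≡ false →
         touches (copyArray dst src dim²) src ≡ false →
         Runs (copyArray dst src dim²) s (suc (N ℕ.* 4 ℕ.+ 1)) 0
             (Leaves (λ s′ → ∀ t → t ℕ.< N → reals s′ dst t ≡ reals s src t))
  copied dst src s eq p q e = subst (λ k → Runs (copyArray dst src dim²) s (suc (k ℕ.* 4 ℕ.+ 1)) 0
      (Leaves (λ s′ → ∀ t → t ℕ.< k → reals s′ dst t ≡ reals s src t))) eq
    (copyArray-sound {dst} {src} {dim²} {s} refl refl p q e)

  -- The query matrix enters as the raw content `a` of its array; `Correctness` relates it to the
  -- matrix `A`.
  module Query (a : ℕ → Carrier) where

    open Weights ℝ d v⁺ α⁺ a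

    record Ready (s : State) : Set (c ⊔ ℓ₁) where
      field
        rep     : Rep s
        matrix≡ : ∀ t → reals s (io 0) t ≡ a t
        dim²≡   : regs s dim² ≡ N
        least≡  : regs s least ≡ 1
    open Ready

    Rep-frame : ∀ C {s s′} → Untouched C (count ∷ dim ∷ blocks ∷ vectors ∷ coefficients ∷ gram ∷ []) →
                Frame C s s′ → Rep s → Rep s′
    Rep-frame C (e₁ ∷ e₂ ∷ e₃ ∷ e₄ ∷ e₅ ∷ e₆ ∷ []) f r = record
      { stored  = Stored-frame C (e₁ ∷ e₂ ∷ e₄ ∷ e₅ ∷ []) f (stored r)
      ; blocks≡ = ≡.trans (sameReg (f blocks e₃)) (blocks≡ r)
      ; gram≈   = λ d≤n k k< → ≈-trans (≈-reflexive (sameReal (f gram e₆) k)) (gram≈ r d≤n k k<)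
      }

    Ready-frame : ∀ C {s s′} → Untouched C readyNames → Frame C s s′ → Ready s → Ready s′
    Ready-frame C (e₁ ∷ e₂ ∷ e₃ ∷ e₄ ∷ e₅ ∷ e₆ ∷ e₇ ∷ e₈ ∷ e₉ ∷ []) f r = record
      { rep     = Rep-frame C (e₁ ∷ e₂ ∷ e₃ ∷ e₄ ∷ e₅ ∷ e₆ ∷ []) f (rep r)
      ; matrix≡ = λ t → ≡.trans (sameReal (f (io 0) e₇) t) (matrix≡ r t)
      ; dim²≡   = ≡.trans (sameReg (f dim² e₈)) (dim²≡ r)
      ; least≡  = ≡.trans (sameReg (f least e₉)) (least≡ r)
      }

    dim≡d : ∀ {s} → Ready s → regs s dim ≡ d
    dim≡d r = dim≡ (stored (rep r))

    evaluateGram-sound : ∀ s → Ready s → d ℕ.≤ n → regs s arg ℕ.≤ m →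
      Runs evaluateGram s (N ℕ.* 8 ℕ.+ 6) 0 (Leaves (λ s′ → scalar result s′ ≈ Σ< (regs s arg) blockWeight))
    evaluateGram-sound s r d≤n x≤m =
      subst (λ u → Runs evaluateGram s u 0 (Leaves (λ s′ → scalar result s′ ≈ Σ< x blockWeight))) cost≡
        (Runs-exec {P = _≡ s₁} refl refl then (Leaves-closed , λ { refl →
          Runs-Leaves-frame (prefixSums-sound {io 0} {gram} {s₁} refl refl) then (Leaves-closed , λ {s₂} (p , f) →
            Runs-exec refl (≈-trans (≈-reflexive (≡.trans (update₂-same (reals s₂) result (regs s₂ dim) _)
                                                          (cong (reals s₂ sums) (sameReg (f dim² refl)))))
              (≈-trans (p (regs s dim²) ℕ.≤-refl) value))) }))
      where
      x = regs s arg
      s₁ = exec (offset ≔ arg ⊠ dim²) s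
      cost≡ : 1 ℕ.+ (3 ℕ.+ (regs s dim² ℕ.* 8 ℕ.+ 1) ℕ.+ 1) ≡ N ℕ.* 8 ℕ.+ 6
      cost≡ = ≡.trans (cong (λ k → 1 ℕ.+ (3 ℕ.+ (k ℕ.* 8 ℕ.+ 1) ℕ.+ 1)) (dim²≡ r))
        (solve 1 (λ k → con 1 :+ (con 3 :+ (k :* con 8 :+ con 1) :+ con 1) := k :* con 8 :+ con 6) refl N)
        where open +-*-Solver
      value : Σ< (regs s dim²) (λ k → reals s (io 0) k * reals s gram (x ℕ.* regs s dim² ℕ.+ k)) ≈ Σ< x blockWeight
      value rewrite dim²≡ r = ≈-trans (Σ<-cong N λ t t<N → *-cong (≈-reflexive (matrix≡ r t))
        (≈-trans (gram≈ (rep r) d≤n _ (i*d+j<m*d (ℕ.s≤s x≤m) t<N)) (≈-reflexive (flatGram-≈ x t<N))))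
            (prefixGram-weight x)

    evaluateBlock-sound : ∀ b s → Ready s →
        (∀ x → x ℕ.≤ d → reals s sums (x ℕ.* d) ≈ Σ< x (λ i → weight⁺ (b ℕ.* d ℕ.+ i))) →
      regs s arg ℕ.≤ d →
      Runs evaluateBlock s 2 0 (Leaves (λ s′ → scalar result s′ ≈ Σ< (regs s arg) (λ i → weight⁺ (b ℕ.* d ℕ.+ i))))
    evaluateBlock-sound b s r p x≤d = Runs-exec refl
      (≈-trans (≈-reflexive (≡.trans (update₂-same (reals s) result (regs s dim) _)
                                     (cong (λ e → reals s sums (regs s arg ℕ.* e)) (dim≡d r)))) (p _ x≤d))

    record Prepared (b : ℕ) (s : State) : Set (c ⊔ ℓ₁) where
      field
        ready  : Ready s
        block≡ : regs s block ≡ b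
        sums≈  : ∀ x → x ℕ.≤ d → reals s sums (x ℕ.* d) ≈ Σ< x (λ i → weight⁺ (b ℕ.* d ℕ.+ i))
    open Prepared

    module _ (correct : ∀ (A B : Matrix d d) s → regs s (io 0) ≡ d → HoldsMatrix (io 0) A s → HoldsMatrix (io 1) B s →
       multiply from s inTime M ensures Leaves (HoldsMatrix (io 2) (mul A B))) where

      open Multiplication M 0≤M multiply correct

      prepareBlock-sound : ∀ {b s} → Ready s → regs s block ≡ b →
        Runs (prepareBlock multiply) s (prepareTime N) 1 (Leaves (Prepared b))
      prepareBlock-sound {b} {s} r refl =
        Runs-Leaves-frame (load-block-sound (stored (rep r)) (dim²≡ r)) then (Leaves-closed , λ {s₂} (blk , f₂) →
        let r₂ = Ready-frame load-block (untouched load-block refl) f₂ r in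
        Runs-Leaves-frame (copied left rows s₂ (dim²≡ r₂) refl refl refl) then (Leaves-closed , λ {s₃} (left≡ , f₃) →
        let r₃ = Ready-frame (copyArray left rows dim²) (untouched (copyArray left rows dim²) refl) f₃ r₂ in
        Runs-Leaves-frame (copied right (io 0) s₃ (dim²≡ r₃) refl refl refl) then (Leaves-closed , λ {s₄} (right≡ , f₄) →
        let r₄ = Ready-frame (copyArray right (io 0) dim²) (untouched (copyArray right (io 0) dim²) refl) f₄ r₃ in
        Runs-Leaves-frame (Runs-exec {P = _≡ exec (left ≔ reg dim) s₄} refl refl) then (Leaves-closed , λ { (refl , f₅) →
        let s₅ = exec (left ≔ reg dim) s₄
            r₅ = Ready-frame (left ≔ reg dim) {s₄} {s₅} (untouched (left ≔ reg dim) refl) f₅ r₄ in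
        Runs-Leaves-frame (call-sound {s₅} (dim≡d r₄)) then (Leaves-closed , λ {s₆} (out≈ , f₆) →
        -- The called program is unknown, so `Ready` survives by the frame alone, name by name.
        let r₆ = Ready-frame (shiftᴾ multiply) {s₅} {s₆} (call-free-var 1 ∷ call-free-var 2 ∷ call-free-var 3 ∷
                call-free-var 40 ∷ call-free-var 41 ∷
                   call-free-var 42 ∷ call-free-io 0 ∷ call-free-var 4 ∷ call-free-var 20 ∷ []) f₆ r₅ in
        Runs-Leaves-frame (Runs-exec {P = _≡ exec (offset ≔ const 0) s₆} refl refl) then (Leaves-closed ,
            λ { (refl , f₇) →
        let s₇ = exec (offset ≔ const 0) s₆
            r₇ = Ready-frame (offset ≔ const 0) {s₆} {s₇} (untouched (offset ≔ const 0) refl) f₇ r₆ in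
        subst (λ k → Runs (prefixSums outcomes scaled) s₇ (3 ℕ.+ (k ℕ.* 8 ℕ.+ 1)) 0 (Leaves (Prepared b))) (dim²≡ r₇)
          (Runs-map (Leaves-map λ {s₈} (sums≈ , f₈) → record
             { ready  = Ready-frame (prefixSums outcomes scaled) {s₇} {s₈}
                 (untouched (prefixSums outcomes scaled) refl) f₈ r₇
             ; block≡ = ≡.trans (sameReg (f₈ block refl)) (≡.trans (sameReg (f₆ block (call-free-var 11)))
                          (≡.trans (sameReg (f₄ block refl))
                              (≡.trans (sameReg (f₃ block refl)) (sameReg (f₂ block refl)))))
             ; sums≈  = λ x x≤d → ≈-trans
                 (sums≈ (x ℕ.* d) (subst (x ℕ.* d ℕ.≤_) (≡.sym (dim²≡ r₇)) (ℕ.*-monoˡ-≤ d x≤d)))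
                 (prefix-product {b} {reals s₆ outcomes} {reals s₆ scaled}
                   (λ i j i<d j<d → ≈-trans (out≈ i j i<d j<d) (Σ<-cong d λ k k<d → *-cong
                     (≈-trans (≈-reflexive (≡.trans (sameReal (f₄ left refl) _) (left≡ _ (i*d+j<m*d i<d k<d))))
                         (rows≈ blk i k i<d k<d))
                     (≈-reflexive (≡.trans (right≡ _ (i*d+j<m*d k<d j<d)) (matrix≡ r₃ _)))))
                   (λ i j i<d j<d → ≈-trans (≈-reflexive (≡.trans (sameReal (f₆ scaled (call-free-var 45)) _)
                       (≡.trans (sameReal (f₄ scaled refl) _) (sameReal (f₃ scaled refl) _)))) (scaled≈ blk i j i<d j<d))
                   x x≤d)
             }) (Runs-Leaves-frame (prefixSums-sound {outcomes} {scaled} {s₇} refl refl))) })) }))))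

      module _ {z z⁻¹ : Carrier} (z⁻¹z≈1 : z⁻¹ * z ≈ 1#) (0≤z*weight : ∀ r → 0# ≤ z * weight⁺ r) where

        -- The probabilities appear multiplied by the weight of the block, which is the form in
        -- which `sample` wants the continuation of the outer search.
        sampleBlock-sound : ∀ {b s} → Prepared b s →
          Runs sampleBlock s (2 ℕ.+ (d ℕ.* 27 ℕ.+ 1 ℕ.+ 2)) 0 (λ τ →
            Distributed (blockWeight b) (λ i → Σ< d (λ j → weight⁺ (b ℕ.* d ℕ.+ j) * indicator (b ℕ.* d ℕ.+ j) i))
                (io 0) τ ×
            Leaves Rep τ)
        sampleBlock-sound {b} {s} p =
          Runs-exec {P = _≡ s₁} refl refl then (Sampled-closed , λ { refl →
            subst (λ e → Runs (search evaluateBlock ⨾ output) s₁ (d ℕ.* 27 ℕ.+ 1 ℕ.+ 2) 0 (λ τ →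
                Distributed (Σ< e W) (λ i → Σ< e (λ j → W j * indicator (b ℕ.* d ℕ.+ j) i)) (io 0) τ ×
                    Leaves Rep τ)) dim-s
              (sample {W} {G = λ j i → W j * indicator (b ℕ.* d ℕ.+ j) i} searched finish) })
          where
          output = offset ≔ block ⊠ dim ⨾ io 0 ≔ offset ⊞ lo
          W : ℕ → Carrier
          W j = weight⁺ (b ℕ.* d ℕ.+ j)
          s₁ = exec (lo ≔ const 0 ⨾ len ≔ reg dim) s
          dim-s : regs s dim ≡ d
          dim-s = dim≡d (ready p)
          open Intervals lo len W

          Prepared-frame : ∀ C {s s′} → Untouched C (block ∷ sums ∷ readyNames) →
                           Frame C s s′ → Prepared b s → Prepared b s′
          Prepared-frame C (e₁ ∷ e₂ ∷ es) f p = record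
            { ready  = Ready-frame C es f (ready p)
            ; block≡ = ≡.trans (sameReg (f block e₁)) (block≡ p)
            ; sums≈  = λ x x≤d → ≈-trans (≈-reflexive (sameReal (f sums e₂) _)) (sums≈ p x x≤d)
            }

          p₁ : Prepared b s₁
          p₁ = Prepared-frame (lo ≔ const 0 ⨾ len ≔ reg dim) (untouched (lo ≔ const 0 ⨾ len ≔ reg dim) refl)
            (exec-frame (lo ≔ const 0 ⨾ len ≔ reg dim) s refl) p

          evaluates : ∀ s → Frame (halve evaluateBlock) s₁ s → regs s arg ℕ.≤ d →
            Runs evaluateBlock s 2 0 (Leaves (λ s′ → scalar result s′ ≈ Σ< (regs s arg) W))
          evaluates s f =
            let q = Prepared-frame (halve evaluateBlock) {s₁} {s} (untouched (halve evaluateBlock) refl) f p₁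
            in evaluateBlock-sound b s (ready q) (sums≈ q)

          open Evaluated evaluateBlock 2 d W s₁ (untouched evaluateBlock refl)
            evaluates z⁻¹z≈1 (λ j → 0≤z*weight _)

          searched : Runs (search evaluateBlock) s₁ (d ℕ.* 27 ℕ.+ 1) 0
            (λ τ → Balanced s₁ τ × Leaves (λ s′ → regs s′ len ≡ 1 × Prepared b s′) τ)
          searched = Runs-map (λ ((bal , ls) , fs) → bal , Leaves-map (λ (len≡1 , f) → len≡1 ,
              Prepared-frame (search evaluateBlock) (untouched (search evaluateBlock) refl) f p₁) (Leaves-zip ls fs))
            (Runs-frame (search-sound d s₁ (λ _ _ → Unchanged-refl) (least≡ (ready p₁))
              (subst (ℕ._≤ 2 ℕ.^ d) (≡.sym dim-s) (n≤2^n d))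
              (subst (1 ℕ.≤_) (≡.sym dim-s) (ℕ.>-nonZero⁻¹ d) , ℕ.≤-reflexive dim-s)))

          finish : ∀ {s} → Prepared b s → Runs output s 2 0 (λ τ →
            Distributed (W (regs s lo)) (λ i → W (regs s lo) * indicator (b ℕ.* d ℕ.+ regs s lo) i)
                (io 0) τ × Leaves Rep τ)
          finish {s} p = Runs-map (λ ls → Distributed-Leaves (Leaves-map proj₁ ls) , Leaves-map proj₂ ls)
              (Runs-exec {P = λ s′ →
              (∀ i → W (regs s lo) * indicator (regs s′ (io 0)) i ≈ W (regs s lo) *
                  indicator (b ℕ.* d ℕ.+ regs s lo) i) × Rep s′}
            refl ((λ i → *-congˡ (≈-reflexive
                (cong (λ k → indicator (k ℕ.+ regs s lo) i) (cong₂ ℕ._*_ (block≡ p) (dim≡d (ready p)))))) ,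
                  Rep-frame output (untouched output refl) (exec-frame output s refl) (rep (ready p))))

        -- `Rep` is established again at every leaf, so that queries can be repeated; the output
        -- register `io 0` is not part of it.
        query-sound : ∀ {s} → Rep s → (∀ t → reals s (io 0) t ≡ a t) →
          Runs (query multiply) s (queryTime d ⌊log₂ n / d ⌋) 1 (λ τ →
            Distributed (Σ< m blockWeight)
              (λ i → Σ< m (λ b → Σ< d (λ j → weight⁺ (b ℕ.* d ℕ.+ j) * indicator (b ℕ.* d ℕ.+ j) i))) (io 0) τ ×
            Leaves Rep τ)
        query-sound {s} r a≡ =
          Runs-exec {P = _≡ s₁} refl refl then (Sampled-closed , λ { refl →
            subst (λ e → Runs (search evaluateGram ⨾ rest) s₁
                (U ℕ.+ (1 ℕ.+ (prepareTime N ℕ.+ (2 ℕ.+ (d ℕ.* 27 ℕ.+ 1 ℕ.+ 2))))) 1 (λ τ →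
                Distributed (Σ< e blockWeight) (λ i → Σ< e (λ b → G b i)) (io 0) τ × Leaves Rep τ)) (blocks≡ r)
              (sample {blockWeight} {G = G} searched λ {s′} r′ →
                Runs-exec {P = _≡ exec (block ≔ reg lo) s′} refl refl then (Sampled-closed , λ { refl →
                  prepareBlock-sound (Ready-frame (block ≔ reg lo) {s′} {exec (block ≔ reg lo) s′}
                      (untouched (block ≔ reg lo) refl)
                    (exec-frame (block ≔ reg lo) s′ refl) r′) refl then (Sampled-closed , sampleBlock-sound) })) })
          where
          U = suc ⌊log₂ n / d ⌋ ℕ.* (3 ℕ.* (N ℕ.* 8 ℕ.+ 6) ℕ.+ 21) ℕ.+ 1
          prelude = dim² ≔ dim ⊠ dim ⨾ lo ≔ const 0 ⨾ len ≔ reg blocks ⨾ least ≔ const 1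
          rest = block ≔ reg lo ⨾ prepareBlock multiply ⨾ sampleBlock
          G : ℕ → ℕ → Carrier
          G b i = Σ< d (λ j → weight⁺ (b ℕ.* d ℕ.+ j) * indicator (b ℕ.* d ℕ.+ j) i)
          s₁ = exec prelude s
          r₁ : Ready s₁
          r₁ = record
            { rep     = Rep-frame prelude (untouched prelude refl) (exec-frame prelude s refl) r
            ; matrix≡ = a≡
            ; dim²≡   = cong₂ ℕ._*_ (dim≡ (stored r)) (dim≡ (stored r))
            ; least≡  = refl
            }
          open Intervals lo len blockWeight

          0≤z*blockWeight : ∀ b → 0# ≤ z * blockWeight b
          0≤z*blockWeight b = ≤-respʳ-≈ (≈-sym (*-distribˡ-Σ< d z _)) (Σ<-nonNegative d λ _ → 0≤z*weight _)

          balanced : Runs (search evaluateGram) s₁ U 0 (λ τ → Balanced s₁ τ × Leaves (λ s′ → regs s′ len ≡ 1) τ)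
          balanced with d ℕ.≤? n
          ... | yes d≤n = search-sound (suc ⌊log₂ n / d ⌋) s₁ (λ _ _ → Unchanged-refl) refl
            (subst (ℕ._≤ 2 ℕ.^ suc ⌊log₂ n / d ⌋) (≡.sym (blocks≡ r)) (n<2^[1+⌊log₂n⌋] (n / d)))
            (subst (1 ℕ.≤_) (≡.sym (blocks≡ r)) (ℕ.s≤s ℕ.z≤n) , ℕ.≤-reflexive (blocks≡ r))
            where
            evaluates : ∀ s → Frame (halve evaluateGram) s₁ s → regs s arg ℕ.≤ m →
              Runs evaluateGram s (N ℕ.* 8 ℕ.+ 6) 0 (Leaves (λ s′ → scalar result s′ ≈ Σ< (regs s arg) blockWeight))
            evaluates s f = evaluateGram-sound s
              (Ready-frame (halve evaluateGram) {s₁} {s} (untouched (halve evaluateGram) refl) f r₁) d≤n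

            open Evaluated evaluateGram (N ℕ.* 8 ℕ.+ 6) m blockWeight s₁
                (untouched evaluateGram refl) evaluates z⁻¹z≈1 0≤z*blockWeight
          -- For n < d the interval has length 1 from the start, the guard fails, and the prefix
          -- sums are never read.
          ... | no d≰n = Runs-≤ (ℕ.m≤n+m 1 _) ℕ.z≤n
              (Runs-stop (λ 1<len → ℕ.<-irrefl refl (subst (1 ℕ.<_) blocks≡1 1<len))
                  (Balanced-done {s₁} {s₁} refl refl , done blocks≡1))
            where
            blocks≡1 : regs s blocks ≡ 1
            blocks≡1 = ≡.trans (blocks≡ r) (cong suc (m<n⇒m/n≡0 (ℕ.≰⇒> d≰n)))

          searched : Runs (search evaluateGram) s₁ U 0
              (λ τ → Balanced s₁ τ × Leaves (λ s′ → regs s′ len ≡ 1 × Ready s′) τ)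
          searched = Runs-map (λ ((bal , ls) , fs) → bal , Leaves-map (λ (len≡1 , f) → len≡1 ,
              Ready-frame (search evaluateGram) (untouched (search evaluateGram) refl) f r₁) (Leaves-zip ls fs))
            (Runs-frame balanced)

-- Preprocessing

start limit : Name
start = var 21
limit = var 22

addBlock : Program → Program
addBlock multiply =
  load-block ⨾ copyArray left columns dim² ⨾ copyArray right scaled dim² ⨾
  left ≔ reg dim ⨾ shiftᴾ multiply ⨾ offset ≔ block ⊠ dim² ⨾ accumulate ⨾
  (next ≔ const 1 ⨾ block ≔ block ⊞ next ⨾ start ≔ block ⊠ dim)

-- The guard says block * dim ≤ count, so the loop makes exactly ⌊count / dim⌋ + 1 rounds: the
-- number of blocks is found by counting instead of dividing.
build : Program → Program
build multiply =
  clear ⨾ (block ≔ const 0 ⨾ start ≔ const 0 ⨾ next ≔ const 1 ⨾ limit ≔ count ⊞ next) ⨾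
  (while start < limit loop addBlock multiply) ⨾ blocks ≔ reg block

init : Program → Program
init multiply =
  (count ≔ reg (io 0) ⨾ dim ≔ reg (io 1) ⨾ dim² ≔ dim ⊠ dim ⨾ next ≔ count ⊠ dim) ⨾
  copyArray vectors (io 0) next ⨾ copyArray coefficients (io 1) count ⨾
  if count < dim then blocks ≔ const 1 else build multiply

addTime : ℕ → ℕ
addTime N = (4 ℕ.+ (N ℕ.* suc (size loadEntry ℕ.+ 2) ℕ.+ 1)) ℕ.+ (suc (N ℕ.* 4 ℕ.+ 1) ℕ.+ (suc (N ℕ.* 4 ℕ.+ 1) ℕ.+
            (1 ℕ.+ (0 ℕ.+ (1 ℕ.+ (suc (N ℕ.* 7 ℕ.+ 1) ℕ.+ 3))))))

buildTime : ℕ → ℕ → ℕ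
buildTime N m = suc (N ℕ.* 4 ℕ.+ 1) ℕ.+ (4 ℕ.+ (m ℕ.* suc (addTime N) ℕ.+ 1 ℕ.+ 1))

initTime : ℕ → ℕ → ℕ → ℕ
initTime n d u = 4 ℕ.+ (suc (n ℕ.* d ℕ.* 4 ℕ.+ 1) ℕ.+ (suc (n ℕ.* 4 ℕ.+ 1) ℕ.+ u))

module Preprocessing {c ℓ₁ ℓ₂ : Level} (ℝ : RealNumbers c ℓ₁ ℓ₂)
  (M : RealNumbers.Carrier ℝ) (0≤M : RealNumbers._≤_ ℝ (RealNumbers.0# ℝ) M)
  {n d : ℕ} .{{_ : ℕ.NonZero d}} (v : Fin n → Fin d → RealNumbers.Carrier ℝ) (α : Fin n → RealNumbers.Carrier ℝ)
  (multiply : Program) where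

  open RealNumbers ℝ hiding (zero)
    renaming (refl to ≈-refl; sym to ≈-sym; trans to ≈-trans; reflexive to ≈-reflexive)
  open RealProperties ℝ
  open RealRAM ℝ
  open Semantics ℝ
  open Logic M 0≤M
  open Expectation ℝ
  open Loops ℝ M 0≤M
  open Blocks v α
  open Gram ℝ d v⁺ α⁺
  open Algorithm ℝ M 0≤M v α multiply
  open State
  open Stored
  open Block

  -- After `j` rounds the prefix sums number 0 to `j` are present, number 0 being the zero matrix
  -- that `clear` writes.
  record Built (j : ℕ) (s : State) : Set ℓ₁ where
    field
      stored : Stored s
      dim²≡  : regs s dim² ≡ N
      block≡ : regs s block ≡ j
      start≡ : regs s start ≡ j ℕ.* d
      limit≡ : regs s limit ≡ n ℕ.+ 1
      gram≈  : ∀ k → k ℕ.< j ℕ.* N ℕ.+ N → reals s gram k ≈ flatGram k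
  open Built

  module _ (correct : ∀ (A B : Matrix d d) s → regs s (io 0) ≡ d → HoldsMatrix (io 0) A s → HoldsMatrix (io 1) B s →
     multiply from s inTime M ensures Leaves (HoldsMatrix (io 2) (mul A B))) where

    open Multiplication M 0≤M multiply correct

    Built-frame : ∀ C {j s s′} → Untouched C
        (count ∷ dim ∷ vectors ∷ coefficients ∷ dim² ∷ block ∷ start ∷ limit ∷ gram ∷ []) →
      Frame C s s′ → Built j s → Built j s′
    Built-frame C (e₁ ∷ e₂ ∷ e₃ ∷ e₄ ∷ e₅ ∷ e₆ ∷ e₇ ∷ e₈ ∷ e₉ ∷ []) f b = record
      { stored = Stored-frame C (e₁ ∷ e₂ ∷ e₃ ∷ e₄ ∷ []) f (stored b)
      ; dim²≡  = ≡.trans (sameReg (f dim² e₅)) (dim²≡ b)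
      ; block≡ = ≡.trans (sameReg (f block e₆)) (block≡ b)
      ; start≡ = ≡.trans (sameReg (f start e₇)) (start≡ b)
      ; limit≡ = ≡.trans (sameReg (f limit e₈)) (limit≡ b)
      ; gram≈  = λ k k< → ≈-trans (≈-reflexive (sameReal (f gram e₉) k)) (gram≈ b k k<)
      }

    addBlock-sound : ∀ {j s} → Built j s → Runs (addBlock multiply) s (addTime N) 1 (Leaves (Built (suc j)))
    addBlock-sound {j} {s} b =
      Runs-Leaves-frame (load-block-sound (stored b) (dim²≡ b)) then (Leaves-closed , λ {s₂} (blk , f₂) →
      let b₂ = Built-frame load-block (untouched load-block refl) f₂ b in
      Runs-Leaves-frame (copied left columns s₂ (dim²≡ b₂) refl refl refl) then (Leaves-closed , λ {s₃} (left≡ , f₃) →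
      let b₃ = Built-frame (copyArray left columns dim²) (untouched (copyArray left columns dim²) refl) f₃ b₂ in
      Runs-Leaves-frame (copied right scaled s₃ (dim²≡ b₃) refl refl refl) then (Leaves-closed , λ {s₄} (right≡ , f₄) →
      let b₄ = Built-frame (copyArray right scaled dim²) (untouched (copyArray right scaled dim²) refl) f₄ b₃ in
      Runs-exec {P = _≡ exec (left ≔ reg dim) s₄} refl refl then (Leaves-closed , λ { refl →
      let s₅ = exec (left ≔ reg dim) s₄
          b₅ = Built-frame (left ≔ reg dim) {s = s₄} {s₅} (untouched (left ≔ reg dim) refl)
                 (exec-frame (left ≔ reg dim) s₄ refl) b₄ in
      Runs-Leaves-frame (call-sound {s₅} (dim≡ (stored b₄))) then (Leaves-closed , λ {s₆} (out≈ , f₆) →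
      let b₆ = Built-frame (shiftᴾ multiply) {s = s₅} {s₆} (call-free-var 1 ∷ call-free-var 2 ∷ call-free-var 40 ∷
              call-free-var 41 ∷
                 call-free-var 4 ∷ call-free-var 11 ∷ call-free-var 21 ∷ call-free-var 22 ∷
                     call-free-var 42 ∷ []) f₆ b₅ in
      Runs-exec {P = _≡ exec (offset ≔ block ⊠ dim²) s₆} refl refl then (Leaves-closed , λ { refl →
      let s₇ = exec (offset ≔ block ⊠ dim²) s₆
          b₇ = Built-frame (offset ≔ block ⊠ dim²) {s = s₆} {s₇} (untouched (offset ≔ block ⊠ dim²) refl)
                 (exec-frame (offset ≔ block ⊠ dim²) s₆ refl) b₆ in
      Runs-Leaves-frame (accumulate-sound {s₇} flatGram (cong₂ ℕ._*_ (block≡ b₆) (dim²≡ b₆)) (dim²≡ b₆) (gram≈ b₇)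
        -- Entry `t` of the product is entry (t / d, t % d) of the Gram matrix of the block, which
        -- is the difference of two consecutive prefix sums.
        (λ t t<N → recurrence t t<N
          (≈-trans (≈-reflexive (cong (reals s₆ outcomes) (t≡ t))) (≈-trans (out≈ (t / d) (t % d) (t/d<d t<N) (m%n<n t d))
            (Σ<-cong d λ k k<d → *-cong
              (≈-trans (≈-reflexive (≡.trans (sameReal (f₄ left refl) _) (left≡ _ (i*d+j<m*d (t/d<d t<N) k<d))))
                (≈-trans (columns≈ blk (t / d) k (t/d<d t<N) k<d)
                    (≈-reflexive (cong (λ b → v⁺ (b ℕ.* d ℕ.+ k) (t / d)) (block≡ b)))))
              (≈-trans (≈-reflexive (≡.trans (right≡ _ (i*d+j<m*d k<d (m%n<n t d))) (sameReal (f₃ scaled refl) _)))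
                (≈-trans (scaled≈ blk k (t % d) k<d (m%n<n t d))
                  (≈-reflexive (cong (λ b → α⁺ (b ℕ.* d ℕ.+ k) * v⁺ (b ℕ.* d ℕ.+ k) (t % d)) (block≡ b))))))))))
        then (Leaves-closed , λ {s₈} (gram≈₈ , f₈) →
      Runs-exec refl (record
        { stored = Stored-frame advance {s₈} (untouched advance refl) (exec-frame advance s₈ refl)
                     (Stored-frame accumulate {s₇} {s₈} (untouched accumulate refl) f₈ (stored b₇))
        ; dim²≡  = ≡.trans (sameReg (f₈ dim² refl)) (dim²≡ b₇)
        ; block≡ = next-block s₈ (≡.trans (sameReg (f₈ block refl)) (block≡ b₇))
        ; start≡ = cong₂ ℕ._*_ (next-block s₈ (≡.trans (sameReg (f₈ block refl)) (block≡ b₇)))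
                     (≡.trans (sameReg (f₈ dim refl)) (dim≡ (stored b₇)))
        ; limit≡ = ≡.trans (sameReg (f₈ limit refl)) (limit≡ b₇)
        ; gram≈  = λ k k< → gram≈₈ k (subst (λ x → k ℕ.< x ℕ.+ N) (ℕ.+-comm N (j ℕ.* N)) k<)
        })) }) ) }))))
      where
      advance = next ≔ const 1 ⨾ block ≔ block ⊞ next ⨾ start ≔ block ⊠ dim
      next-block : ∀ s → regs s block ≡ j → regs s block ℕ.+ 1 ≡ suc j
      next-block s eq = ≡.trans (cong (ℕ._+ 1) eq) (ℕ.+-comm j 1)
      t≡ : ∀ t → t ≡ t / d ℕ.* d ℕ.+ t % d
      t≡ t = ≡.trans (m≡m%n+[m/n]*n t d) (ℕ.+-comm (t % d) _)
      t/d<d : ∀ {t} → t ℕ.< N → t / d ℕ.< d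
      t/d<d t<N = m<n*o⇒m/o<n t<N
      recurrence : ∀ t → t ℕ.< N → ∀ {x} → x ≈ blockGram j (t / d) (t % d) →
                   flatGram (j ℕ.* N ℕ.+ t) + x ≈ flatGram (j ℕ.* N ℕ.+ N ℕ.+ t)
      recurrence t t<N x≈ = ≈-trans (+-cong (≈-reflexive (flatGram-≈ j t<N)) x≈)
        (≈-reflexive (≡.trans (≡.sym (flatGram-≈ (suc j) t<N)) (cong (λ x → flatGram (x ℕ.+ t)) (ℕ.+-comm N (j ℕ.* N)))))

    build-sound : ∀ {s} → Stored s → regs s dim² ≡ N → Runs (build multiply) s (buildTime N m) m (Leaves Rep)
    build-sound {s} st dim²≡N = subst (λ k → Runs (build multiply) s (buildTime N m) k (Leaves Rep)) calls≡
      (Runs-Leaves-frame cleared then (Leaves-closed , λ {s₁} (gram≡0 , f₁) →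
       Runs-exec {P = _≡ exec prelude s₁} refl refl then (Leaves-closed , λ { refl →
       Runs-while m Built
         (λ j s j<m _ b → ≡.subst₂ ℕ._<_ (≡.sym (start≡ b)) (≡.sym (limit≡ b)) (j*d<n+1 j<m) , addBlock-sound b)
         (λ s _ b start<limit → ℕ.<⇒≱ (≡.subst₂ ℕ._<_ (start≡ b) (limit≡ b) start<limit) n+1≤m*d)
         (record
           { stored = Stored-frame prelude {s₁} (untouched prelude refl) (exec-frame prelude s₁ refl)
                        (Stored-frame clear {s} {s₁} (untouched clear refl) f₁ st)
           ; dim²≡  = ≡.trans (sameReg (f₁ dim² refl)) dim²≡N
           ; block≡ = refl
           ; start≡ = refl
           ; limit≡ = cong (ℕ._+ 1) (≡.trans (sameReg (f₁ count refl)) (count≡ st))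
           ; gram≈  = λ k k<N → ≈-trans (≈-reflexive (gram≡0 k k<N)) (≈-reflexive (≡.sym (flatGram-≈ 0 k<N)))
           })
       then (Leaves-closed , λ {s₂} b → Runs-exec refl (record
         { stored  = Stored-frame (blocks ≔ reg block) {s₂} (untouched (blocks ≔ reg block) refl)
             (exec-frame (blocks ≔ reg block) s₂ refl) (stored b)
         ; blocks≡ = block≡ b
         ; gram≈   = λ _ k k< → gram≈ b k (subst (k ℕ.<_) (ℕ.+-comm N (m ℕ.* N)) k<)
         })) })))
      where
      prelude = block ≔ const 0 ⨾ start ≔ const 0 ⨾ next ≔ const 1 ⨾ limit ≔ count ⊞ next
      calls≡ : m ℕ.* 1 ℕ.+ 0 ≡ m
      calls≡ = ≡.trans (ℕ.+-identityʳ _) (ℕ.*-identityʳ m)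
      cleared : Runs clear s (suc (N ℕ.* 4 ℕ.+ 1)) 0 (Leaves (λ s′ → ∀ t → t ℕ.< N → reals s′ gram t ≡ 0#))
      cleared = subst (λ k → Runs clear s (suc (k ℕ.* 4 ℕ.+ 1)) 0 (Leaves (λ s′ → ∀ t → t ℕ.< k → reals s′ gram t ≡ 0#)))
        dim²≡N clear-sound
      j*d<n+1 : ∀ {j} → j ℕ.< m → j ℕ.* d ℕ.< n ℕ.+ 1
      j*d<n+1 {j} j<m = subst (j ℕ.* d ℕ.<_) (ℕ.+-comm 1 n)
        (ℕ.s≤s (ℕ.≤-trans (ℕ.*-monoˡ-≤ d (ℕ.≤-pred j<m)) (m/n*n≤m n d)))
      n+1≤m*d : n ℕ.+ 1 ℕ.≤ m ℕ.* d
      n+1≤m*d = subst (ℕ._≤ m ℕ.* d) (ℕ.+-comm 1 n)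
        (subst (ℕ._< m ℕ.* d) (≡.sym (m≡m%n+[m/n]*n n d)) (ℕ.+-monoˡ-< (n / d ℕ.* d) (m%n<n n d)))

    init-sound : ∀ {s} u k → InitInput v α s →
      (∀ {s′} → Stored s′ → regs s′ dim² ≡ N →
         Runs (if count < dim then blocks ≔ const 1 else build multiply) s′ u k (Leaves Rep)) →
      Runs (init multiply) s (initTime n d u) k (Leaves Rep)
    init-sound {s} u k (refl , refl , holdsV , holdsα) continue =
      Runs-exec {P = _≡ s₁} refl refl then (Leaves-closed , λ { refl →
      Runs-Leaves-frame (copyArray-sound {vectors} {io 0} {next} {s₁} refl refl refl refl refl) then (Leaves-closed ,
          λ {s₂} (v≡ , f₂) →
      subst (λ n′ → Runs (copyArray coefficients (io 1) count ⨾ D) s₂ (suc (n′ ℕ.* 4 ℕ.+ 1) ℕ.+ u) k (Leaves Rep))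
          (sameReg (f₂ count refl))
        (Runs-Leaves-frame (copyArray-sound {coefficients} {io 1} {count} {s₂} refl refl refl refl refl)
            then (Leaves-closed , λ {s₃} (α≡ , f₃) →
        continue {s₃} (record
          { count≡        = ≡.trans (sameReg (f₃ count refl)) (sameReg (f₂ count refl))
          ; dim≡          = ≡.trans (sameReg (f₃ dim refl)) (sameReg (f₂ dim refl))
          ; vectors≈      = λ r j r<n j<d → ≈-trans
              (≈-reflexive (≡.trans (sameReal (f₃ vectors refl) _) (v≡ _ (i*d+j<m*d r<n j<d)))) (input-v r<n j<d)
          ; coefficients≈ = λ r r<n → ≈-trans
              (≈-reflexive (≡.trans (α≡ r (subst (r ℕ.<_) (≡.sym (sameReg (f₂ count refl))) r<n))
                  (sameReal (f₂ (io 1) refl) r))) (input-α r<n)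
          }) (≡.trans (sameReg (f₃ dim² refl)) (sameReg (f₂ dim² refl))))) ) })
      where
      D = if count < dim then blocks ≔ const 1 else build multiply
      s₁ = exec (count ≔ reg (io 0) ⨾ dim ≔ reg (io 1) ⨾ dim² ≔ dim ⊠ dim ⨾ next ≔ count ⊠ dim) s
      input-v : ∀ {r j} → r ℕ.< n → j ℕ.< d → reals s (io 0) (r ℕ.* d ℕ.+ j) ≈ v⁺ r j
      input-v r<n j<d = ≡.subst₂ (λ r j → reals s (io 0) (r ℕ.* d ℕ.+ j) ≈ v⁺ r j) (Fin.toℕ-fromℕ< r<n)
          (Fin.toℕ-fromℕ< j<d)
        (≈-trans (holdsV (fromℕ< r<n) (fromℕ< j<d)) (≈-reflexive (≡.sym (v⁺-toℕ (fromℕ< r<n) (fromℕ< j<d)))))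
      input-α : ∀ {r} → r ℕ.< n → reals s (io 1) r ≈ α⁺ r
      input-α r<n = subst (λ r → reals s (io 1) r ≈ α⁺ r) (Fin.toℕ-fromℕ< r<n)
        (≈-trans (holdsα (fromℕ< r<n)) (≈-reflexive (≡.sym (extend-toℕ α (fromℕ< r<n)))))

    Runs-if : ∀ {x y C D s u k ℓ} {Φ : Pred Tree ℓ} →
      (regs s x ℕ.< regs s y → Runs C s u k Φ) → (¬ regs s x ℕ.< regs s y → Runs D s u k Φ) →
      Runs (if x < y then C else D) s (suc u) k Φ
    Runs-if {x} {y} {s = s} f g with regs s x ℕ.<? regs s y
    ... | yes b with runs (t , τ , p , t≤ , φ) ← f b =
      runs (suc t , τ , ifTrue b p , ≤-respʳ-≈ (≈-sym (+-assoc _ _ _)) (+-monoʳ-≤ 1# t≤) , φ)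
    ... | no b with runs (t , τ , p , t≤ , φ) ← g b =
      runs (suc t , τ , ifFalse b p , ≤-respʳ-≈ (≈-sym (+-assoc _ _ _)) (+-monoʳ-≤ 1# t≤) , φ)

    init-small : ∀ {s} → n ℕ.< d → InitInput v α s →
      Runs (init multiply) s (initTime n d 2) 0 (Leaves Rep)
    init-small n<d input = init-sound 2 0 input λ {s} st _ → Runs-if
      (λ _ → Runs-exec refl (record
        { stored  = Stored-frame (blocks ≔ const 1) {s} (untouched (blocks ≔ const 1) refl)
            (exec-frame (blocks ≔ const 1) s refl) st
        ; blocks≡ = cong suc (≡.sym (m<n⇒m/n≡0 n<d))
        ; gram≈   = λ d≤n → contradiction d≤n (ℕ.<⇒≱ n<d)
        }))
      (λ n≮d → contradiction (≡.subst₂ ℕ._<_ (≡.sym (count≡ st)) (≡.sym (dim≡ st)) n<d) n≮d)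

    init-large : ∀ {s} → d ℕ.≤ n → InitInput v α s →
      Runs (init multiply) s (initTime n d (suc (buildTime N m))) m (Leaves Rep)
    init-large d≤n input = init-sound (suc (buildTime N m)) m input λ st dim²≡N → Runs-if
      (λ n<d → contradiction d≤n (ℕ.<⇒≱ (≡.subst₂ ℕ._<_ (count≡ st) (dim≡ st) n<d)))
      (λ _ → build-sound st dim²≡N)

-- Time, correctness and space

queryTime-≤ : ∀ d ℓ .{{_ : ℕ.NonZero d}} → queryTime d ℓ ℕ.≤ 200 ℕ.* (d ℕ.^ 2 ℕ.* ℓ ℕ.+ d ℕ.* d)
-- The implicit argument is the slack, expanded in e = d − 1.
queryTime-≤ (suc e) ℓ = ℕ.m+n≤o⇒m≤o _ {ℓ ℕ.* (137 ℕ.+ 352 ℕ.* e ℕ.+ 176 ℕ.* (e ℕ.* e)) ℕ.+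
    (44 ℕ.+ 245 ℕ.* e ℕ.+ 136 ℕ.* (e ℕ.* e))}
  (ℕ.≤-reflexive (solve 2 (λ e ℓ → let d = con 1 :+ e ; N = d :* d in
    (con 4 :+ ((con 1 :+ ℓ) :* (con 3 :* (N :* con 8 :+ con 6) :+ con 21) :+ con 1 :+ (con 1 :+
      ((con 4 :+ (N :* con 24 :+ con 1)) :+ ((con 1 :+ (N :* con 4 :+ con 1)) :+ ((con 1 :+ (N :* con 4 :+ con 1)) :+
                    (con 1 :+ (con 0 :+ (con 1 :+ (con 3 :+ (N :* con 8 :+ con 1))))))) :+
                        (con 2 :+ (d :* con 27 :+ con 1 :+ con 2))))))
     :+ (ℓ :* (con 137 :+ con 352 :* e :+ con 176 :* (e :* e)) :+ (con 44 :+ con 245 :* e :+ con 136 :* (e :* e)))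
    := con 200 :* (d :* (d :* con 1) :* ℓ :+ N)) refl e ℓ))
  where open +-*-Solver

initTime-small-≤ : ∀ n d .{{_ : ℕ.NonZero n}} .{{_ : ℕ.NonZero d}} → initTime n d 2 ℕ.≤ 200 ℕ.* (n ℕ.* d)
-- The implicit argument is again the slack, expanded in the predecessors of both numbers.
initTime-small-≤ (suc n) (suc d) = ℕ.m+n≤o⇒m≤o _ {182 ℕ.+ 192 ℕ.* n ℕ.+ 196 ℕ.* d ℕ.+ 196 ℕ.* (n ℕ.* d)}
  (ℕ.≤-reflexive (solve 2 (λ n d → let n′ = con 1 :+ n ; d′ = con 1 :+ d in
    (con 4 :+ ((con 1 :+ (n′ :* d′ :* con 4 :+ con 1)) :+ ((con 1 :+ (n′ :* con 4 :+ con 1)) :+ con 2)))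
      :+ (con 182 :+ con 192 :* n :+ con 196 :* d :+ con 196 :* (n :* d))
    := con 200 :* (n′ :* d′)) refl n d))
  where open +-*-Solver

initTime-large-≤ : ∀ n d m .{{_ : ℕ.NonZero n}} .{{_ : ℕ.NonZero d}} → d ℕ.≤ n → m ℕ.* d ℕ.≤ 2 ℕ.* n →
  initTime n d (suc (buildTime (d ℕ.* d) m)) ℕ.≤ 200 ℕ.* (n ℕ.* d)
initTime-large-≤ n d m d≤n md≤2n = begin
  _ ≡⟨ solve 3 (λ n d m → let N = d :* d in
        con 4 :+ ((con 1 :+ (n :* d :* con 4 :+ con 1)) :+
            ((con 1 :+ (n :* con 4 :+ con 1)) :+ (con 1 :+ ((con 1 :+ (N :* con 4 :+ con 1)) :+ (con 4 :+ (m :* (con 1 :+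
          ((con 4 :+ (N :* con 24 :+ con 1)) :+ ((con 1 :+ (N :* con 4 :+ con 1)) :+ ((con 1 :+ (N :* con 4 :+ con 1)) :+
                    (con 1 :+ (con 0 :+ (con 1 :+ ((con 1 :+ (N :* con 7 :+ con 1)) :+ con 3)))))))) :+
                        con 1 :+ con 1))))))
        := con 17 :+ con 4 :* n :+ con 4 :* (d :* d) :+ con 39 :* (m :* d :* d) :+ con 17 :* m :+
            con 4 :* (n :* d)) refl n d m ⟩
  17 ℕ.+ 4 ℕ.* n ℕ.+ 4 ℕ.* (d ℕ.* d) ℕ.+ 39 ℕ.* (m ℕ.* d ℕ.* d) ℕ.+ 17 ℕ.* m ℕ.+ 4 ℕ.* (n ℕ.* d)
    ≤⟨ ℕ.+-monoˡ-≤ _ (ℕ.+-mono-≤ (ℕ.+-mono-≤ (ℕ.+-mono-≤ (ℕ.+-mono-≤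
         (ℕ.≤-trans (ℕ.m≤m*n 17 (n ℕ.* d)) ℕ.≤-refl) (ℕ.*-monoʳ-≤ 4 (ℕ.m≤m*n n d)))
         (ℕ.*-monoʳ-≤ 4 (ℕ.*-monoˡ-≤ d d≤n))) (ℕ.*-monoʳ-≤ 39 (ℕ.*-monoˡ-≤ d md≤2n)))
         (ℕ.*-monoʳ-≤ 17 (ℕ.≤-trans (ℕ.m≤m*n m d) (ℕ.≤-trans md≤2n (ℕ.m≤m*n (2 ℕ.* n) d))))) ⟩
  17 ℕ.* x ℕ.+ 4 ℕ.* x ℕ.+ 4 ℕ.* x ℕ.+ 39 ℕ.* (2 ℕ.* n ℕ.* d) ℕ.+ 17 ℕ.* (2 ℕ.* n ℕ.* d) ℕ.+ 4 ℕ.* x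
    -- The terms so far add up to 141 x, and 59 x fills this up to 200 x.
    ≤⟨ ℕ.m≤m+n _ (59 ℕ.* x) ⟩
  17 ℕ.* x ℕ.+ 4 ℕ.* x ℕ.+ 4 ℕ.* x ℕ.+ 39 ℕ.* (2 ℕ.* n ℕ.* d) ℕ.+ 17 ℕ.* (2 ℕ.* n ℕ.* d) ℕ.+ 4 ℕ.* x ℕ.+ 59 ℕ.* x
    ≡⟨ solve 2 (λ n d → con 17 :* (n :* d) :+ con 4 :* (n :* d) :+ con 4 :* (n :* d) :+ con 39 :* (con 2 :* n :* d)
          :+ con 17 :* (con 2 :* n :* d) :+ con 4 :* (n :* d) :+ con 59 :* (n :* d) := con 200 :* (n :* d)) refl n d ⟩
  200 ℕ.* x ∎
  where
  open ℕ.≤-Reasoning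
  open +-*-Solver
  x = n ℕ.* d
  instance
    x≢0 : ℕ.NonZero x
    x≢0 = ℕ.m*n≢0 n d

[1+n/d]*d≤2*n : ∀ n d .{{_ : ℕ.NonZero d}} → d ℕ.≤ n → suc (n / d) ℕ.* d ℕ.≤ 2 ℕ.* n
[1+n/d]*d≤2*n n d d≤n = ℕ.+-mono-≤ d≤n (ℕ.≤-trans (m/n*n≤m n d) (ℕ.m≤m+n n 0))

-- Time bounds over the reals

module Time {c ℓ₁ ℓ₂ : Level} (ℝ : RealNumbers c ℓ₁ ℓ₂) (ω : RealNumbers.Carrier ℝ)
  (2≤ω : RealNumbers._≤_ ℝ (RealNumbers.fromℕ ℝ 2) ω) (L d : ℕ) .{{_ : ℕ.NonZero d}} where

  open RealNumbers ℝ hiding (zero)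
    renaming (refl to ≈-refl; sym to ≈-sym; trans to ≈-trans; reflexive to ≈-reflexive)
  open RealProperties ℝ

  D X P M : Carrier
  D = fromℕ d
  X = D ^ (ω - 1#)
  P = D ^ ω
  M = fromℕ L * P

  1≤D : 1# ≤ D
  1≤D = ≤-respˡ-≈ fromℕ-1 (fromℕ-mono-≤ (ℕ.>-nonZero⁻¹ d))

  0≤D : 0# ≤ D
  0≤D = ≤-trans 0≤1 1≤D

  1≤ω-1 : 1# ≤ ω - 1#
  1≤ω-1 = ≤-respˡ-≈ (x-y≈z (+-congˡ fromℕ-1)) (≤-respˡ-≈ (+-comm _ _) (≤-respʳ-≈ (+-comm _ _) (+-monoʳ-≤ (- 1#) 2≤ω)))

  -- Here ω ≥ 2 enters: the exponent ω - 1 is at least 1, and exponentiation is monotone because the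
  -- base is at least 1.
  D≤X : D ≤ X
  D≤X = ≤-respˡ-≈ (^-identityʳ 1≤D) (^-monoʳ-≤ 1≤D 1≤ω-1)

  0≤X : 0# ≤ X
  0≤X = ≤-trans 0≤D D≤X

  P≈X*D : P ≈ X * D
  P≈X*D = ≈-trans (^-cong ≈-refl (≈-sym ([x-y]+y≈x ω 1#))) (≈-trans (^-homo-+ 1≤D _ _) (*-congˡ (^-identityʳ 1≤D)))

  D*D≤P : fromℕ (d ℕ.* d) ≤ P
  D*D≤P = ≤-respˡ-≈ (≈-sym (fromℕ-* d d)) (≤-respʳ-≈ (≈-sym P≈X*D) (*-monoˡ-≤ 0≤D D≤X))

  0≤P : 0# ≤ P
  0≤P = ≤-trans (fromℕ-nonNegative (d ℕ.* d)) D*D≤P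

  0≤M : 0# ≤ M
  0≤M = *-nonNegative (fromℕ-nonNegative L) 0≤P

  open Semantics.Logic ℝ M 0≤M using (cost)
  open SemiringSolver commutativeSemiring

  -- A call costs `L * X * D`. The factor `D` is spent on the bound for `k ℕ.* d`, which leaves at
  -- most 2 n L X for all calls.
  initTime-≤ : ∀ {n u k} C → u ℕ.≤ C ℕ.* (n ℕ.* d) → k ℕ.* d ℕ.≤ 2 ℕ.* n →
               cost u k ≤ fromℕ (C ℕ.+ 2 ℕ.* L) * (fromℕ n * X)
  initTime-≤ {n} {u} {k} C u≤ kd≤ = ≤-respʳ-≈ total≈ (+-mono-≤ steps calls)
    where
    steps : fromℕ u ≤ fromℕ C * (fromℕ n * X)
    steps = ≤-trans (fromℕ-mono-≤ u≤) (≤-respˡ-≈ (≈-sym (≈-trans (fromℕ-* C (n ℕ.* d)) (*-congˡ (fromℕ-* n d))))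
      (*-monoʳ-≤ (fromℕ-nonNegative C) (*-monoʳ-≤ (fromℕ-nonNegative n) D≤X)))
    calls : fromℕ k * M ≤ fromℕ (2 ℕ.* n) * (fromℕ L * X)
    calls = ≤-respˡ-≈ (≈-trans (*-congʳ (fromℕ-* k d)) (≈-trans
        (solve 4 (λ k d l x → k :* d :* (l :* x) := k :* (l :* (x :* d))) ≈-refl (fromℕ k) D (fromℕ L) X)
        (*-congˡ (*-congˡ (≈-sym P≈X*D)))))
      (*-monoˡ-≤ (*-nonNegative (fromℕ-nonNegative L) 0≤X) (fromℕ-mono-≤ kd≤))
    total≈ : fromℕ C * (fromℕ n * X) + fromℕ (2 ℕ.* n) * (fromℕ L * X) ≈ fromℕ (C ℕ.+ 2 ℕ.* L) * (fromℕ n * X)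
    total≈ = ≈-trans (+-congˡ (*-congʳ (fromℕ-* 2 n))) (≈-trans
      (solve 5 (λ c n x t l → c :* (n :* x) :+ t :* n :* (l :* x) := (c :+ t :* l) :* (n :* x)) ≈-refl (fromℕ C)
          (fromℕ n) X (fromℕ 2) (fromℕ L))
      (*-congʳ (≈-sym (≈-trans (fromℕ-+ C (2 ℕ.* L)) (+-congˡ (fromℕ-* 2 L))))))

  queryTime-real-≤ : ∀ {q u} C → u ℕ.≤ C ℕ.* (q ℕ.+ d ℕ.* d) → cost u 1 ≤ fromℕ (C ℕ.+ 2 ℕ.* L) * (fromℕ q + P)
  queryTime-real-≤ {q} {u} C u≤ = ≤-respʳ-≈ (≈-trans (≈-sym (distribʳ _ _ _)) (*-congʳ (≈-sym (fromℕ-+ C (2 ℕ.* L)))))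
      (+-mono-≤ steps calls)
    where
    P≤q+P : P ≤ fromℕ q + P
    P≤q+P = ≤-respʳ-≈ (+-comm _ _) (x≤x+y (fromℕ-nonNegative q))
    steps : fromℕ u ≤ fromℕ C * (fromℕ q + P)
    steps = ≤-trans (fromℕ-mono-≤ u≤)
        (≤-respˡ-≈ (≈-sym (≈-trans (fromℕ-* C (q ℕ.+ d ℕ.* d)) (*-congˡ (fromℕ-+ q (d ℕ.* d)))))
      (*-monoʳ-≤ (fromℕ-nonNegative C) (+-monoʳ-≤ _ D*D≤P)))
    calls : fromℕ 1 * M ≤ fromℕ (2 ℕ.* L) * (fromℕ q + P)
    calls = ≤-respˡ-≈ (≈-sym (≈-trans (*-congʳ fromℕ-1) (*-identityˡ M)))
      (≤-trans (*-monoʳ-≤ (fromℕ-nonNegative L) P≤q+P)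
        (*-monoˡ-≤ (≤-trans 0≤P P≤q+P) (fromℕ-mono-≤ (ℕ.m≤m+n L _))))

-- From weights to probabilities

module Correctness {c ℓ₁ ℓ₂ : Level} (ℝ : RealNumbers c ℓ₁ ℓ₂) {n d : ℕ} .{{_ : ℕ.NonZero d}}
  (v : Fin n → Fin d → RealNumbers.Carrier ℝ) (α : Fin n → RealNumbers.Carrier ℝ)
  (A : Fin d → Fin d → RealNumbers.Carrier ℝ) (a : ℕ → RealNumbers.Carrier ℝ) where

  open RealNumbers ℝ hiding (zero)
    renaming (refl to ≈-refl; sym to ≈-sym; trans to ≈-trans; reflexive to ≈-reflexive)
  open RealProperties ℝ
  open RealRAM ℝ
  open Expectation ℝ
  open Extension ℝ v α
  open Weights ℝ d v⁺ α⁺ a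
  open MonoidSum +-monoid using (sum)

  weight⁺-≥ : ∀ {r} → ¬ r ℕ.< n → weight⁺ r ≈ 0#
  weight⁺-≥ r≮n = ≈-trans (*-congʳ (≈-reflexive (extend-≥ α r≮n))) (zeroˡ _)

  n≤m*d : n ℕ.≤ suc (n / d) ℕ.* d
  n≤m*d = ℕ.≤-trans (ℕ.≤-reflexive (m≡m%n+[m/n]*n n d)) (ℕ.+-monoˡ-≤ _ (ℕ.<⇒≤ (m%n<n n d)))

  module _ (A≈a : ∀ i j → a (toℕ i ℕ.* d ℕ.+ toℕ j) ≈ A i j) where

    weight⁺-toℕ : ∀ i → weight v α A i ≈ weight⁺ (toℕ i)
    weight⁺-toℕ i = *-cong (≈-reflexive (≡.sym (extend-toℕ α i)))
      (sum≈Σ< d λ j → sum≈Σ< d λ k → *-cong (*-cong (≈-reflexive (≡.sym (v⁺-toℕ i j))) (≈-sym (A≈a j k)))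
          (≈-reflexive (≡.sym (v⁺-toℕ i k))))

    -- The padding of the last block has coefficients 0 and adds nothing.
    total-weight : sum (weight v α A) ≈ Σ< (suc (n / d)) blockWeight
    total-weight = ≈-trans (sum≈Σ< n weight⁺-toℕ) (≈-trans (≈-sym truncate) (Σ<-flatten (suc (n / d)) d weight⁺))
      where
      k = suc (n / d) ℕ.* d ℕ.∸ n
      truncate : Σ< (suc (n / d) ℕ.* d) weight⁺ ≈ Σ< n weight⁺
      truncate = ≈-trans (≈-reflexive (cong (λ x → Σ< x weight⁺) (≡.sym (ℕ.m+[n∸m]≡n n≤m*d))))
        (≈-trans (Σ<-split n k weight⁺)
            (≈-trans (+-congˡ (≈-trans (Σ<-cong k λ i _ → weight⁺-≥ (ℕ.≤⇒≯ (ℕ.m≤m+n n i))) (Σ<-zero k))) (+-identityʳ _)))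

    picked-weight : ∀ i → Σ< (suc (n / d))
        (λ b → Σ< d (λ j → weight⁺ (b ℕ.* d ℕ.+ j) * indicator (b ℕ.* d ℕ.+ j) (toℕ i))) ≈ weight v α A i
    picked-weight i = ≈-trans (≈-sym (Σ<-flatten (suc (n / d)) d (λ r → weight⁺ r * indicator r (toℕ i))))
      (≈-trans (Σ<-single _ (ℕ.<-≤-trans (Fin.toℕ<n i) n≤m*d) λ r r≢i →
          ≈-trans (*-congˡ (≈-reflexive (cong (λ b → if b then 1# else 0#) (dec-false (r ℕ.≟ toℕ i) r≢i)))) (zeroʳ _))
        (≈-trans (*-congˡ (≈-reflexive (cong (λ b → if b then 1# else 0#) (dec-true (toℕ i ℕ.≟ toℕ i) refl))))
          (≈-trans (*-identityʳ _) (≈-sym (weight⁺-toℕ i)))))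

    module _ (distribution : 𝒟-IsDistribution v α A) where

      W = sum (weight v α A)

      W*W⁻¹≈1 : W * W ⁻¹ ≈ 1#
      W*W⁻¹≈1 = ⁻¹-inverseʳ (proj₁ distribution)

      -- The inverse total is the witness of the common sign, since its product with a weight is a
      -- value of `𝒟`. Its own inverse is `W`, so the pair can play `z` and `z⁻¹` in the search.
      0≤W⁻¹*weight⁺ : ∀ r → 0# ≤ W ⁻¹ * weight⁺ r
      0≤W⁻¹*weight⁺ r = nonNegative (r ℕ.<? n)
        where
        nonNegative : Dec (r ℕ.< n) → 0# ≤ W ⁻¹ * weight⁺ r
        nonNegative (no r≮n)  = ≤-reflexive (≈-sym (≈-trans (*-congˡ (weight⁺-≥ r≮n)) (zeroʳ _)))
        nonNegative (yes r<n) = subst (λ r → 0# ≤ W ⁻¹ * weight⁺ r) (Fin.toℕ-fromℕ< r<n)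
          (≤-respʳ-≈ (≈-trans (*-comm _ _) (*-congˡ (weight⁺-toℕ (fromℕ< r<n)))) (proj₂ distribution (fromℕ< r<n)))

      probability : ∀ {τ} →
        Distributed (Σ< (suc (n / d)) blockWeight)
          (λ i → Σ< (suc (n / d)) (λ b → Σ< d (λ j → weight⁺ (b ℕ.* d ℕ.+ j) * indicator (b ℕ.* d ℕ.+ j) i))) (io 0) τ →
        ∀ i → Pr τ (io 0) (toℕ i) ≈ 𝒟 v α A i
      probability {τ} distributed i = begin
        p                     ≈⟨ *-identityˡ p ⟨
        1# * p                ≈⟨ *-congʳ (≈-trans (*-comm _ _) W*W⁻¹≈1) ⟨
        W ⁻¹ * W * p          ≈⟨ *-assoc _ _ _ ⟩
        W ⁻¹ * (W * p)        ≈⟨ *-congˡ (*-congʳ total-weight) ⟩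
        W ⁻¹ * (_ * p)        ≈⟨ *-congˡ (≈-trans (distributed (toℕ i)) (picked-weight i)) ⟩
        W ⁻¹ * weight v α A i ≈⟨ *-comm _ _ ⟩
        𝒟 v α A i             ∎
        where
        open SetoidReasoning setoid
        p = Pr τ (io 0) (toℕ i)

-- Memory of the data structure

module Space {c ℓ₁ ℓ₂ : Level} (ℝ : RealNumbers c ℓ₁ ℓ₂)
  (M : RealNumbers.Carrier ℝ) (0≤M : RealNumbers._≤_ ℝ (RealNumbers.0# ℝ) M)
  {n d : ℕ} .{{_ : ℕ.NonZero d}} (v : Fin n → Fin d → RealNumbers.Carrier ℝ) (α : Fin n → RealNumbers.Carrier ℝ)
  (multiply : Program) where

  open RealNumbers ℝ hiding (zero)
    renaming (refl to ≈-refl; sym to ≈-sym; trans to ≈-trans; reflexive to ≈-reflexive)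
  open RealRAM ℝ
  open Loops.Blocks ℝ M 0≤M v α using (Stored)
  open Algorithm ℝ M 0≤M v α multiply
  open Stored
  open Rep
  open SameMemory

  -- `Rep` reads three registers and parts of three real arrays. The largest part is that of `gram`,
  -- where d ≤ n gives d² ≤ n d for one matrix and at most 2 n d for the other `m`.
  Rep-occupies : ∀ C k → T (59 ℕ.<ᵇ C) → OccupiesOnly (C ℕ.+ k) ((C ℕ.+ k) ℕ.* (n ℕ.* d)) Rep
  Rep-occupies C k 59<C s s′ same r = record
    { stored  = record
      { count≡        = ≡.trans (≡.sym (sameRegs same 1 (name 1))) (count≡ (stored r))
      ; dim≡          = ≡.trans (≡.sym (sameRegs same 2 (name 2))) (dim≡ (stored r))
      ; vectors≈      = λ i j i<n j<d →
          ≈-trans (≈-sym (sameReals same 40 _ (name 40)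
              (cell 1 (ℕ.≤-trans (i*d+j<m*d i<n j<d) (ℕ.≤-reflexive (≡.sym (ℕ.+-identityʳ _)))))))
                          (vectors≈ (stored r) i j i<n j<d)
      ; coefficients≈ = λ i i<n → ≈-trans
          (≈-sym (sameReals same 41 _ (name 41)
              (cell 1 (ℕ.<-≤-trans i<n (ℕ.≤-trans (ℕ.m≤m*n n d) (ℕ.≤-reflexive (≡.sym (ℕ.+-identityʳ _))))))))
                          (coefficients≈ (stored r) i i<n)
      }
    ; blocks≡ = ≡.trans (≡.sym (sameRegs same 3 (name 3))) (blocks≡ r)
    ; gram≈   = λ d≤n i i< → ≈-trans (≈-sym (sameReals same 42 _ (name 42) (cell 3 (ℕ.<-≤-trans i< (gram-size d≤n)))))
        (gram≈ r d≤n i i<)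
    }
    where
    name : ∀ j {_ : T (j ℕ.<ᵇ 60)} → j ℕ.< C ℕ.+ k
    name j {j<60} = ℕ.<-≤-trans (ℕ.<ᵇ⇒< j 60 j<60) (ℕ.≤-trans (ℕ.<ᵇ⇒< 59 C 59<C) (ℕ.m≤m+n C k))
    cell : ∀ j {_ : T (j ℕ.<ᵇ 60)} {i} → i ℕ.< j ℕ.* (n ℕ.* d) → i ℕ.< (C ℕ.+ k) ℕ.* (n ℕ.* d)
    cell j {j<60} i< = ℕ.<-≤-trans i< (ℕ.*-monoˡ-≤ (n ℕ.* d) (ℕ.<⇒≤ (name j {j<60})))
    gram-size : d ℕ.≤ n → suc m ℕ.* N ℕ.≤ 3 ℕ.* (n ℕ.* d)
    gram-size d≤n = ℕ.+-mono-≤ (ℕ.*-monoˡ-≤ d d≤n) (ℕ.≤-trans (ℕ.≤-reflexive (≡.sym (ℕ.*-assoc m d d)))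
      (ℕ.≤-trans (ℕ.*-monoˡ-≤ d ([1+n/d]*d≤2*n n d d≤n)) (ℕ.≤-reflexive (ℕ.*-assoc 2 n d))))

theorem7p8 : ∀ {c ℓ₁ ℓ₂} (ℝ : RealNumbers c ℓ₁ ℓ₂) →
    let open RealNumbers ℝ
        open RealRAM ℝ
    in
    ∀ ω → fromℕ 2 ≤ ω → MatMulInTime ω →
    ∃[ init ] ∃[ query ] ∃[ K ]
    ∀ n d .{{_ : ℕ.NonZero n}} .{{_ : ℕ.NonZero d}} (v : Fin n → Vect d) (α : Vect n) →
    ∃[ Rep ] (OccupiesOnly {c ⊔ ℓ₁ ⊔ ℓ₂} K (K ℕ.* (n ℕ.* d)) Rep
      × (∀ s → InitInput v α s →
          init from s inTime fromℕ K * (fromℕ n * fromℕ d ^ (ω - 1#))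
            ensures Leaves Rep)
      × (∀ s A → Rep s → HoldsMatrix (io 0) A s → PSD A → 𝒟-IsDistribution v α A →
          query from s
            inTime fromℕ K * (fromℕ (d ℕ.^ 2 ℕ.* ⌊log₂ n / d ⌋) + fromℕ d ^ ω)
            ensures (λ τ → (∀ i → Pr τ (io 0) (toℕ i) ≈ 𝒟 v α A i) × Leaves Rep τ)))
theorem7p8 {c} {ℓ₁} {ℓ₂} ℝ ω 2≤ω (multiply , L , correct) =
  -- 200 is a round number above all constants for unit steps (a query needs at most 156, reached at
  -- d = 1) and above all numbers of names; 2L pays for the calls.
  init multiply , query multiply , 200 ℕ.+ 2 ℕ.* L , dataStructure
  where
  open RealNumbers ℝ
  open RealRAM ℝ
  open Semantics ℝ using (Leaves-map; module Logic)

  module _ (n d : ℕ) .{{_ : ℕ.NonZero n}} .{{_ : ℕ.NonZero d}} (v : Fin n → Vect d) (α : Vect n) where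

    open Time ℝ ω 2≤ω L d using (M; 0≤M; initTime-≤; queryTime-real-≤)
    open Logic M 0≤M using (Runs-inTime)
    open Algorithm ℝ M 0≤M v α multiply using (Rep; module Query)
    open Preprocessing ℝ M 0≤M v α multiply using (init-small; init-large)

    Rep′ : State → Set (c ⊔ ℓ₁ ⊔ ℓ₂)
    Rep′ s = Lift (c ⊔ ℓ₂) (Rep s)

    initialised : ∀ s → InitInput v α s →
      init multiply from s inTime fromℕ (200 ℕ.+ 2 ℕ.* L) * (fromℕ n * fromℕ d ^ (ω - 1#)) ensures Leaves Rep′
    initialised s input = [ large , small ]′ (ℕ.≤-<-connex d n)
      where
      large : d ℕ.≤ n → _
      large d≤n = Runs-inTime (init-large (correct d) d≤n input)
        (initTime-≤ {n} {initTime n d (suc (buildTime (d ℕ.* d) (suc (n / d))))} {suc (n / d)} 200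
            (initTime-large-≤ n d (suc (n / d)) d≤n ([1+n/d]*d≤2*n n d d≤n)) ([1+n/d]*d≤2*n n d d≤n))
        (Leaves-map lift)
      small : n ℕ.< d → _
      small n<d = Runs-inTime (init-small (correct d) n<d input)
          (initTime-≤ {n} {initTime n d 2} {0} 200 (initTime-small-≤ n d) ℕ.z≤n) (Leaves-map lift)

    module _ (s : State) (A : Matrix d d) where

      open Correctness ℝ v α A (State.reals s (io 0))

      sampled : Rep′ s → HoldsMatrix (io 0) A s → 𝒟-IsDistribution v α A →
        query multiply from s inTime fromℕ (200 ℕ.+ 2 ℕ.* L) * (fromℕ (d ℕ.^ 2 ℕ.* ⌊log₂ n / d ⌋) + fromℕ d ^ ω)
          ensures (λ τ → (∀ i → Pr τ (io 0) (toℕ i) ≈ 𝒟 v α A i) × Leaves Rep′ τ)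
      sampled (lift rep) holds distribution = Runs-inTime
        (Query.query-sound (State.reals s (io 0)) (correct d) (W*W⁻¹≈1 holds distribution)
          (0≤W⁻¹*weight⁺ holds distribution) rep (λ _ → ≡.refl))
        (queryTime-real-≤ {d ℕ.^ 2 ℕ.* ⌊log₂ n / d ⌋} {queryTime d ⌊log₂ n / d ⌋} 200 (queryTime-≤ d ⌊log₂ n / d ⌋))
        (λ {τ} (distributed , ls) → probability holds distribution {τ} distributed , Leaves-map lift ls)

    dataStructure = Rep′ ,
      (λ { s s′ same (lift r) → lift (Space.Rep-occupies ℝ M 0≤M v α multiply 200 (2 ℕ.* L) _ s s′ same r) }) ,
      initialised , (λ s A r holds _ distribution → sampled s A r holds distribution)
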